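{- Let $P\subseteq\mathbb{R}^n$ be an $n$-dimensional lattice polytope which is not unimodularly equivalent to $\Delta_n$. Define \[d(P):=\begin{cases} 2\,(n-\lfloor \mu(P)\rfloor) & \text{if } \mu(P)\notin\mathbb{N},\\ 2\,(n-\mu(P))+1 & \text{if } \mu(P)\in\mathbb{N}.\end{cases}\] If $n>d(P)$, then $P$ is unimodularly equivalent to a Cayley sum $P_0*\cdots*P_t$ of lattice polytopes $P_0,\dots,P_t\subseteq\mathbb{R}^m$ with $m\le d(P)$.
   Context: Write $P$ irredundantly as $P=\{x\in\mathbb{R}^n:\langle a_i,x\rangle\ge b_i,\ i=1,\dots,m'\}$ with primitive $a_i\in(\mathbb{Z}^n)^*$, $b_i\in\mathbb{Q}$, each inequality defining a facet of $P$. Put $d_P(x):=\min_i(\langle a_i,x\rangle-b_i)$ and, for $s\ge 0$, $P^{(s)}:=\{x\in\mathbb{R}^n: d_P(x)\ge s\}$. The $\mathbb{Q}$-codegree is $\mu(P):=(\sup\{s>0: P^{(s)}\neq\emptyset\})^{ -1}$. $\Delta_n=\mathrm{conv}(0,e_1,\dots,e_n)$ is the unimodular simplex. Two lattice polytopes are unimodularly equivalent if an affine lattice automorphism of $\mathbb{Z}^n$ maps one onto the other. For lattice polytopes $P_0,\dots,P_t\subseteq\mathbb{R}^k$, the Cayley sum $P_0*\cdots*P_t$ is the convex hull of $(P_0\times 0)\cup(P_1\times e_1)\cup\cdots\cup(P_t\times e_t)$ in $\mathbb{R}^k\times\mathbb{R}^t$, where $e_1,\dots,e_t$ is the standard basis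 of $\mathbb{R}^t$; "$P$ is unimodularly equivalent to $P_0*\cdots*P_t$" means there is an affine lattice basis identifying $\mathbb{Z}^n\cong\mathbb{Z}^k\times\mathbb{Z}^t$ under which $P$ becomes this Cayley sum. -}

module Defs where

open import Algebra.Bundles.Raw using (RawMonoid)
import Algebra.Definitions.RawMonoid as RawMonoidDefinitions
open import Data.Fin using (Fin; zero; suc)
import Data.Fin.Properties as Fin
open import Data.Integer as ℤ using (ℤ; +_)
import Data.Integer.Divisibility as ℤ
open import Data.Nat as ℕ using (ℕ; zero; suc)
import Data.Nat.Properties as ℕ
open import Data.Product using (∃; ∃-syntax; _×_; _,_)
open import Data.Rational as ℚ using (ℚ; 0ℚ; 1ℚ; ½)
import Data.Rational.Properties as ℚ
open import Data.Rational.Solver using (module +-*-Solver)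
open import Data.Vec.Functional using (Vector; _++_)
open import Level using (0ℓ)
open import Relation.Binary.PropositionalEquality using (_≡_; _≢_; _≗_; refl; sym; trans; cong; cong₂; subst)
open import Relation.Nullary using (¬_; yes; no)
open import Relation.Unary using (Pred; _∈_; _∩_; _≐_; ⋂; Satisfiable)

-- Real numbers as Cauchy sequences of rationals, up to the equivalence _≈_.
-- Operations are computed termwise.

IsCauchy : (ℕ → ℚ) → Set
IsCauchy x = ∀ ε → 0ℚ ℚ.< ε →
  ∃[ N ] (∀ i j → N ℕ.≤ i → N ℕ.≤ j → ℚ.∣ x i ℚ.- x j ∣ ℚ.≤ ε)

record ℝ : Set where
  constructor mkℝ
  field
    seq    : ℕ → ℚ
    cauchy : IsCauchy seq

open ℝ public

infix 4 _≈_ _≤_ _<_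

_≈_ _≤_ _<_ : ℝ → ℝ → Set
x ≈ y = ∀ ε → 0ℚ ℚ.< ε → ∃[ N ] (∀ k → N ℕ.≤ k → ℚ.∣ seq x k ℚ.- seq y k ∣ ℚ.≤ ε)
x ≤ y = ∀ ε → 0ℚ ℚ.< ε → ∃[ N ] (∀ k → N ℕ.≤ k → seq x k ℚ.≤ seq y k ℚ.+ ε)
x < y = ∃[ ε ] (0ℚ ℚ.< ε × ∃[ N ] (∀ k → N ℕ.≤ k → seq x k ℚ.+ ε ℚ.≤ seq y k))

private abstract
  half>0 : ∀ {ε} → 0ℚ ℚ.< ε → 0ℚ ℚ.< ε ℚ.* ½
  half>0 {ε} ε>0 =
    ℚ.positive⁻¹ (ε ℚ.* ½) {{ℚ.pos*pos⇒pos ε {{ℚ.positive ε>0}} ½}}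

  halves : ∀ ε → ε ℚ.* ½ ℚ.+ ε ℚ.* ½ ≡ ε
  halves ε = trans (sym (ℚ.*-distribˡ-+ ε ½ ½)) (ℚ.*-identityʳ ε)

  *-mono-≤⁺ : ∀ {p q r s} → 0ℚ ℚ.≤ r → 0ℚ ℚ.≤ q →
              p ℚ.≤ q → r ℚ.≤ s → p ℚ.* r ℚ.≤ q ℚ.* s
  *-mono-≤⁺ {q = q} {r = r} 0≤r 0≤q p≤q r≤s = ℚ.≤-trans
    (ℚ.*-monoʳ-≤-nonNeg r {{ℚ.nonNegative 0≤r}} p≤q)
    (ℚ.*-monoˡ-≤-nonNeg q {{ℚ.nonNegative 0≤q}} r≤s)

  cauchy-const : ∀ q → IsCauchy (λ _ → q)
  cauchy-const q ε ε>0 = 0 , λ _ _ _ _ →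
    subst (ℚ._≤ ε) (sym (cong ℚ.∣_∣ (ℚ.+-inverseʳ q))) (ℚ.<⇒≤ ε>0)

  cauchy-+ : ∀ {x y} → IsCauchy x → IsCauchy y → IsCauchy (λ k → x k ℚ.+ y k)
  cauchy-+ {x} {y} cx cy ε ε>0 with cx (ε ℚ.* ½) (half>0 ε>0) | cy (ε ℚ.* ½) (half>0 ε>0)
  ... | M , hM | N , hN = M ℕ.⊔ N , λ i j p q → begin
    ℚ.∣ (x i ℚ.+ y i) ℚ.- (x j ℚ.+ y j) ∣
      ≡⟨ cong ℚ.∣_∣ (solve 4 (λ a b c d →
           (a :+ b) :- (c :+ d) := (a :- c) :+ (b :- d)) refl (x i) (y i) (x j) (y j)) ⟩
    ℚ.∣ (x i ℚ.- x j) ℚ.+ (y i ℚ.- y j) ∣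
      ≤⟨ ℚ.∣p+q∣≤∣p∣+∣q∣ (x i ℚ.- x j) (y i ℚ.- y j) ⟩
    ℚ.∣ x i ℚ.- x j ∣ ℚ.+ ℚ.∣ y i ℚ.- y j ∣
      ≤⟨ ℚ.+-mono-≤
           (hM i j (ℕ.≤-trans (ℕ.m≤m⊔n M N) p) (ℕ.≤-trans (ℕ.m≤m⊔n M N) q))
           (hN i j (ℕ.≤-trans (ℕ.m≤n⊔m M N) p) (ℕ.≤-trans (ℕ.m≤n⊔m M N) q)) ⟩
    ε ℚ.* ½ ℚ.+ ε ℚ.* ½
      ≡⟨ halves ε ⟩
    ε ∎
    where
    open ℚ.≤-Reasoning
    open +-*-Solver

  cauchy-neg : ∀ {x} → IsCauchy x → IsCauchy (λ k → ℚ.- x k)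
  cauchy-neg {x} cx ε ε>0 with cx ε ε>0
  ... | N , h = N , λ i j p q → subst (ℚ._≤ ε)
    (trans (sym (ℚ.∣-p∣≡∣p∣ (x i ℚ.- x j)))
           (cong ℚ.∣_∣ (ℚ.neg-distrib-+ (x i) (ℚ.- x j))))
    (h i j p q)

  bounded : ∀ {x} → IsCauchy x →
            ∃[ B ] (0ℚ ℚ.< B × ∃[ N ] (∀ k → N ℕ.≤ k → ℚ.∣ x k ∣ ℚ.≤ B))
  bounded {x} cx with cx 1ℚ (ℚ.positive⁻¹ 1ℚ)
  ... | N , h = ℚ.∣ x N ∣ ℚ.+ 1ℚ
              , ℚ.+-mono-≤-< (ℚ.0≤∣p∣ (x N)) (ℚ.positive⁻¹ 1ℚ)
              , N , λ k N≤k → begin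
    ℚ.∣ x k ∣
      ≡⟨ cong ℚ.∣_∣ (solve 2 (λ a b → a := b :+ (a :- b)) refl (x k) (x N)) ⟩
    ℚ.∣ x N ℚ.+ (x k ℚ.- x N) ∣
      ≤⟨ ℚ.∣p+q∣≤∣p∣+∣q∣ (x N) (x k ℚ.- x N) ⟩
    ℚ.∣ x N ∣ ℚ.+ ℚ.∣ x k ℚ.- x N ∣
      ≤⟨ ℚ.+-monoʳ-≤ ℚ.∣ x N ∣ (h k N N≤k ℕ.≤-refl) ⟩
    ℚ.∣ x N ∣ ℚ.+ 1ℚ ∎
    where
    open ℚ.≤-Reasoning
    open +-*-Solver

  -- for B > 0: an ε′ > 0 with B · ε′ = ε/2
  scaled : ∀ {B ε} → 0ℚ ℚ.< B → 0ℚ ℚ.< ε →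
           ∃[ ε′ ] (0ℚ ℚ.< ε′ × B ℚ.* ε′ ≡ ε ℚ.* ½)
  scaled {B} {ε} B>0 ε>0 = B⁻¹ ℚ.* (ε ℚ.* ½) , ε′>0 , eq
    where
    instance
      B-pos : ℚ.Positive B
      B-pos = ℚ.positive B>0
      B-nonZero : ℚ.NonZero B
      B-nonZero = ℚ.pos⇒nonZero B
    B⁻¹ : ℚ
    B⁻¹ = ℚ.1/ B
    ε′>0 : 0ℚ ℚ.< B⁻¹ ℚ.* (ε ℚ.* ½)
    ε′>0 = ℚ.positive⁻¹ _
      {{ℚ.pos*pos⇒pos B⁻¹ {{ℚ.1/pos⇒pos B}} (ε ℚ.* ½) {{ℚ.positive (half>0 ε>0)}}}}
    eq : B ℚ.* (B⁻¹ ℚ.* (ε ℚ.* ½)) ≡ ε ℚ.* ½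
    eq = trans (sym (ℚ.*-assoc B B⁻¹ (ε ℚ.* ½)))
        (trans (cong (ℚ._* (ε ℚ.* ½)) (ℚ.*-inverseʳ B)) (ℚ.*-identityˡ (ε ℚ.* ½)))

  product-difference : ∀ a b c d →
    a ℚ.* b ℚ.- c ℚ.* d ≡ a ℚ.* (b ℚ.- d) ℚ.+ d ℚ.* (a ℚ.- c)
  product-difference = solve 4 (λ a b c d →
    a :* b :- c :* d := a :* (b :- d) :+ d :* (a :- c)) refl
    where open +-*-Solver

  product-bound : ∀ {A B α β ε} a b c d → 0ℚ ℚ.< A → 0ℚ ℚ.< B →
    A ℚ.* α ≡ ε ℚ.* ½ → B ℚ.* β ≡ ε ℚ.* ½ →
    ℚ.∣ a ∣ ℚ.≤ A → ℚ.∣ d ∣ ℚ.≤ B → ℚ.∣ b ℚ.- d ∣ ℚ.≤ α → ℚ.∣ a ℚ.- c ∣ ℚ.≤ β →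
    ℚ.∣ a ℚ.* b ℚ.- c ℚ.* d ∣ ℚ.≤ ε
  product-bound {A} {B} {α} {β} {ε} a b c d A>0 B>0 Aα Bβ a≤A d≤B b-d≤α a-c≤β = begin
    ℚ.∣ a ℚ.* b ℚ.- c ℚ.* d ∣
      ≡⟨ cong ℚ.∣_∣ (product-difference a b c d) ⟩
    ℚ.∣ a ℚ.* (b ℚ.- d) ℚ.+ d ℚ.* (a ℚ.- c) ∣
      ≤⟨ ℚ.∣p+q∣≤∣p∣+∣q∣ (a ℚ.* (b ℚ.- d)) (d ℚ.* (a ℚ.- c)) ⟩
    ℚ.∣ a ℚ.* (b ℚ.- d) ∣ ℚ.+ ℚ.∣ d ℚ.* (a ℚ.- c) ∣
      ≡⟨ cong₂ ℚ._+_ (ℚ.∣p*q∣≡∣p∣*∣q∣ a (b ℚ.- d)) (ℚ.∣p*q∣≡∣p∣*∣q∣ d (a ℚ.- c)) ⟩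
    ℚ.∣ a ∣ ℚ.* ℚ.∣ b ℚ.- d ∣ ℚ.+ ℚ.∣ d ∣ ℚ.* ℚ.∣ a ℚ.- c ∣
      ≤⟨ ℚ.+-mono-≤
           (*-mono-≤⁺ {ℚ.∣ a ∣} {A} {ℚ.∣ b ℚ.- d ∣} {α}
             (ℚ.0≤∣p∣ (b ℚ.- d)) (ℚ.<⇒≤ A>0) a≤A b-d≤α)
           (*-mono-≤⁺ {ℚ.∣ d ∣} {B} {ℚ.∣ a ℚ.- c ∣} {β}
             (ℚ.0≤∣p∣ (a ℚ.- c)) (ℚ.<⇒≤ B>0) d≤B a-c≤β) ⟩
    A ℚ.* α ℚ.+ B ℚ.* β
      ≡⟨ cong₂ ℚ._+_ Aα Bβ ⟩
    ε ℚ.* ½ ℚ.+ ε ℚ.* ½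
      ≡⟨ halves ε ⟩
    ε ∎
    where open ℚ.≤-Reasoning

  cauchy-* : ∀ {x y} → IsCauchy x → IsCauchy y → IsCauchy (λ k → x k ℚ.* y k)
  cauchy-* {x} {y} cx cy ε ε>0 =
    let A , A>0 , K , hA = bounded cx
        B , B>0 , L , hB = bounded cy
        α , α>0 , Aα     = scaled A>0 ε>0
        β , β>0 , Bβ     = scaled B>0 ε>0
        M , hM           = cx β β>0
        N , hN           = cy α α>0
        K≤ = ℕ.≤-trans (ℕ.m≤m⊔n K L) (ℕ.m≤m⊔n (K ℕ.⊔ L) (M ℕ.⊔ N))
        L≤ = ℕ.≤-trans (ℕ.m≤n⊔m K L) (ℕ.m≤m⊔n (K ℕ.⊔ L) (M ℕ.⊔ N))
        M≤ = ℕ.≤-trans (ℕ.m≤m⊔n M N) (ℕ.m≤n⊔m (K ℕ.⊔ L) (M ℕ.⊔ N))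
        N≤ = ℕ.≤-trans (ℕ.m≤n⊔m M N) (ℕ.m≤n⊔m (K ℕ.⊔ L) (M ℕ.⊔ N))
    in (K ℕ.⊔ L) ℕ.⊔ (M ℕ.⊔ N) , λ i j p q →
      product-bound (x i) (y i) (x j) (y j) A>0 B>0 Aα Bβ
        (hA i (ℕ.≤-trans K≤ p)) (hB j (ℕ.≤-trans L≤ q))
        (hN i j (ℕ.≤-trans N≤ p) (ℕ.≤-trans N≤ q))
        (hM i j (ℕ.≤-trans M≤ p) (ℕ.≤-trans M≤ q))

infixl 6 _+_ _-_
infixl 7 _*_
infix  8 -_

_+_ _*_ : ℝ → ℝ → ℝ
x + y = mkℝ (λ k → seq x k ℚ.+ seq y k) (cauchy-+ {seq x} {seq y} (cauchy x) (cauchy y))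
x * y = mkℝ (λ k → seq x k ℚ.* seq y k) (cauchy-* {seq x} {seq y} (cauchy x) (cauchy y))

-_ : ℝ → ℝ
- x = mkℝ (λ k → ℚ.- seq x k) (cauchy-neg {seq x} (cauchy x))

_-_ : ℝ → ℝ → ℝ
x - y = x + (- y)

fromℚ : ℚ → ℝ
fromℚ q = mkℝ (λ _ → q) (cauchy-const q)

fromℤ : ℤ → ℝ
fromℤ z = fromℚ (z ℚ./ 1)

0ℝ 1ℝ : ℝ
0ℝ = fromℚ 0ℚ
1ℝ = fromℚ 1ℚ

+-0-rawMonoid : RawMonoid 0ℓ 0ℓ
+-0-rawMonoid = record { _≈_ = _≈_ ; _∙_ = _+_ ; ε = 0ℝ }

open RawMonoidDefinitions +-0-rawMonoid public using (sum)
open RawMonoidDefinitions ℤ.+-0-rawMonoid public using () renaming (sum to sumℤ)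

IsSupremum : Pred ℝ 0ℓ → ℝ → Set
IsSupremum S σ =
  (∀ s → s ∈ S → s ≤ σ) × (∀ u → (∀ s → s ∈ S → s ≤ u) → σ ≤ u)

IsFloor : ℝ → ℤ → Set
IsFloor x k = fromℤ k ≤ x × x < fromℤ (k ℤ.+ + 1)

infix 8 ℝ^_ ℤ^_

ℝ^_ ℤ^_ : ℕ → Set
ℝ^ n = Vector ℝ n
ℤ^ n = Vector ℤ n

Subset : ℕ → Set₁
Subset n = Pred (ℝ^ n) 0ℓ

infix 4 _≋_

_≋_ : ∀ {n} → ℝ^ n → ℝ^ n → Set
x ≋ y = ∀ i → x i ≈ y i

ι : ∀ {n} → ℤ^ n → ℝ^ n
ι z i = fromℤ (z i)

⟨_,_⟩ : ∀ {n} → ℤ^ n → ℝ^ n → ℝ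
⟨ a , x ⟩ = sum (λ i → fromℤ (a i) * x i)

combination : ∀ {r n} → Vector ℝ r → Vector (ℝ^ n) r → ℝ^ n
combination c p i = sum (λ j → c j * p j i)

aff conv : ∀ {n} → Subset n → Subset n
aff {n} S x = ∃[ r ] ∃[ c ] ∃[ p ]
  ((∀ (j : Fin r) → p j ∈ S) × sum c ≈ 1ℝ × x ≋ combination {r} {n} c p)
conv {n} S x = ∃[ r ] ∃[ c ] ∃[ p ]
  ((∀ (j : Fin r) → p j ∈ S) × (∀ j → 0ℝ ≤ c j) × sum c ≈ 1ℝ ×
   x ≋ combination {r} {n} c p)

-- A lattice polytope is given by any nonempty finite family of lattice points
-- whose convex hull it is; the generators need not be its vertices.
record LatticePolytope (n : ℕ) : Set where
  field
    size      : ℕ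
    generator : Vector (ℤ^ n) (suc size)

⟦_⟧ : ∀ {n} → LatticePolytope n → Subset n
⟦ P ⟧ = conv (λ x → ∃[ j ] x ≋ ι (LatticePolytope.generator P j))

FullDimensional : ∀ {n} → Subset n → Set
FullDimensional S = ∀ x → x ∈ aff S

-- For n = 0 every d divides all coordinates, so no vector is primitive.
Primitive : ∀ {n} → ℤ^ n → Set
Primitive a = ∀ (d : ℕ) → (∀ i → + d ℤ.∣ a i) → d ≡ 1

halfspace hyperplane : ∀ {n} → ℤ^ n → ℚ → Subset n
halfspace  a b x = fromℚ b ≤ ⟨ a , x ⟩
hyperplane a b x = ⟨ a , x ⟩ ≈ fromℚ b

record FacetDescription {n} (P : Subset n) : Set where
  field
    count       : ℕ
    a           : Vector (ℤ^ n) count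
    b           : Vector ℚ count
    isPrimitive : ∀ i → Primitive (a i)
    describes   : P ≐ ⋂ (Fin count) (λ i → halfspace (a i) (b i))
    irredundant : ∀ i → ∃[ x ] ((∀ j → j ≢ i → x ∈ halfspace (a j) (b j)) ×
                                ⟨ a i , x ⟩ < fromℚ (b i))
    -- the face cut out by each inequality has dimension n − 1
    facet       : ∀ i → aff (P ∩ hyperplane (a i) (b i)) ≐ hyperplane (a i) (b i)

module _ {n} {P : Subset n} (F : FacetDescription P) where
  open FacetDescription F

  -- P⁽ˢ⁾, where minᵢ (⟨aᵢ,x⟩ − bᵢ) ≥ s is spelled out as a condition on each i.
  adjoint : ℝ → Subset n
  adjoint s x = ∀ i → s ≤ ⟨ a i , x ⟩ - fromℚ (b i)

  IsℚCodegree : ℝ → Set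
  IsℚCodegree μ = ∃[ σ ]
    (IsSupremum (λ s → 0ℝ < s × Satisfiable (adjoint s)) σ × μ * σ ≈ 1ℝ)

-- The graph of P ↦ d(P), for n = dim P and μ = μ(P).
data IsD (n : ℕ) (μ : ℝ) : ℤ → Set where
  non-integral : (∀ (k : ℕ) → ¬ (μ ≈ fromℤ (+ k))) → ∀ {⌊μ⌋} → IsFloor μ ⌊μ⌋ →
                 IsD n μ (+ 2 ℤ.* (+ n ℤ.- ⌊μ⌋))
  integral     : ∀ {k : ℕ} → μ ≈ fromℤ (+ k) →
                 IsD n μ (+ 2 ℤ.* (+ n ℤ.- + k) ℤ.+ + 1)

record AffineMap (m n : ℕ) : Set where
  field
    matrix : Vector (ℤ^ m) n
    offset : ℤ^ n

  applyℤ : ℤ^ m → ℤ^ n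
  applyℤ z i = sumℤ (λ j → matrix i j ℤ.* z j) ℤ.+ offset i

  applyℝ : ℝ^ m → ℝ^ n
  applyℝ x i = ⟨ matrix i , x ⟩ + fromℤ (offset i)

MapsOnto : ∀ {m n} → AffineMap m n → Subset m → Subset n → Set
MapsOnto φ P Q =
  (∀ x → x ∈ P → AffineMap.applyℝ φ x ∈ Q) ×
  (∀ y → y ∈ Q → ∃[ x ] (x ∈ P × AffineMap.applyℝ φ x ≋ y))

record AffineLatticeIso (m n : ℕ) : Set where
  field
    to   : AffineMap m n
    from : AffineMap n m
  open AffineMap
  field
    from∘to : ∀ z → applyℤ from (applyℤ to z) ≗ z
    to∘from : ∀ z → applyℤ to (applyℤ from z) ≗ z

infix 4 _≅_

-- Unimodular equivalence. The ambient dimensions are not required to be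
-- syntactically equal, so that ℤⁿ can be identified with ℤᵏ × ℤᵗ = ℤᵏ⁺ᵗ;
-- the lattice isomorphism forces n = k + t.
_≅_ : ∀ {m n} → Subset m → Subset n → Set
_≅_ {m} {n} P Q = ∃[ φ ] MapsOnto (AffineLatticeIso.to {m} {n} φ) P Q

-- 0, e₁, …, eₜ
corner : ∀ {t} → Fin (suc t) → ℤ^ t
corner zero    j = + 0
corner (suc i) j with i Fin.≟ j
... | yes _ = + 1
... | no  _ = + 0

Δ : ∀ n → LatticePolytope n
Δ n = record { size = n ; generator = corner }

Cayley : ∀ {k t} → Vector (LatticePolytope k) (suc t) → Subset (k ℕ.+ t)
Cayley P = conv (λ z → ∃[ i ] ∃[ x ] (x ∈ ⟦ P i ⟧ × z ≋ x ++ ι (corner i)))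

-- Let ηᵢ = ⟨aᵢ , ·⟩ − bᵢ be the lattice distances to the facets of P, which are
-- integral and nonnegative at the generators. LP duality gives rational cᵢ ≥ 0
-- with Σ cᵢ ηᵢ = 1 and Σ cᵢ = μ(P), and Carathéodory's argument makes at most n + 1
-- of them nonzero without decreasing Σ cᵢ. As ηᵢ ≥ 1 at some generator, cᵢ ≤ 1.
-- For S = { i : cᵢ > ½ } the sum of ηᵢ over S is an integer below 2 at every
-- generator, so 1 − Σ_S ηᵢ and the ηᵢ with i ∈ S are integral affine functions
-- with values 0 and 1 that add up to 1. If 1 − Σ_S ηᵢ does not vanish on P, these
-- are |S| + 1 summands, and 2 Σ cᵢ ≤ |S| + (n + 1) gives |S| + 1 ≥ n + 1 − d(P).
-- If it vanishes, minimality of the support forces cᵢ = 1 on S, so that μ(P) ≤ |S|,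
-- and |S| summands suffice unless |S| = n + 1, when P is a unimodular simplex.
-- Differences of generators are dual to the linear parts of t of the t + 1
-- summands, which Euclid's algorithm therefore completes to a basis of the dual
-- lattice; in these coordinates P is a Cayley sum of t + 1 polytopes.

module Submission where

open import Algebra.Bundles using (CommutativeRing)
open import Data.Fin using (Fin; zero; suc; splitAt; _↑ˡ_; _↑ʳ_)
open import Data.Nat as ℕ using (ℕ; zero; suc)
open import Data.Vec.Functional using (Vector; _∷_; _++_; tail; updateAt)

-- The order on `ℝ` is undecidable, so all case distinctions are made on rationals or integers: the
-- linear program behind μ(P) is solved over ℚ, and σ and μ are only compared with its optimal value
-- s afterwards, through s ≤ σ and hence 1/s ≥ μ. Fourier-Motzkin elimination serves as the duality
-- theorem because its multipliers form a finite list that does not depend on the right-hand sides.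
-- The optimum is then a minimum of finitely many rationals and comes with its dual solution. Both
-- cases in the definition of d(P) yield the same strict inequality 2n - d(P) < 2/s; the extra 1 for
-- integral μ(P) pays for the strictness. Nothing else about d(P) enters the final count. The
-- threshold ½ is forced from both sides: above it 2c - 1 > 0, which keeps the sum over S strictly
-- below 2, and up to it 2c ≤ 1, so that an index outside S costs at most one unit in 2 Σ c ≤ |S| +
-- |supp c|.

-- Finite sums and dot products over a commutative ring, for use with ℤ, ℚ and ℝ.

module RingSums {c ℓ} (R : CommutativeRing c ℓ) where

  open CommutativeRing R hiding (zero)
  open import Algebra.Properties.Semiring.Sum semiring public
    using (sum; sum-cong-≋; sum-replicate-zero; ∑-distrib-+; ∑-comm; *-distribˡ-sum; *-distribʳ-sum)
  open import Algebra.Properties.Ring ring using (-1*x≈-x)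
  open import Relation.Binary.Reasoning.Setoid setoid

  sum-cong : ∀ {n} {u v : Vector Carrier n} → (∀ i → u i ≈ v i) → sum u ≈ sum v
  sum-cong = sum-cong-≋

  sum-zero : ∀ {n} {u : Vector Carrier n} → (∀ i → u i ≈ 0#) → sum u ≈ 0#
  sum-zero {n} h = trans (sum-cong h) (sum-replicate-zero n)

  dot : ∀ {n} → Vector Carrier n → Vector Carrier n → Carrier
  dot u v = sum (λ i → u i * v i)

  dot-cong : ∀ {n} {u u′ v v′ : Vector Carrier n} →
             (∀ i → u i ≈ u′ i) → (∀ i → v i ≈ v′ i) → dot u v ≈ dot u′ v′
  dot-cong p q = sum-cong (λ i → *-cong (p i) (q i))

  dot-congˡ : ∀ {n} {u u′ : Vector Carrier n} v → (∀ i → u i ≈ u′ i) → dot u v ≈ dot u′ v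
  dot-congˡ v p = dot-cong p (λ _ → refl)

  dot-congʳ : ∀ {n} u {v v′ : Vector Carrier n} → (∀ i → v i ≈ v′ i) → dot u v ≈ dot u v′
  dot-congʳ u p = dot-cong (λ _ → refl) p

  dot-comm : ∀ {n} (u v : Vector Carrier n) → dot u v ≈ dot v u
  dot-comm u v = sum-cong (λ i → *-comm (u i) (v i))

  dot-+ʳ : ∀ {n} (u v w : Vector Carrier n) → dot u (λ i → v i + w i) ≈ dot u v + dot u w
  dot-+ʳ u v w = trans (sum-cong (λ i → distribˡ (u i) (v i) (w i)))
                       (∑-distrib-+ (λ i → u i * v i) (λ i → u i * w i))

  dot-*ʳ : ∀ {n} k (u v : Vector Carrier n) → dot u (λ i → k * v i) ≈ k * dot u v
  dot-*ʳ k u v = begin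
    sum (λ i → u i * (k * v i)) ≈⟨ sum-cong (λ i → trans (sym (*-assoc (u i) k (v i)))
                                     (trans (*-congʳ (*-comm (u i) k)) (*-assoc k (u i) (v i)))) ⟩
    sum (λ i → k * (u i * v i)) ≈⟨ *-distribˡ-sum k (λ i → u i * v i) ⟨
    k * dot u v ∎

  dot-+ˡ : ∀ {n} (u v w : Vector Carrier n) → dot (λ i → u i + v i) w ≈ dot u w + dot v w
  dot-+ˡ u v w = trans (dot-comm _ w) (trans (dot-+ʳ w u v) (+-cong (dot-comm w u) (dot-comm w v)))

  dot-*ˡ : ∀ {n} k (u v : Vector Carrier n) → dot (λ i → k * u i) v ≈ k * dot u v
  dot-*ˡ k u v = trans (dot-comm _ v) (trans (dot-*ʳ k v u) (*-congˡ (dot-comm v u)))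

  dot-zeroˡ : ∀ {n} {u : Vector Carrier n} v → (∀ i → u i ≈ 0#) → dot u v ≈ 0#
  dot-zeroˡ v h = sum-zero (λ i → trans (*-congʳ (h i)) (zeroˡ (v i)))

  dot-zeroʳ : ∀ {n} u {v : Vector Carrier n} → (∀ i → v i ≈ 0#) → dot u v ≈ 0#
  dot-zeroʳ u h = trans (dot-comm u _) (dot-zeroˡ u h)

  dot-negˡ : ∀ {n} (u v : Vector Carrier n) → dot (λ i → - u i) v ≈ - dot u v
  dot-negˡ u v = begin
    dot (λ i → - u i) v        ≈⟨ dot-congˡ v (λ i → sym (-1*x≈-x (u i))) ⟩
    dot (λ i → - 1# * u i) v   ≈⟨ dot-*ˡ (- 1#) u v ⟩
    - 1# * dot u v             ≈⟨ -1*x≈-x (dot u v) ⟩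
    - dot u v ∎

  dot-assoc : ∀ {m n} (u : Vector Carrier m) (A : Fin m → Vector Carrier n) (v : Vector Carrier n) →
              dot u (λ i → dot (A i) v) ≈ dot (λ j → dot u (λ i → A i j)) v
  dot-assoc u A v = begin
    sum (λ i → u i * sum (λ j → A i j * v j))
      ≈⟨ sum-cong (λ i → *-distribˡ-sum (u i) (λ j → A i j * v j)) ⟩
    sum (λ i → sum (λ j → u i * (A i j * v j)))
      ≈⟨ ∑-comm (λ i j → u i * (A i j * v j)) ⟩
    sum (λ j → sum (λ i → u i * (A i j * v j)))
      ≈⟨ sum-cong (λ j → sum-cong (λ i → sym (*-assoc (u i) (A i j) (v j)))) ⟩
    sum (λ j → sum (λ i → u i * A i j * v j))
      ≈⟨ sum-cong (λ j → sym (*-distribʳ-sum (v j) (λ i → u i * A i j))) ⟩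
    sum (λ j → sum (λ i → u i * A i j) * v j) ∎

  -- Structural recursion instead of a decision of `i ≡ j` lets `dot-δ` and `δ-sym` go by the same
  -- recursion.
  δ : ∀ {n} → Fin n → Vector Carrier n
  δ zero    zero    = 1#
  δ zero    (suc j) = 0#
  δ (suc i) zero    = 0#
  δ (suc i) (suc j) = δ i j

  δ-sym : ∀ {n} (i j : Fin n) → δ i j ≈ δ j i
  δ-sym zero    zero    = refl
  δ-sym zero    (suc j) = refl
  δ-sym (suc i) zero    = refl
  δ-sym (suc i) (suc j) = δ-sym i j

  dot-δ : ∀ {n} (i : Fin n) v → dot (δ i) v ≈ v i
  dot-δ zero v = trans (+-cong (*-identityˡ (v zero)) (dot-zeroˡ (λ j → v (suc j)) (λ _ → refl)))
                       (+-identityʳ (v zero))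
  dot-δ (suc i) v = trans (+-cong (zeroˡ (v zero)) (dot-δ i (λ j → v (suc j))))
                          (+-identityˡ (v (suc i)))

open import Data.Empty using (⊥-elim)
import Data.Fin.Properties as Fin
open import Data.Integer as ℤ using (ℤ)
import Data.Integer.Properties as ℤ
import Data.Integer.Solver as ℤSolver
import Data.Nat.Divisibility as ℕ
import Data.Nat.GCD as ℕ
open import Data.Nat.Induction using (<-wellFounded)
import Data.Nat.Properties as ℕ
open import Data.Product using (∃-syntax; Σ-syntax; _×_; _,_; proj₁; proj₂)
open import Data.Rational as ℚ using (ℚ; 0ℚ; 1ℚ; ½)
import Data.Rational.Properties as ℚ
open import Data.Sum using (_⊎_; inj₁; inj₂; [_,_]; [_,_]′; fromInj₁)
open import Data.Unit using (tt)
open import Data.Vec.Functional.Properties using (updateAt-updates; updateAt-minimal)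
open import Function using (_∘_; id)
open import Induction.WellFounded using (Acc; acc)
open import Level using (0ℓ)
open import Relation.Binary.Definitions using (tri<; tri≈; tri>)
open import Relation.Binary.PropositionalEquality using (_≡_; _≢_; _≗_; refl; sym; trans; cong; cong₂; subst; subst₂; module ≡-Reasoning)
open import Relation.Nullary using (¬_; Dec; yes; no; contradiction; ¬?)
open import Relation.Unary using (_∈_; Satisfiable)


module ℤSums = RingSums ℤ.+-*-commutativeRing

-- Ordered arithmetic of ℚ and the embedding of ℤ.

module RationalArithmetic where
  open import Data.Rational
  open import Data.Rational.Properties
  open import Data.Rational.Solver using (module +-*-Solver)
  import Data.Rational.Unnormalised as ℚᵘ
  import Data.Rational.Unnormalised.Properties as ℚᵘ

  open RingSums +-*-commutativeRing public

  0≤-+ : ∀ {p q} → 0ℚ ≤ p → 0ℚ ≤ q → 0ℚ ≤ p + q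
  0≤-+ = +-mono-≤

  0≤-* : ∀ {p q} → 0ℚ ≤ p → 0ℚ ≤ q → 0ℚ ≤ p * q
  0≤-* {p} {q} hp hq = nonNegative⁻¹ (p * q) {{nonNeg*nonNeg⇒nonNeg p {{nonNegative hp}} q {{nonNegative hq}}}}

  0<-* : ∀ {p q} → 0ℚ < p → 0ℚ < q → 0ℚ < p * q
  0<-* {p} {q} hp hq = positive⁻¹ (p * q) {{pos*pos⇒pos p {{positive hp}} q {{positive hq}}}}

  *-monoˡ : ∀ {r p q} → 0ℚ ≤ r → p ≤ q → r * p ≤ r * q
  *-monoˡ {r} hr = *-monoˡ-≤-nonNeg r {{nonNegative hr}}

  *-monoˡ-< : ∀ {r p q} → 0ℚ < r → p < q → r * p < r * q
  *-monoˡ-< {r} hr = *-monoʳ-<-pos r {{positive hr}}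

  *-cancelˡ-≤ : ∀ {r p q} → 0ℚ < r → r * p ≤ r * q → p ≤ q
  *-cancelˡ-≤ {r} hr = *-cancelˡ-≤-pos r {{positive hr}}

  0≤1 : 0ℚ ≤ 1ℚ
  0≤1 = nonNegative⁻¹ 1ℚ

  0<1 : 0ℚ < 1ℚ
  0<1 = positive⁻¹ 1ℚ

  ≤⇒0≤- : ∀ {p q} → p ≤ q → 0ℚ ≤ q - p
  ≤⇒0≤- {p} {q} h = subst (_≤ q - p) (+-inverseʳ p) (+-monoˡ-≤ (- p) h)

  <⇒0<- : ∀ {p q} → p < q → 0ℚ < q - p
  <⇒0<- {p} {q} h = subst (_< q - p) (+-inverseʳ p) (+-monoˡ-< (- p) h)

  add-sub : ∀ p q → p + (q - p) ≡ q
  add-sub = solve 2 (λ p q → p :+ (q :- p) := q) refl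
    where open +-*-Solver

  0≤-⇒≤ : ∀ {p q} → 0ℚ ≤ q - p → p ≤ q
  0≤-⇒≤ {p} {q} h = subst₂ _≤_ (+-identityʳ p) (add-sub p q) (+-monoʳ-≤ p h)

  0<-⇒< : ∀ {p q} → 0ℚ < q - p → p < q
  0<-⇒< {p} {q} h = subst₂ _<_ (+-identityʳ p) (add-sub p q) (+-monoʳ-< p h)

  0<⇒≢0 : ∀ {p} → 0ℚ < p → p ≢ 0ℚ
  0<⇒≢0 h e = <⇒≢ h (sym e)

  ≤∧≢⇒< : ∀ {p q} → p ≤ q → p ≢ q → p < q
  ≤∧≢⇒< {p} {q} h n with <-cmp p q
  ... | tri< a _ _ = a
  ... | tri≈ _ b _ = contradiction b n
  ... | tri> _ _ c = contradiction (<-≤-trans c h) (<-irrefl refl)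

  0<⊎≡0 : ∀ {p} → 0ℚ ≤ p → 0ℚ < p ⊎ p ≡ 0ℚ
  0<⊎≡0 {p} h with p ≟ 0ℚ
  ... | yes e = inj₂ e
  ... | no ne = inj₁ (≤∧≢⇒< h (λ e → ne (sym e)))

  recip : ∀ {p} → 0ℚ < p → ∃[ q ] (0ℚ < q × p * q ≡ 1ℚ)
  recip {p} h = (1/ p) {{pos⇒nonZero p {{positive h}}}}
    , positive⁻¹ _ {{1/pos⇒pos p {{positive h}}}}
    , *-inverseʳ p {{pos⇒nonZero p {{positive h}}}}

  *-cancel-≢0 : ∀ {p q} → p ≢ 0ℚ → p * q ≡ 0ℚ → q ≡ 0ℚ
  *-cancel-≢0 {p} {q} ne e = begin
    q                 ≡⟨ *-identityˡ q ⟨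
    1ℚ * q            ≡⟨ cong (_* q) (*-inverseˡ p) ⟨
    1/ p * p * q      ≡⟨ *-assoc (1/ p) p q ⟩
    1/ p * (p * q)    ≡⟨ cong (1/ p *_) e ⟩
    1/ p * 0ℚ         ≡⟨ *-zeroʳ (1/ p) ⟩
    0ℚ ∎
    where
    open ≡-Reasoning
    instance
      p≢0 : NonZero p
      p≢0 = ≢-nonZero ne

  sum-mono-≤ : ∀ {n} {u v : Vector ℚ n} → (∀ i → u i ≤ v i) → sum u ≤ sum v
  sum-mono-≤ {zero}  h = ≤-refl
  sum-mono-≤ {suc n} h = +-mono-≤ (h zero) (sum-mono-≤ (λ i → h (suc i)))

  0≤-sum : ∀ {n} {u : Vector ℚ n} → (∀ i → 0ℚ ≤ u i) → 0ℚ ≤ sum u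
  0≤-sum {n} {u} h = subst (_≤ sum u) (sum-replicate-zero n) (sum-mono-≤ h)

  term≤sum : ∀ {n} {u : Vector ℚ n} → (∀ i → 0ℚ ≤ u i) → ∀ i → u i ≤ sum u
  term≤sum {suc n} {u} h zero = subst (_≤ sum u) (+-identityʳ (u zero))
    (+-monoʳ-≤ (u zero) (0≤-sum (λ i → h (suc i))))
  term≤sum {suc n} {u} h (suc i) = ≤-trans (term≤sum (λ j → h (suc j)) i)
    (subst (_≤ sum u) (+-identityˡ _) (+-monoˡ-≤ _ (h zero)))

  sum-nonneg-zero : ∀ {n} {u : Vector ℚ n} → (∀ i → 0ℚ ≤ u i) → sum u ≡ 0ℚ → ∀ i → u i ≡ 0ℚ
  sum-nonneg-zero h e i = ≤-antisym (subst (_ ≤_) e (term≤sum h i)) (h i)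

  0≤-dot : ∀ {n} {u v : Vector ℚ n} → (∀ i → 0ℚ ≤ u i) → (∀ i → 0ℚ ≤ v i) → 0ℚ ≤ dot u v
  0≤-dot hu hv = 0≤-sum (λ i → 0≤-* (hu i) (hv i))

  -- Serves both the ratio tests of linear programming and, with a constant `f`, as plain decidable
  -- search.
  argmin : ∀ {n} {P : Fin n → Set} → (∀ i → Dec (P i)) → (f : Fin n → ℚ) →
           (∀ i → ¬ P i) ⊎ (∃[ i ] (P i × (∀ j → P j → f i ≤ f j)))
  argmin {zero} P? f = inj₁ λ ()
  argmin {suc n} P? f with P? zero | argmin (λ i → P? (suc i)) (λ i → f (suc i))
  ... | no ¬p | inj₁ none = inj₁ λ { zero → ¬p ; (suc i) → none i }
  ... | yes p | inj₁ none = inj₂ (zero , p , λ { zero _ → ≤-refl ; (suc j) q → contradiction q (none j) })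
  ... | no ¬p | inj₂ (i , q , h) = inj₂ (suc i , q , λ { zero p → contradiction p ¬p ; (suc j) r → h j r })
  ... | yes p | inj₂ (i , q , h) with ≤-total (f zero) (f (suc i))
  ...   | inj₁ le = inj₂ (zero , p , λ { zero _ → ≤-refl ; (suc j) r → ≤-trans le (h j r) })
  ...   | inj₂ le = inj₂ (suc i , q , λ { zero _ → le ; (suc j) r → h j r })

  -- Normalisation by gcds keeps `z / 1` from computing for a variable `z`; laws of the embedding
  -- are therefore checked on unnormalised fractions.
  toℚᵘ-/1 : ∀ z → toℚᵘ (z / 1) ℚᵘ.≃ ℚᵘ.mkℚᵘ z 0
  toℚᵘ-/1 z = toℚᵘ-fromℚᵘ (ℚᵘ.mkℚᵘ z 0)

  /1-+ : ∀ x y → (x ℤ.+ y) / 1 ≡ x / 1 + y / 1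
  /1-+ x y = toℚᵘ-injective (ℚᵘ.≃-trans (toℚᵘ-/1 (x ℤ.+ y)) (ℚᵘ.≃-sym
    (ℚᵘ.≃-trans (toℚᵘ-homo-+ (x / 1) (y / 1))
      (ℚᵘ.≃-trans (ℚᵘ.+-cong (toℚᵘ-/1 x) (toℚᵘ-/1 y))
        (ℚᵘ.*≡* (cong (ℤ._* ℤ.+ 1) (cong₂ ℤ._+_ (ℤ.*-identityʳ x) (ℤ.*-identityʳ y))))))))

  /1-* : ∀ x y → (x ℤ.* y) / 1 ≡ x / 1 * (y / 1)
  /1-* x y = toℚᵘ-injective (ℚᵘ.≃-trans (toℚᵘ-/1 (x ℤ.* y)) (ℚᵘ.≃-sym
    (ℚᵘ.≃-trans (toℚᵘ-homo-* (x / 1) (y / 1))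
      (ℚᵘ.≃-trans (ℚᵘ.*-cong (toℚᵘ-/1 x) (toℚᵘ-/1 y)) ℚᵘ.≃-refl))))

  /1-mono-≤ : ∀ {x y} → x ℤ.≤ y → x / 1 ≤ y / 1
  /1-mono-≤ {x} {y} h = toℚᵘ-cancel-≤ (ℚᵘ.≤-respˡ-≃ (ℚᵘ.≃-sym (toℚᵘ-/1 x)) (ℚᵘ.≤-respʳ-≃ (ℚᵘ.≃-sym (toℚᵘ-/1 y))
    (ℚᵘ.*≤* (ℤ.*-monoʳ-≤-nonNeg (ℤ.+ 1) h))))

  /1-mono-< : ∀ {x y} → x ℤ.< y → x / 1 < y / 1
  /1-mono-< {x} {y} h = toℚᵘ-cancel-< (ℚᵘ.<-respˡ-≃ (ℚᵘ.≃-sym (toℚᵘ-/1 x)) (ℚᵘ.<-respʳ-≃ (ℚᵘ.≃-sym (toℚᵘ-/1 y))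
    (ℚᵘ.*<* (ℤ.*-monoʳ-<-pos (ℤ.+ 1) h))))

  /1-cancel-< : ∀ {x y} → x / 1 < y / 1 → x ℤ.< y
  /1-cancel-< {x} {y} h with y ℤ.≤? x
  ... | yes y≤x = contradiction (<-≤-trans h (/1-mono-≤ y≤x)) (<-irrefl refl)
  ... | no y≰x = ℤ.≰⇒> y≰x

  /1-cancel-≤ : ∀ {x y} → x / 1 ≤ y / 1 → x ℤ.≤ y
  /1-cancel-≤ {x} {y} h with x ℤ.≤? y
  ... | yes x≤y = x≤y
  ... | no x≰y = contradiction (<-≤-trans (/1-mono-< (ℤ.≰⇒> x≰y)) h) (<-irrefl refl)

  /1-injective : ∀ {x y} → x / 1 ≡ y / 1 → x ≡ y
  /1-injective e = ℤ.≤-antisym (/1-cancel-≤ (≤-reflexive e)) (/1-cancel-≤ (≤-reflexive (sym e)))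

-- Linear programming duality over ℚ by Fourier-Motzkin elimination.

module FourierMotzkin where
  open import Data.Fin using (combine; remQuot)
  open import Data.Fin.Properties using (remQuot-combine)
  open import Data.Rational
  open import Data.Rational.Properties
  open import Data.Rational.Solver using (module +-*-Solver)
  open RationalArithmetic

  -- extended by inv 0 = 0
  inv : ℚ → ℚ
  inv p with p ≟ 0ℚ
  ... | yes _ = 0ℚ
  ... | no p≢0 = (1/ p) {{≢-nonZero p≢0}}

  inv-inverse : ∀ {p} → 0ℚ < p → p * inv p ≡ 1ℚ
  inv-inverse {p} h with p ≟ 0ℚ
  ... | yes e = contradiction e (0<⇒≢0 h)
  ... | no p≢0 = *-inverseʳ p {{≢-nonZero p≢0}}

  pos-part : ∀ p q κ ι → p * ι ≡ 1ℚ → p * (q * ι - κ) ≡ q + - κ * p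
  pos-part p q κ ι e = trans
    (solve 4 (λ p q κ ι → p :* (q :* ι :- κ) := q :* (p :* ι) :+ (:- κ) :* p) refl p q κ ι)
    (cong (_+ - κ * p) (trans (cong (q *_) e) (*-identityʳ q)))
    where open +-*-Solver

  neg-part : ∀ p q p′ q′ ι → p * ι ≡ 1ℚ → p * q′ - p′ * q ≡ p * (q′ + - (q * ι) * p′)
  neg-part p q p′ q′ ι e = trans
    (cong (λ z → p * q′ - p′ * z) (sym (trans (cong (q *_) e) (*-identityʳ q))))
    (solve 5 (λ p q p′ q′ ι → p :* q′ :- p′ :* (q :* (p :* ι)) := p :* (q′ :+ (:- (q :* ι)) :* p′))
      refl p q p′ q′ ι)
    where open +-*-Solver

  -- A row with `p i > 0` bounds the unknown from below by `- q i / p i`. Row `i₀` gives the largest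
  -- of these bounds and the unknown is set equal to it; the rows with `p j < 0` then hold because
  -- each of them has been combined with row `i₀`.
  solve-at-pos : ∀ {L} (p q : Vector ℚ L) i₀ → 0ℚ < p i₀ →
    (∀ i → p i ≡ 0ℚ → 0ℚ ≤ q i) →
    (∀ j → p j < 0ℚ → 0ℚ ≤ p i₀ * q j - p j * q i₀) →
    (∀ i → 0ℚ < p i → q i₀ * inv (p i₀) ≤ q i * inv (p i)) →
    ∀ i → 0ℚ ≤ q i + - (q i₀ * inv (p i₀)) * p i
  solve-at-pos p q i₀ pos hz hn hp i with <-cmp 0ℚ (p i)
  ... | tri< 0<p _ _ = subst (0ℚ ≤_) (pos-part (p i) (q i) _ (inv (p i)) (inv-inverse 0<p))
                         (0≤-* (<⇒≤ 0<p) (≤⇒0≤- (hp i 0<p)))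
  ... | tri≈ _ 0≡p _ = subst (0ℚ ≤_) (trans (sym (+-identityʳ (q i)))
                         (cong (q i +_) (trans (sym (*-zeroʳ (- (q i₀ * inv (p i₀))))) (cong (- (q i₀ * inv (p i₀)) *_) 0≡p))))
                         (hz i (sym 0≡p))
  ... | tri> _ _ p<0 = *-cancelˡ-≤ pos (subst₂ _≤_ (sym (*-zeroʳ (p i₀)))
                         (neg-part (p i₀) (q i₀) (p i) (q i) (inv (p i₀)) (inv-inverse pos)) (hn i p<0))

  solve-one-variable : ∀ {L} (p q : Vector ℚ L) →
    (∀ i → p i ≡ 0ℚ → 0ℚ ≤ q i) →
    (∀ i j → 0ℚ < p i → p j < 0ℚ → 0ℚ ≤ p i * q j - p j * q i) →
    ∃[ t ] (∀ i → 0ℚ ≤ q i + t * p i)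
  solve-one-variable p q hz hpair
    with argmin (λ i → 0ℚ <? p i) (λ i → q i * inv (p i))
  ... | inj₂ (i₀ , pos , min) = - (q i₀ * inv (p i₀)) , solve-at-pos p q i₀ pos hz (λ j → hpair i₀ j pos) min
  -- Without positive coefficients, changing the sign of the unknown turns the upper bounds into
  -- lower ones, and the condition on pairs becomes void.
  ... | inj₁ nopos with argmin (λ i → 0ℚ <? - p i) (λ i → q i * inv (- p i))
  ...   | inj₁ noneg = 0ℚ , λ i → subst (0ℚ ≤_) (sym (trans (cong (q i +_) (*-zeroˡ (p i))) (+-identityʳ (q i))))
                                   (hz i (≤-antisym (≮⇒≥ (nopos i))
                                     (neg-cancel (p i) (≮⇒≥ (noneg i)))))
    where
    neg-cancel : ∀ p → - p ≤ 0ℚ → 0ℚ ≤ p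
    neg-cancel p h = 0≤-⇒≤ (subst (0ℚ ≤_) (solve 1 (λ p → con 0ℚ :- (:- p) := p :- con 0ℚ) refl p) (≤⇒0≤- h))
      where open +-*-Solver
  ...   | inj₂ (i₀ , pos , min) = - t , λ i → subst (0ℚ ≤_) (flip (q i) t (p i)) (sol i)
    where
    t = - (q i₀ * inv (- p i₀))
    neg-zero : ∀ i → - p i ≡ 0ℚ → p i ≡ 0ℚ
    neg-zero i e = neg-injective e
    neg-neg : ∀ p → - p < 0ℚ → 0ℚ < p
    neg-neg p h = 0<-⇒< (subst (0ℚ <_) (solve 1 (λ p → con 0ℚ :- (:- p) := p :- con 0ℚ) refl p) (<⇒0<- h))
      where open +-*-Solver
    flip : ∀ q t p → q + t * - p ≡ q + - t * p
    flip = solve 3 (λ q t p → q :+ t :* (:- p) := q :+ (:- t) :* p) refl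
      where open +-*-Solver
    sol = solve-at-pos (λ i → - p i) q i₀ pos (λ i e → hz i (neg-zero i e))
            (λ j h → contradiction (neg-neg (p j) h) (nopos j)) min

  -- Nonnegative weights cancelling x against y; the zero weights stand for
  -- the pairs that Fourier–Motzkin elimination ignores.
  abstract
    cancelling : ∀ x y → ∃[ α ] ∃[ β ] (0ℚ ≤ α × 0ℚ ≤ β × α * x + β * y ≡ 0ℚ ×
      (x ≡ 0ℚ → ∀ d e → α * d + β * e ≡ d) ×
      (0ℚ < x → y < 0ℚ → ∀ d e → α * d + β * e ≡ x * e - y * d))
    cancelling x y with x ≟ 0ℚ
    ... | yes refl = 1ℚ , 0ℚ , 0≤1 , ≤-refl , cong (0ℚ +_) (*-zeroˡ y)
                   , (λ _ → solve 2 (λ d e → con 1ℚ :* d :+ con 0ℚ :* e := d) refl)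
                   , (λ 0<0 → contradiction 0<0 (<-irrefl refl))
      where open +-*-Solver
    ... | no x≢0 with 0ℚ <? x | y <? 0ℚ
    ...   | yes 0<x | yes y<0 = - y , x , <⇒≤ (neg-antimono-< y<0) , <⇒≤ 0<x
                   , solve 2 (λ x y → (:- y) :* x :+ x :* y := con 0ℚ) refl x y
                   , (λ e → contradiction e x≢0)
                   , (λ _ _ → solve 4 (λ x y d e → (:- y) :* d :+ x :* e := x :* e :- y :* d) refl x y)
      where open +-*-Solver
    ...   | no 0≮x | _ = 0ℚ , 0ℚ , ≤-refl , ≤-refl , cong₂ _+_ (*-zeroˡ x) (*-zeroˡ y)
                   , (λ e → contradiction e x≢0) , (λ h → contradiction h 0≮x)
    ...   | yes _ | no y≮0 = 0ℚ , 0ℚ , ≤-refl , ≤-refl , cong₂ _+_ (*-zeroˡ x) (*-zeroˡ y)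
                   , (λ e → contradiction e x≢0) , (λ _ h → contradiction h y≮0)

  dot-combo : ∀ {M} α β (u v h : Vector ℚ M) →
    dot (λ i → α * u i + β * v i) h ≡ α * dot u h + β * dot v h
  dot-combo α β u v h = trans (dot-+ˡ (λ i → α * u i) (λ i → β * v i) h)
                              (cong₂ _+_ (dot-*ˡ α u h) (dot-*ˡ β v h))

  Nonneg : ∀ {n} → Vector ℚ n → Set
  Nonneg c = ∀ i → 0ℚ ≤ c i

  abstract
    -- Rows are kept as nonnegative multipliers of the `M` original inequalities, not as evaluated
    -- inequalities, so that a row surviving all eliminations is itself a dual solution. The new
    -- rows are indexed by all pairs of old ones.
    eliminate-one : ∀ {M L} (u : Fin L → Vector ℚ M) (p : Vector ℚ M) → (∀ l → Nonneg (u l)) →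
      ∃[ L′ ] Σ[ u′ ∈ (Fin L′ → Vector ℚ M) ]
        ((∀ l → Nonneg (u′ l)) × (∀ l → dot (u′ l) p ≡ 0ℚ) ×
         (∀ h → (∀ l → dot (u l) h ≡ 0ℚ) → ∀ l → dot (u′ l) h ≡ 0ℚ) ×
         (∀ h → (∀ l → 0ℚ ≤ dot (u′ l) h) → ∃[ t ] (∀ l → 0ℚ ≤ dot (u l) (λ i → h i + t * p i))))
    eliminate-one {M} {L} u p u≥0 = L ℕ.* L , (λ l → new (remQuot L l)) , (λ l → new≥0 (remQuot L l))
                            , (λ l → new-p (remQuot L l)) , (λ h e l → new-zero h e (remQuot L l)) , solvable
      where
      x : Fin L → ℚ
      x l = dot (u l) p
      α β : Fin L × Fin L → ℚ
      α (i , j) = proj₁ (cancelling (x i) (x j))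
      β (i , j) = proj₁ (proj₂ (cancelling (x i) (x j)))
      new : Fin L × Fin L → Vector ℚ M
      new (i , j) k = α (i , j) * u i k + β (i , j) * u j k
      new≥0 : ∀ l → Nonneg (new l)
      new≥0 (i , j) k with cancelling (x i) (x j)
      ... | _ , _ , α≥0 , β≥0 , _ = 0≤-+ (0≤-* α≥0 (u≥0 i k)) (0≤-* β≥0 (u≥0 j k))
      new-p : ∀ l → dot (new l) p ≡ 0ℚ
      new-p (i , j) with cancelling (x i) (x j)
      ... | a , b , _ , _ , e , _ = trans (dot-combo a b (u i) (u j) p) e
      new-zero : ∀ h → (∀ l → dot (u l) h ≡ 0ℚ) → ∀ l → dot (new l) h ≡ 0ℚ
      new-zero h e (i , j) = trans (dot-combo (α (i , j)) (β (i , j)) (u i) (u j) h)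
        (cong₂ _+_ (trans (cong (α (i , j) *_) (e i)) (*-zeroʳ (α (i , j))))
                   (trans (cong (β (i , j) *_) (e j)) (*-zeroʳ (β (i , j)))))
      solvable : ∀ h → (∀ l → 0ℚ ≤ dot (new (remQuot L l)) h) →
                 ∃[ t ] (∀ l → 0ℚ ≤ dot (u l) (λ i → h i + t * p i))
      solvable h hyp =
        let t , ht = solve-one-variable x (λ l → dot (u l) h) hz hpair
        in t , λ l → subst (0ℚ ≤_) (sym (trans (dot-+ʳ (u l) h (λ i → t * p i))
                                    (cong (dot (u l) h +_) (dot-*ʳ t (u l) p)))) (ht l)
        where
        hyp′ : ∀ i j → 0ℚ ≤ α (i , j) * dot (u i) h + β (i , j) * dot (u j) h
        hyp′ i j = subst (0ℚ ≤_) (dot-combo (α (i , j)) (β (i , j)) (u i) (u j) h)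
          (subst (λ z → 0ℚ ≤ dot (new z) h) (remQuot-combine i j) (hyp (combine i j)))
        -- A row that already annihilates `p` survives as its pair with itself, with weights 1 and
        -- 0.
        hz : ∀ i → x i ≡ 0ℚ → 0ℚ ≤ dot (u i) h
        hz i e =
          let _ , _ , _ , _ , _ , z , _ = cancelling (x i) (x i)
          in subst (0ℚ ≤_) (z e (dot (u i) h) (dot (u i) h)) (hyp′ i i)
        hpair : ∀ i j → 0ℚ < x i → x j < 0ℚ → 0ℚ ≤ x i * dot (u j) h - x j * dot (u i) h
        hpair i j xi xj =
          let _ , _ , _ , _ , _ , _ , f = cancelling (x i) (x j)
          in subst (0ℚ ≤_) (f xi xj (dot (u i) h) (dot (u j) h)) (hyp′ i j)

  abstract
    -- Farkas' lemma, uniform in the right-hand side: the multipliers depend on `A` alone, and the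
    -- same finite list decides solvability for every `h`. With no columns left they are the unit
    -- vectors.
    eliminate : ∀ {M n} (A : Fin n → Vector ℚ M) →
      ∃[ L ] Σ[ u ∈ (Fin L → Vector ℚ M) ]
        ((∀ l → Nonneg (u l)) × (∀ l k → dot (u l) (A k) ≡ 0ℚ) ×
         (∀ h → (∀ l → 0ℚ ≤ dot (u l) h) →
            ∃[ x ] (∀ i → 0ℚ ≤ h i + dot x (λ k → A k i))))
    eliminate {M} {zero} A = M , δ , δ≥0 , (λ _ ()) ,
      λ h hyp → (λ ()) , λ i → subst (0ℚ ≤_) (trans (dot-δ i h) (sym (+-identityʳ (h i)))) (hyp i)
      where
      δ≥0 : ∀ {n} (i : Fin n) → Nonneg (δ i)
      δ≥0 zero    zero    = 0≤1
      δ≥0 zero    (suc j) = ≤-refl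
      δ≥0 (suc i) zero    = ≤-refl
      δ≥0 (suc i) (suc j) = δ≥0 i j
    eliminate {M} {suc n} A =
      let L , u , u≥0 , uA , sol = eliminate (λ k → A (suc k))
          L′ , u′ , u′≥0 , u′p , u′z , sol′ = eliminate-one u (A zero) u≥0
      in L′ , u′ , u′≥0
         , (λ { l zero → u′p l ; l (suc k) → u′z (A (suc k)) (λ l′ → uA l′ k) l })
         , λ h hyp → let t , ht = sol′ h hyp
                         x , hx = sol (λ i → h i + t * A zero i) ht
                     in (λ { zero → t ; (suc k) → x k })
                        , λ i → subst (0ℚ ≤_) (+-assoc (h i) (t * A zero i) _) (hx i)

  -- For the right-hand side `- s - b`, the multiplier row `u l` with sum `U l` demands
  -- `s * U l ≤ - (u l · b)`. The optimum is therefore the least quotient `κ l`, and the row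
  -- attaining it, divided by `U l`, is the dual solution.
  max-min-duality : ∀ {M n} (A : Fin M → Vector ℚ n) (b : Vector ℚ M) →
    (∀ s → ∃[ x ] (∀ i → s ≤ dot (A i) x - b i)) ⊎
    ∃[ s ] ((∃[ x ] (∀ i → s ≤ dot (A i) x - b i)) ×
      ∃[ c ] (Nonneg c × sum c ≡ 1ℚ × (∀ k → dot c (λ i → A i k) ≡ 0ℚ) × dot c b ≡ - s))
  max-min-duality {M} {n} A b with eliminate (λ k i → A i k)
  ... | L , u , u≥0 , uA , sol = result
    where
    U : Fin L → ℚ
    U l = sum (u l)
    κ : Fin L → ℚ
    κ l = - dot (u l) b * inv (U l)
    shifted : ∀ l s → dot (u l) (λ i → - s - b i) ≡ - dot (u l) b - s * U l
    shifted l s = begin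
      dot (u l) (λ i → - s - b i)
        ≡⟨ dot-+ʳ (u l) (λ _ → - s) (λ i → - b i) ⟩
      dot (u l) (λ _ → - s) + dot (u l) (λ i → - b i)
        ≡⟨ cong₂ _+_ (sym (*-distribʳ-sum (- s) (u l)))
             (trans (dot-comm (u l) _) (trans (dot-negˡ b (u l)) (cong -_ (dot-comm b (u l))))) ⟩
      U l * - s - dot (u l) b
        ≡⟨ solve 3 (λ U s d → U :* (:- s) :- d := (:- d) :- s :* U) refl (U l) s (dot (u l) b) ⟩
      - dot (u l) b - s * U l ∎
      where
      open ≡-Reasoning
      open +-*-Solver
    feasible : ∀ s → (∀ l → 0ℚ < U l → s ≤ κ l) → ∃[ x ] (∀ i → s ≤ dot (A i) x - b i)
    feasible s h =
      let x , hx = sol (λ i → - s - b i) nonneg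
      in x , λ i → 0≤-⇒≤ (subst (0ℚ ≤_)
           (trans (solve 3 (λ s b d → :- s :- b :+ d := d :- b :- s) refl s (b i) (dot x (A i)))
                  (cong (λ z → z - b i - s) (dot-comm x (A i))))
           (hx i))
      where
      open +-*-Solver
      nonneg : ∀ l → 0ℚ ≤ dot (u l) (λ i → - s - b i)
      nonneg l with 0<⊎≡0 (0≤-sum (u≥0 l))
      -- A nonnegative row with sum zero is the zero row and imposes no condition.
      ... | inj₂ U≡0 = ≤-reflexive (sym (dot-zeroˡ _ (sum-nonneg-zero (u≥0 l) U≡0)))
      ... | inj₁ U>0 = subst (0ℚ ≤_) (sym (shifted l s)) (≤⇒0≤- (≤-trans
            (subst₂ _≤_ (*-comm (U l) s) refl (*-monoˡ (<⇒≤ U>0) (h l U>0)))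
            (≤-reflexive (trans (solve 3 (λ U d i → U :* (d :* i) := d :* (U :* i)) refl (U l) (- dot (u l) b) (inv (U l)))
              (trans (cong (- dot (u l) b *_) (inv-inverse U>0)) (*-identityʳ (- dot (u l) b)))))))
    result : _
    result with argmin (λ l → 0ℚ <? U l) κ
    ... | inj₁ none = inj₁ λ s → feasible s (λ l h → contradiction h (none l))
    ... | inj₂ (l , U>0 , min) = inj₂ (κ l , feasible (κ l) min , (λ i → inv (U l) * u l i)
          , (λ i → 0≤-* inv≥0 (u≥0 l i))
          , trans (sym (*-distribˡ-sum (inv (U l)) (u l))) (trans (*-comm (inv (U l)) (U l)) (inv-inverse U>0))
          , (λ k → trans (dot-*ˡ (inv (U l)) (u l) (λ i → A i k)) (trans (cong (inv (U l) *_) (uA l k)) (*-zeroʳ (inv (U l)))))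
          , trans (dot-*ˡ (inv (U l)) (u l) b)
              (solve 2 (λ i d → i :* d := :- ((:- d) :* i)) refl (inv (U l)) (dot (u l) b)))
      where
      open +-*-Solver
      inv≥0 : 0ℚ ≤ inv (U l)
      inv≥0 = *-cancelˡ-≤ U>0 (subst₂ _≤_ (sym (*-zeroʳ (U l))) (sym (inv-inverse U>0)) 0≤1)

-- Support reduction in the manner of Carathéodory.

module Caratheodory where
  open import Data.Rational
  open import Data.Rational.Properties
  open import Data.Rational.Solver using (module +-*-Solver)
  open RationalArithmetic
  open FourierMotzkin

  nonzero# : ℚ → ℕ
  nonzero# q with q ≟ 0ℚ
  ... | yes _ = 0
  ... | no _  = 1

  nonzero#-mono : ∀ p q → (q ≡ 0ℚ → p ≡ 0ℚ) → nonzero# p ℕ.≤ nonzero# q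
  nonzero#-mono p q h with p ≟ 0ℚ | q ≟ 0ℚ
  ... | yes _  | _      = ℕ.z≤n
  ... | no p≢0 | yes e  = contradiction (h e) p≢0
  ... | no _   | no _   = ℕ.≤-refl

  nonzero#-strict : ∀ p q → p ≡ 0ℚ → q ≢ 0ℚ → nonzero# p ℕ.< nonzero# q
  nonzero#-strict p q e ne with p ≟ 0ℚ | q ≟ 0ℚ
  ... | no p≢0 | _     = contradiction e p≢0
  ... | yes _  | yes f = contradiction f ne
  ... | yes _  | no _  = ℕ.≤-refl

  nonzero#≤1 : ∀ q → nonzero# q ℕ.≤ 1
  nonzero#≤1 q with q ≟ 0ℚ
  ... | yes _ = ℕ.z≤n
  ... | no _  = ℕ.≤-refl

  supp# : ∀ {n} → Vector ℚ n → ℕ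
  supp# {zero}  c = 0
  supp# {suc n} c = nonzero# (c zero) ℕ.+ supp# (c ∘ suc)

  supp#-mono : ∀ {n} (c c′ : Vector ℚ n) → (∀ i → c i ≡ 0ℚ → c′ i ≡ 0ℚ) → supp# c′ ℕ.≤ supp# c
  supp#-mono {zero}  c c′ h = ℕ.z≤n
  supp#-mono {suc n} c c′ h = ℕ.+-mono-≤ (nonzero#-mono _ _ (h zero)) (supp#-mono _ _ (h ∘ suc))

  supp#-strict : ∀ {n} (c c′ : Vector ℚ n) → (∀ i → c i ≡ 0ℚ → c′ i ≡ 0ℚ) →
                 ∀ i → c′ i ≡ 0ℚ → c i ≢ 0ℚ → supp# c′ ℕ.< supp# c
  supp#-strict {suc n} c c′ h zero e ne =
    ℕ.+-mono-<-≤ (nonzero#-strict _ _ e ne) (supp#-mono _ _ (h ∘ suc))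
  supp#-strict {suc n} c c′ h (suc i) e ne =
    ℕ.+-mono-≤-< (nonzero#-mono _ _ (h zero)) (supp#-strict _ _ (h ∘ suc) i e ne)

  supp#-zeroing : ∀ {n} (c : Vector ℚ n) i → supp# c ℕ.≤ suc (supp# (updateAt c i (λ _ → 0ℚ)))
  supp#-zeroing {suc n} c zero = ℕ.+-monoˡ-≤ (supp# (c ∘ suc)) (nonzero#≤1 (c zero))
  supp#-zeroing {suc n} c (suc i) = ℕ.≤-trans
    (ℕ.+-monoʳ-≤ (nonzero# (c zero)) (supp#-zeroing (c ∘ suc) i))
    (ℕ.≤-reflexive (ℕ.+-suc (nonzero# (c zero)) _))

  supp#-witness : ∀ {n} (c : Vector ℚ n) → 0 ℕ.< supp# c → ∃[ i ] c i ≢ 0ℚ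
  supp#-witness {suc n} c h with c zero ≟ 0ℚ
  ... | no ne = zero , ne
  ... | yes _ = let i , ne = supp#-witness (c ∘ suc) h in suc i , ne

  δ-diag : ∀ {n} (i : Fin n) → δ i i ≡ 1ℚ
  δ-diag zero    = refl
  δ-diag (suc i) = δ-diag i

  δ-off : ∀ {n} {i j : Fin n} → i ≢ j → δ i j ≡ 0ℚ
  δ-off {i = zero}  {zero}  ne = contradiction refl ne
  δ-off {i = zero}  {suc j} ne = refl
  δ-off {i = suc i} {zero}  ne = refl
  δ-off {i = suc i} {suc j} ne = δ-off (ne ∘ cong suc)

  abstract
    -- Gaussian elimination, where `a` only marks the indices allowed to occur. Nonvanishing of
    -- `a i * v i zero` asks at once for an allowed index and a usable pivot; clearing the first
    -- coordinate costs that one index and one dimension, so the strict inequality is preserved.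
    dependent : ∀ {M N} (v : Fin M → Vector ℚ N) (a : Vector ℚ M) → N ℕ.< supp# a →
      ∃[ d ] ((∃[ i ] d i ≢ 0ℚ) × (∀ i → a i ≡ 0ℚ → d i ≡ 0ℚ) × (∀ k → dot d (λ i → v i k) ≡ 0ℚ))
    dependent {N = zero} v a h =
      let i , ai≢0 = supp#-witness a h
      in δ i , (i , subst (_≢ 0ℚ) (sym (δ-diag i)) 1≢0)
         , (λ j aj≡0 → δ-off {i = i} {j} (λ { refl → ai≢0 aj≡0 })) , λ ()
    dependent {M} {suc N} v a h with argmin (λ i → ¬? (a i * v i zero ≟ 0ℚ)) (λ _ → 0ℚ)
    ... | inj₁ none =
      let d , ne , sup , rel = dependent (λ i k → v i (suc k)) a (ℕ.<-trans (ℕ.n<1+n N) h)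
      in d , ne , sup , λ { zero → sum-zero (vanish d sup) ; (suc k) → rel k }
      where
      vanish : ∀ (d : Vector ℚ M) → (∀ i → a i ≡ 0ℚ → d i ≡ 0ℚ) → ∀ i → d i * v i zero ≡ 0ℚ
      vanish d sup i with a i ≟ 0ℚ | v i zero ≟ 0ℚ
      ... | yes e | _     = trans (cong (_* v i zero) (sup i e)) (*-zeroˡ (v i zero))
      ... | no _  | yes e = trans (cong (d i *_) e) (*-zeroʳ (d i))
      ... | no ne | no nf = ⊥-elim (none i (λ e → nf (*-cancel-≢0 ne e)))
    ... | inj₂ (i₀ , pivot , _) =
      let d , (j , dj≢0) , sup , rel = dependent v′ a′ (ℕ.s≤s⁻¹ (ℕ.≤-trans h (supp#-zeroing a i₀)))
      in result d j dj≢0 sup rel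
      where
      p : ℚ
      p = v i₀ zero
      x : Vector ℚ M
      x i = v i zero
      a′ : Vector ℚ M
      a′ = updateAt a i₀ (λ _ → 0ℚ)
      v′ : Fin M → Vector ℚ N
      v′ i k = p * v i (suc k) + - v i₀ (suc k) * x i
      p≢0 : p ≢ 0ℚ
      p≢0 e = pivot (trans (cong (a i₀ *_) e) (*-zeroʳ (a i₀)))
      a≢0 : a i₀ ≢ 0ℚ
      a≢0 e = pivot (trans (cong (_* p) e) (*-zeroˡ p))
      result : ∀ (d : Vector ℚ M) j → d j ≢ 0ℚ → (∀ i → a′ i ≡ 0ℚ → d i ≡ 0ℚ) → (∀ k → dot d (λ i → v′ i k) ≡ 0ℚ) →
        ∃[ d ] ((∃[ i ] d i ≢ 0ℚ) × (∀ i → a i ≡ 0ℚ → d i ≡ 0ℚ) × (∀ k → dot d (λ i → v i k) ≡ 0ℚ))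
      result d j dj≢0 sup rel = D , (j , Dj≢0) , supD , relD
        where
        open +-*-Solver
        y : ℚ
        y = dot d x
        -- The pivot index re-enters with the coefficient that cancels the first coordinate; scaling
        -- `d` by `p` avoids dividing by the pivot.
        D : Vector ℚ M
        D i = p * d i + - y * δ i₀ i
        d₀≡0 : d i₀ ≡ 0ℚ
        d₀≡0 = sup i₀ (updateAt-updates i₀ a)
        D-off : ∀ {i} → i₀ ≢ i → D i ≡ p * d i
        D-off {i} ne = trans (cong (λ z → p * d i + - y * z) (δ-off ne))
          (trans (cong (λ z → p * d i + z) (*-zeroʳ (- y))) (+-identityʳ (p * d i)))
        Dj≢0 : D j ≢ 0ℚ
        Dj≢0 e = dj≢0 (*-cancel-≢0 p≢0 (trans (sym (D-off λ { refl → dj≢0 d₀≡0 })) e))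
        supD : ∀ i → a i ≡ 0ℚ → D i ≡ 0ℚ
        supD i e with i₀ Fin.≟ i
        ... | yes refl = contradiction e a≢0
        ... | no ne = trans (D-off ne) (trans (cong (p *_)
                (sup i (trans (updateAt-minimal i i₀ a (ne ∘ sym)) e))) (*-zeroʳ p))
        dot-D : ∀ (w : Vector ℚ M) → dot D w ≡ p * dot d w + - y * w i₀
        dot-D w = trans (dot-combo p (- y) d (δ i₀) w) (cong (λ z → p * dot d w + - y * z) (dot-δ i₀ w))
        relD : ∀ k → dot D (λ i → v i k) ≡ 0ℚ
        relD zero = trans (dot-D x) (solve 2 (λ p y → p :* y :+ (:- y) :* p := con 0ℚ) refl p y)
        relD (suc k) = begin
          dot D w                               ≡⟨ dot-D w ⟩
          p * dot d w + - y * w i₀              ≡⟨ solve 4 (λ p s y w → p :* s :+ (:- y) :* w := p :* s :+ (:- w) :* y)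
                                                     refl p (dot d w) y (w i₀) ⟩
          p * dot d w + - w i₀ * y              ≡⟨ cong₂ _+_ (dot-*ʳ p d w) (dot-*ʳ (- w i₀) d x) ⟨
          dot d (λ i → p * w i) + dot d (λ i → - w i₀ * x i)
                                                ≡⟨ dot-+ʳ d (λ i → p * w i) (λ i → - w i₀ * x i) ⟨
          dot d (λ i → v′ i k)                  ≡⟨ rel k ⟩
          0ℚ ∎
          where
          open ≡-Reasoning
          w : Vector ℚ M
          w i = v i (suc k)

  -- The indicator of S takes values in ℚ, so that sums over S are dot products and `[½< c ] - c` is
  -- a direction for support reduction.
  [½<_] : ℚ → ℚ
  [½< q ] with ½ <? q
  ... | yes _ = 1ℚ
  ... | no _  = 0ℚ

  [½<0] : ∀ {q} → q ≡ 0ℚ → [½< q ] ≡ 0ℚ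
  [½<0] refl = refl

  module _ {M G} (E : Fin M → Fin G → ℚ) (E≥0 : ∀ i g → 0ℚ ≤ E i g)
           (E≢0 : ∀ i → ∃[ g ] (0ℚ < E i g)) (Λ : ℚ) where

    -- `E i g` is the distance of generator `g` from facet `i`. The fixed bound `Λ` replaces the
    -- value of the sum because a reduction may increase it.
    record Certificate (c : Vector ℚ M) : Set where
      field
        nonneg : Nonneg c
        unit   : ∀ g → dot c (λ i → E i g) ≡ 1ℚ
        large  : Λ ≤ sum c

    Relation : Vector ℚ M → Set
    Relation d = ∀ g → dot d (λ i → E i g) ≡ 0ℚ

    abstract
      -- Moving from `c` along `d` preserves the equations and does not lower the sum; the ratio
      -- test stops when the first coefficient reaches zero. Some entry of `d` is negative, since
      -- otherwise a nonzero entry and a generator off the corresponding facet would make the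
      -- relation positive there.
      reduce⁺ : ∀ {c} → Certificate c → ∀ d → (∃[ i ] d i ≢ 0ℚ) → (∀ i → c i ≡ 0ℚ → d i ≡ 0ℚ) →
        Relation d → 0ℚ ≤ sum d → ∃[ c′ ] (Certificate c′ × supp# c′ ℕ.< supp# c)
      reduce⁺ {c} cert d (k , dk≢0) sup rel Σd≥0 with argmin (λ i → d i <? 0ℚ) (λ i → c i * inv (- d i))
      ... | inj₁ none = ⊥-elim (<-irrefl refl (<-≤-trans term>0 (subst (d k * E k g ≤_) (rel g)
              (term≤sum (λ i → 0≤-* (d≥0 i) (E≥0 i g)) k))))
        where
        d≥0 : Nonneg d
        d≥0 i = ≮⇒≥ (none i)
        g : Fin G
        g = proj₁ (E≢0 k)
        term>0 : 0ℚ < d k * E k g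
        term>0 = 0<-* (≤∧≢⇒< (d≥0 k) (dk≢0 ∘ sym)) (proj₂ (E≢0 k))
      ... | inj₂ (i₀ , d₀<0 , min) = c′ , cert′ , supp#-strict c c′ sup′ i₀ c′₀≡0
              (λ e → <-irrefl (sup i₀ e) d₀<0)
        where
        open Certificate cert
        t : ℚ
        t = c i₀ * inv (- d i₀)
        c′ : Vector ℚ M
        c′ i = c i + t * d i
        neg>0 : ∀ {q} → q < 0ℚ → 0ℚ < - q
        neg>0 = neg-antimono-<
        inv≥0 : ∀ {q} → 0ℚ < q → 0ℚ ≤ inv q
        inv≥0 {q} h = *-cancelˡ-≤ h (subst₂ _≤_ (sym (*-zeroʳ q)) (sym (inv-inverse h)) 0≤1)
        t≥0 : 0ℚ ≤ t
        t≥0 = 0≤-* (nonneg i₀) (inv≥0 (neg>0 d₀<0))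
        factored : ∀ i → d i < 0ℚ → - d i * (c i * inv (- d i) - t) ≡ c′ i
        factored i h = trans (pos-part (- d i) (c i) t (inv (- d i)) (inv-inverse (neg>0 h)))
          (solve 3 (λ c t d → c :+ (:- t) :* (:- d) := c :+ t :* d) refl (c i) t (d i))
          where open +-*-Solver
        c′₀≡0 : c′ i₀ ≡ 0ℚ
        c′₀≡0 = trans (sym (factored i₀ d₀<0))
          (trans (cong (- d i₀ *_) (+-inverseʳ t)) (*-zeroʳ (- d i₀)))
        c′≥0 : Nonneg c′
        c′≥0 i with d i <? 0ℚ
        ... | yes h = subst (0ℚ ≤_) (factored i h) (0≤-* (<⇒≤ (neg>0 h)) (≤⇒0≤- (min i h)))
        ... | no  h = 0≤-+ (nonneg i) (0≤-* t≥0 (≮⇒≥ h))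
        sup′ : ∀ i → c i ≡ 0ℚ → c′ i ≡ 0ℚ
        sup′ i e = cong₂ _+_ e (trans (cong (t *_) (sup i e)) (*-zeroʳ t))
        cert′ : Certificate c′
        cert′ = record
          { nonneg = c′≥0
          ; unit = λ g → trans (dot-+ˡ c (λ i → t * d i) (λ i → E i g))
              (cong₂ _+_ (unit g) (trans (dot-*ˡ t d (λ i → E i g)) (trans (cong (t *_) (rel g)) (*-zeroʳ t))))
          ; large = ≤-trans large (subst₂ _≤_ (+-identityʳ (sum c))
              (trans (cong (sum c +_) (*-distribˡ-sum t d)) (sym (∑-distrib-+ c (λ i → t * d i))))
              (+-monoʳ-≤ (sum c) (0≤-* t≥0 Σd≥0)))
          }

      reduce : ∀ {c} → Certificate c → ∀ d → (∃[ i ] d i ≢ 0ℚ) → (∀ i → c i ≡ 0ℚ → d i ≡ 0ℚ) →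
        Relation d → ∃[ c′ ] (Certificate c′ × supp# c′ ℕ.< supp# c)
      reduce cert d (k , dk≢0) sup rel with ≤-total 0ℚ (sum d)
      ... | inj₁ Σd≥0 = reduce⁺ cert d (k , dk≢0) sup rel Σd≥0
      ... | inj₂ Σd≤0 = reduce⁺ cert (λ i → - d i)
              (k , λ e → dk≢0 (neg-injective (trans e refl)))
              (λ i e → cong -_ (sup i e))
              (λ g → trans (dot-negˡ d (λ i → E i g)) (cong -_ (rel g)))
              (subst (0ℚ ≤_) (sym sum-neg) (neg-antimono-≤ Σd≤0))
        where
        sum-neg : sum (λ i → - d i) ≡ - sum d
        sum-neg = trans (sum-cong (λ i → sym (*-identityʳ (- d i))))
          (trans (dot-negˡ d (λ _ → 1ℚ)) (cong -_ (sum-cong (λ i → *-identityʳ (d i)))))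

    big : Vector ℚ M → Fin G → ℚ
    big c g = dot (λ i → [½< c i ]) (λ i → E i g)

    abstract
      -- There are two sources of relations inside the support: linear dependence of the `v i` as
      -- long as the support exceeds `N`, and the difference between `c` and the indicator of S when
      -- both satisfy the equations. Descent on the size of the support exhausts both.
      minimise : ∀ {N} (v : Fin M → Vector ℚ N) →
        (∀ d → (∀ k → dot d (λ i → v i k) ≡ 0ℚ) → Relation d) →
        ∀ {c} → Certificate c → Acc ℕ._<_ (supp# c) →
        ∃[ c ] (Certificate c × supp# c ℕ.≤ N ×
          ((∃[ g ] big c g ≢ 1ℚ) ⊎ ((∀ g → big c g ≡ 1ℚ) × (∀ i → [½< c i ] ≡ c i))))
      minimise {N} v rel {c} cert (acc rs) with N ℕ.<? supp# c
      ... | yes N<s =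
        let d , ne , sup , vd = dependent v c N<s
            c′ , cert′ , lt = reduce cert d ne sup (rel d vd)
        in minimise v rel cert′ (rs lt)
      ... | no N≮s with Fin.all? (λ g → big c g ≟ 1ℚ)
      ...   | no ¬all = c , cert , ℕ.≮⇒≥ N≮s , inj₁ (Fin.¬∀⟶∃¬ G _ (λ g → big c g ≟ 1ℚ) ¬all)
      ...   | yes all with Fin.all? (λ i → [½< c i ] ≟ c i)
      ...     | yes fix = c , cert , ℕ.≮⇒≥ N≮s , inj₂ (all , fix)
      -- The indicator of S solves the same equations as `c`, so their difference is a relation; it
      -- stays inside the support because `[½< 0ℚ ]` is zero.
      ...     | no ¬fix =
        let i , ne = Fin.¬∀⟶∃¬ M _ (λ i → [½< c i ] ≟ c i) ¬fix
            c′ , cert′ , lt = reduce cert (λ i → [½< c i ] + - c i)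
              (i , λ e → ne (trans (sym (add-sub (c i) [½< c i ]))
                     (trans (cong (c i +_) e) (+-identityʳ (c i)))))
              (λ i e → cong₂ (λ p q → p + - q) ([½<0] e) e)
              (λ g → trans (dot-+ˡ (λ i → [½< c i ]) (λ i → - c i) (λ i → E i g))
                 (cong₂ _+_ (all g) (trans (dot-negˡ c (λ i → E i g)) (cong -_ (Certificate.unit cert g)))))
        in minimise v rel cert′ (rs lt)

-- Coefficients above ½ and the resulting family of facets.

module Counting where
  open import Data.Rational
  open import Data.Rational.Properties
  open import Data.Rational.Solver using (module +-*-Solver)
  open RationalArithmetic
  open FourierMotzkin
  open Caratheodory

  sum-/1 : ∀ {n} (f : Vector ℤ n) → ℤSums.sum f / 1 ≡ sum (λ i → f i / 1)
  sum-/1 {zero}  f = refl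
  sum-/1 {suc n} f = trans (/1-+ (f zero) (ℤSums.sum (f ∘ suc)))
                           (cong (λ z → f zero / 1 + z) (sum-/1 (f ∘ suc)))

  dot-/1 : ∀ {n} (u v : Vector ℤ n) → ℤSums.dot u v / 1 ≡ dot (λ i → u i / 1) (λ i → v i / 1)
  dot-/1 u v = trans (sum-/1 (λ i → u i ℤ.* v i)) (sum-cong (λ i → /1-* (u i) (v i)))

  suc-/1 : ∀ k → ℤ.+ suc k / 1 ≡ 1ℚ + ℤ.+ k / 1
  suc-/1 k = /1-+ (ℤ.+ 1) (ℤ.+ k)

  -- Stating the enumeration of S through sums of an arbitrary `f` covers both uses: `f = 1` gives
  -- |S| = k, and the distances to a generator give the sum over S.
  enumerate-big : ∀ {M} (c : Vector ℚ M) → ∃[ k ] Σ[ e ∈ (Fin k → Fin M) ]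
    (∀ (f : Vector ℚ M) → sum (λ i → [½< c i ] * f i) ≡ sum (λ j → f (e j)))
  enumerate-big {zero} c = 0 , (λ ()) , λ _ → refl
  enumerate-big {suc M} c with ½ <? c zero | enumerate-big (c ∘ suc)
  ... | yes _ | k , e , h = suc k , (λ { zero → zero ; (suc j) → suc (e j) })
                          , λ f → cong₂ _+_ (*-identityˡ (f zero)) (h (f ∘ suc))
  ... | no _  | k , e , h = k , (λ j → suc (e j))
                          , λ f → trans (cong₂ _+_ (*-zeroˡ (f zero)) (h (f ∘ suc))) (+-identityˡ (sum (λ j → f (suc (e j)))))

  sum-ones : ∀ k → sum {k} (λ _ → 1ℚ) ≡ ℤ.+ k / 1
  sum-ones zero = refl
  sum-ones (suc k) = trans (cong (λ z → 1ℚ + z) (sum-ones k)) (sym (suc-/1 k))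

  2ℚ : ℚ
  2ℚ = 1ℚ + 1ℚ

  double : ∀ x → 2ℚ * x ≡ x + x
  double = solve 1 (λ x → (con 1ℚ :+ con 1ℚ) :* x := x :+ x) refl
    where open +-*-Solver

  0≤[½<] : ∀ q → 0ℚ ≤ [½< q ]
  0≤[½<] q with ½ <? q
  ... | yes _ = 0≤1
  ... | no _  = ≤-refl

  double-½ : ∀ {q} → q ≤ ½ → 2ℚ * q ≤ 1ℚ
  double-½ {q} = *-monoˡ {2ℚ} {q} {½} (nonNegative⁻¹ 2ℚ)

  [½<]≤double : ∀ {q} → 0ℚ ≤ q → 0ℚ ≤ 2ℚ * q - [½< q ]
  [½<]≤double {q} 0≤q with ½ <? q
  ... | yes ½<q = ≤⇒0≤- (*-monoˡ {2ℚ} (nonNegative⁻¹ 2ℚ) (<⇒≤ ½<q))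
  ... | no _    = ≤⇒0≤- (*-monoˡ {2ℚ} (nonNegative⁻¹ 2ℚ) 0≤q)

  [½<]-vanish : ∀ {q x} → (2ℚ * q - [½< q ]) * x ≡ 0ℚ → [½< q ] * x ≡ 0ℚ
  [½<]-vanish {q} {x} e with ½ <? q
  ... | yes ½<q = trans (*-identityˡ x) (*-cancel-≢0 (0<⇒≢0 (<⇒0<- (*-monoˡ-< {2ℚ} (positive⁻¹ 2ℚ) ½<q))) e)
  ... | no _    = *-zeroˡ x

  -- The source of the factor 2 in d(P): an index above ½ is counted twice and needs only
  -- `2 * q ≤ 2`, any other nonzero index is counted once and has `2 * q ≤ 1`.
  double≤[½<]+nonzero# : ∀ {q} → q ≤ 1ℚ → 2ℚ * q ≤ [½< q ] + ℤ.+ nonzero# q / 1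
  double≤[½<]+nonzero# {q} q≤1 with ½ <? q | q ≟ 0ℚ
  ... | yes ½<q | yes refl = contradiction (nonNegative⁻¹ ½) (λ 0≤½ → <-irrefl refl (≤-<-trans 0≤½ ½<q))
  ... | yes _   | no _     = *-monoˡ {2ℚ} (nonNegative⁻¹ 2ℚ) q≤1
  ... | no _    | yes refl = ≤-reflexive refl
  ... | no ½≮q  | no _     = double-½ (≮⇒≥ ½≮q)

  double-sum≤ : ∀ {M} (c : Vector ℚ M) → (∀ i → c i ≤ 1ℚ) →
                2ℚ * sum c ≤ sum (λ i → [½< c i ]) + ℤ.+ supp# c / 1
  double-sum≤ {zero} c h = ≤-refl
  double-sum≤ {suc M} c h = begin
    2ℚ * (c zero + sum (c ∘ suc))        ≡⟨ *-distribˡ-+ 2ℚ (c zero) (sum (c ∘ suc)) ⟩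
    2ℚ * c zero + 2ℚ * sum (c ∘ suc)     ≤⟨ +-mono-≤ (double≤[½<]+nonzero# (h zero)) (double-sum≤ (c ∘ suc) (h ∘ suc)) ⟩
    (b₀ + n₀) + (bs + ns)                ≡⟨ solve 4 (λ a b c d → (a :+ b) :+ (c :+ d) := (a :+ c) :+ (b :+ d)) refl b₀ n₀ bs ns ⟩
    (b₀ + bs) + (n₀ + ns)                ≡⟨ cong (λ z → (b₀ + bs) + z) (/1-+ (ℤ.+ nonzero# (c zero)) (ℤ.+ supp# (c ∘ suc))) ⟨
    (b₀ + bs) + ℤ.+ supp# c / 1 ∎
    where
    open ≤-Reasoning
    open +-*-Solver
    b₀ = [½< c zero ]
    bs = sum (λ i → [½< c (suc i) ])
    n₀ = ℤ.+ nonzero# (c zero) / 1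
    ns = ℤ.+ supp# (c ∘ suc) / 1

  <2⇒≤1 : ∀ {z} → z ℤ.< ℤ.+ 2 → z ℤ.≤ ℤ.1ℤ
  <2⇒≤1 ℤ.-<+ = ℤ.-≤+
  <2⇒≤1 (ℤ.+<+ h) = ℤ.+≤+ (ℕ.s≤s⁻¹ h)

  0≤z≤1 : ∀ {z} → ℤ.0ℤ ℤ.≤ z → z ℤ.≤ ℤ.1ℤ → z ≡ ℤ.0ℤ ⊎ z ≡ ℤ.1ℤ
  0≤z≤1 {ℤ.+ 0} _ _ = inj₁ refl
  0≤z≤1 {ℤ.+ 1} _ _ = inj₂ refl
  0≤z≤1 {ℤ.+ suc (suc _)} _ (ℤ.+≤+ (ℕ.s≤s ()))

  module _ {M G} (E : Fin M → Fin (suc G) → ℤ) (E≥0 : ∀ i g → ℤ.0ℤ ℤ.≤ E i g)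
           (E≢0 : ∀ i → ∃[ g ] (ℤ.0ℤ ℤ.< E i g)) where

    Eℚ : Fin M → Fin (suc G) → ℚ
    Eℚ i g = E i g / 1

    Eℚ≥0 : ∀ i g → 0ℚ ≤ Eℚ i g
    Eℚ≥0 i g = /1-mono-≤ (E≥0 i g)

    Eℚ≢0 : ∀ i → ∃[ g ] (0ℚ < Eℚ i g)
    Eℚ≢0 i = let g , h = E≢0 i in g , /1-mono-< h

    coefficient≤1 : ∀ {c : Vector ℚ M} → Nonneg c → (∀ g → dot c (λ i → Eℚ i g) ≡ 1ℚ) → ∀ i → c i ≤ 1ℚ
    coefficient≤1 {c} c≥0 unit i = let g , h = E≢0 i in begin
      c i             ≡⟨ *-identityʳ (c i) ⟨
      c i * 1ℚ        ≤⟨ *-monoˡ (c≥0 i) (/1-mono-≤ {ℤ.1ℤ} (ℤ.i<j⇒suc[i]≤j h)) ⟩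
      c i * Eℚ i g    ≤⟨ term≤sum (λ j → 0≤-* (c≥0 j) (Eℚ≥0 j g)) i ⟩
      dot c (λ j → Eℚ j g) ≡⟨ unit g ⟩
      1ℚ ∎
      where open ≤-Reasoning

    bigE : Vector ℚ M → Fin (suc G) → ℚ
    bigE c g = dot (λ i → [½< c i ]) (λ i → Eℚ i g)

    -- The defect `2 - bigE c g` is the sum of the nonnegative terms
    -- `(2 * c i - [½< c i ]) * E i g`. If it were zero, all terms would vanish; as `2 * c i > 1` on
    -- S, the distances `E i g` would vanish on S, and `bigE c g` would be 0 instead of 2.
    bigE<2 : ∀ {c : Vector ℚ M} → Nonneg c → (∀ g → dot c (λ i → Eℚ i g) ≡ 1ℚ) → ∀ g → bigE c g < 2ℚ
    bigE<2 {c} c≥0 unit g = ≤∧≢⇒< (0≤-⇒≤ (subst (0ℚ ≤_) D≡ D≥0)) λ e →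
      0<⇒≢0 (positive⁻¹ 2ℚ) (trans (sym e) (bigE≡0 (trans D≡ (trans (cong (λ z → 2ℚ + - z) e) (+-inverseʳ 2ℚ)))))
      where
      w : Vector ℚ M
      w i = 2ℚ * c i - [½< c i ]
      D≥0 : 0ℚ ≤ dot w (λ i → Eℚ i g)
      D≥0 = 0≤-dot (λ i → [½<]≤double (c≥0 i)) (λ i → Eℚ≥0 i g)
      D≡ : dot w (λ i → Eℚ i g) ≡ 2ℚ - bigE c g
      D≡ = trans (dot-+ˡ (λ i → 2ℚ * c i) (λ i → - [½< c i ]) (λ i → Eℚ i g))
        (cong₂ _+_ (trans (dot-*ˡ 2ℚ c (λ i → Eℚ i g)) (trans (cong (2ℚ *_) (unit g)) (*-identityʳ 2ℚ)))
                   (dot-negˡ (λ i → [½< c i ]) (λ i → Eℚ i g)))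
      bigE≡0 : dot w (λ i → Eℚ i g) ≡ 0ℚ → bigE c g ≡ 0ℚ
      bigE≡0 e = sum-zero (λ i → [½<]-vanish {c i}
        (sum-nonneg-zero (λ j → 0≤-* ([½<]≤double (c≥0 j)) (Eℚ≥0 j g)) e i))

    -- In the application `l` is 2n - d(P) and `N` is n + 1. The first bound on `l` comes from 2 Σ c
    -- ≤ |S| + |supp c|; in the second alternative `c` is the indicator of S, so that 2 Σ c = 2k.
    Subfamily : (k : ℕ) → (Fin k → Fin M) → ℕ → ℤ → Set
    Subfamily k e N l = (∀ g → ℤSums.sum (λ j → E (e j) g) ℤ.≤ ℤ.1ℤ) ×
      ((∃[ g ] ℤSums.sum (λ j → E (e j) g) ≡ ℤ.0ℤ) × l ℤ.< ℤ.+ (k ℕ.+ N) ⊎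
       (∀ g → ℤSums.sum (λ j → E (e j) g) ≡ ℤ.1ℤ) × l ℤ.< ℤ.+ (k ℕ.+ k))

    big-subfamily : ∀ {N} {c : Vector ℚ M} → Nonneg c → (∀ g → dot c (λ i → Eℚ i g) ≡ 1ℚ) →
      ∀ {l} → l / 1 < 2ℚ * sum c → ∀ {k} {e : Fin k → Fin M} →
      (∀ (f : Vector ℚ M) → sum (λ i → [½< c i ] * f i) ≡ sum (λ j → f (e j))) →
      supp# c ℕ.≤ N → (∃[ g ] bigE c g ≢ 1ℚ) ⊎ ((∀ g → bigE c g ≡ 1ℚ) × (∀ i → [½< c i ] ≡ c i)) →
      Subfamily k e N l
    big-subfamily {N} {c} c≥0 unit {l} l<double {k} {e} enumerated s≤N alternative = S≤1 , final alternative
      where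
      S : Fin (suc G) → ℤ
      S g = ℤSums.sum (λ j → E (e j) g)
      S-big : ∀ g → bigE c g ≡ S g / 1
      S-big g = trans (enumerated (λ i → Eℚ i g)) (sym (sum-/1 (λ j → E (e j) g)))
      S≤1 : ∀ g → S g ℤ.≤ ℤ.1ℤ
      S≤1 g = <2⇒≤1 (/1-cancel-< {S g} {ℤ.+ 2} (subst (_< 2ℚ) (S-big g) (bigE<2 c≥0 unit g)))
      S≥0 : ∀ g → ℤ.0ℤ ℤ.≤ S g
      S≥0 g = /1-cancel-≤ {ℤ.0ℤ} {S g} (subst (0ℚ ≤_) (S-big g) (0≤-dot (λ i → 0≤[½<] (c i)) (λ i → Eℚ≥0 i g)))
      k-big : sum (λ i → [½< c i ]) ≡ ℤ.+ k / 1
      k-big = trans (sum-cong (λ i → sym (*-identityʳ [½< c i ]))) (trans (enumerated (λ _ → 1ℚ)) (sum-ones k))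
      S≡0 : ∀ g → bigE c g ≢ 1ℚ → S g ≡ ℤ.0ℤ
      S≡0 g ne = fromInj₁ (λ S≡1 → contradiction (trans (S-big g) (cong (_/ 1) S≡1)) ne) (0≤z≤1 (S≥0 g) (S≤1 g))
      final : (∃[ g ] bigE c g ≢ 1ℚ) ⊎ ((∀ g → bigE c g ≡ 1ℚ) × (∀ i → [½< c i ] ≡ c i)) →
              (∃[ g ] S g ≡ ℤ.0ℤ) × l ℤ.< ℤ.+ (k ℕ.+ N) ⊎ (∀ g → S g ≡ ℤ.1ℤ) × l ℤ.< ℤ.+ (k ℕ.+ k)
      final (inj₁ (g , ne)) = inj₁ ((g , S≡0 g ne) , /1-cancel-< {l} {ℤ.+ (k ℕ.+ N)} (begin-strict
        l / 1                                         <⟨ l<double ⟩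
        2ℚ * sum c                                    ≤⟨ double-sum≤ c (coefficient≤1 c≥0 unit) ⟩
        sum (λ i → [½< c i ]) + ℤ.+ supp# c / 1       ≤⟨ +-mono-≤ (≤-reflexive k-big) (/1-mono-≤ {ℤ.+ supp# c} {ℤ.+ N} (ℤ.+≤+ s≤N)) ⟩
        ℤ.+ k / 1 + ℤ.+ N / 1                         ≡⟨ /1-+ (ℤ.+ k) (ℤ.+ N) ⟨
        ℤ.+ (k ℕ.+ N) / 1 ∎))
        where open ≤-Reasoning
      final (inj₂ (all , fix)) = inj₂ ((λ g → /1-injective {S g} {ℤ.1ℤ} (trans (sym (S-big g)) (all g))) , /1-cancel-< {l} {ℤ.+ (k ℕ.+ k)} (begin-strict
        l / 1                                         <⟨ l<double ⟩
        2ℚ * sum c                                    ≡⟨ cong (2ℚ *_) (trans (sum-cong (λ i → sym (fix i))) k-big) ⟩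
        2ℚ * (ℤ.+ k / 1)                              ≡⟨ double (ℤ.+ k / 1) ⟩
        ℤ.+ k / 1 + ℤ.+ k / 1                         ≡⟨ /1-+ (ℤ.+ k) (ℤ.+ k) ⟨
        ℤ.+ (k ℕ.+ k) / 1 ∎))
        where
        open ≤-Reasoning

    abstract
      unit-subfamily : ∀ {N} (v : Fin M → Vector ℚ N) →
        (∀ (d : Vector ℚ M) → (∀ k → dot d (λ i → v i k) ≡ 0ℚ) → ∀ g → dot d (λ i → Eℚ i g) ≡ 0ℚ) →
        ∀ (c : Vector ℚ M) → Nonneg c → (∀ g → dot c (λ i → Eℚ i g) ≡ 1ℚ) →
        ∀ (l : ℤ) → l / 1 < 2ℚ * sum c →
        ∃[ k ] Σ[ e ∈ (Fin k → Fin M) ] Subfamily k e N l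
      unit-subfamily {N} v rel c₀ c₀≥0 unit₀ l l< =
        let c , cert , s≤N , alternative = minimise Eℚ Eℚ≥0 Eℚ≢0 (sum c₀) v rel {c₀}
              (record { nonneg = c₀≥0 ; unit = unit₀ ; large = ≤-refl }) (<-wellFounded (supp# c₀))
            k , e , enumerated = enumerate-big c
        in k , e , big-subfamily (Certificate.nonneg cert) (Certificate.unit cert)
             (<-≤-trans l< (*-monoˡ {2ℚ} (nonNegative⁻¹ 2ℚ) (Certificate.large cert)))
             enumerated s≤N alternative

-- Completing integral linear forms to a basis of the dual lattice.

module UnimodularCompletion where
  open import Data.Integer hiding (suc)
  open import Data.Integer.Properties
  open import Data.Integer.Solver using (module +-*-Solver)
  open ℤSums

  signed-abs : ∀ a → ∃[ s ] (s * s ≡ + 1 × a ≡ s * + ∣ a ∣)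
  signed-abs (+ n)    = + 1 , refl , sym (*-identityˡ (+ n))
  signed-abs -[1+ n ] = - + 1 , refl , sym (-1*i≡-i (+ suc n))

  -- Unlike with gcds, (p, q) is unimodular even when a = b = 0.
  record Bézout (a b : ℤ) : Set where
    field
      g p q α β : ℤ
      a≡ : a ≡ g * p
      b≡ : b ≡ g * q
      unit : α * p + β * q ≡ + 1

  private
    -- The Bézout identity over ℕ avoids subtraction by moving a term to the other side; over ℤ the
    -- term moves back and the common factor `d` cancels.
    pos-eq : ∀ {x m p₀ y q₀} d .{{_ : ℕ.NonZero d}} → m ≡ p₀ ℕ.* d →
             d ℕ.+ y ℕ.* (q₀ ℕ.* d) ≡ x ℕ.* m → + x * + p₀ + - + y * + q₀ ≡ + 1
    pos-eq {x} {_} {p₀} {y} {q₀} d refl eq = *-cancelʳ-≡ _ _ (+ d) (begin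
      (+ x * + p₀ + - + y * + q₀) * + d
        ≡⟨ solve 5 (λ x p y q d → (x :* p :+ (:- y) :* q) :* d := x :* (p :* d) :- y :* (q :* d)) refl (+ x) (+ p₀) (+ y) (+ q₀) (+ d) ⟩
      + x * (+ p₀ * + d) - + y * (+ q₀ * + d)
        ≡⟨ cong₂ (λ u v → u - v) (push x p₀) (push y q₀) ⟩
      + (x ℕ.* (p₀ ℕ.* d)) - + (y ℕ.* (q₀ ℕ.* d))
        ≡⟨ cong (λ z → + z - + (y ℕ.* (q₀ ℕ.* d))) (sym eq) ⟩
      (+ d + + (y ℕ.* (q₀ ℕ.* d))) - + (y ℕ.* (q₀ ℕ.* d))
        ≡⟨ solve 2 (λ d w → d :+ w :- w := con (+ 1) :* d) refl (+ d) (+ (y ℕ.* (q₀ ℕ.* d))) ⟩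
      + 1 * + d ∎)
      where
      open ≡-Reasoning
      open +-*-Solver
      push : ∀ x p → + x * (+ p * + d) ≡ + (x ℕ.* (p ℕ.* d))
      push x p = trans (cong (+ x *_) (sym (pos-* p d))) (sym (pos-* x (p ℕ.* d)))

    signs : ∀ s r p₀ q₀ x y → s * s ≡ + 1 → r * r ≡ + 1 → x * p₀ + y * q₀ ≡ + 1 →
            s * x * (s * p₀) + r * y * (r * q₀) ≡ + 1
    signs s r p₀ q₀ x y ss rr e = trans
      (solve 6 (λ s r p q x y → s :* x :* (s :* p) :+ r :* y :* (r :* q)
                := (s :* s) :* (x :* p) :+ (r :* r) :* (y :* q)) refl s r p₀ q₀ x y)
      (trans (cong₂ (λ u v → u * (x * p₀) + v * (y * q₀)) ss rr)
        (trans (cong₂ _+_ (*-identityˡ (x * p₀)) (*-identityˡ (y * q₀))) e))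
      where open +-*-Solver

    factor : ∀ {a s p₀ d} → a ≡ s * + ∣ a ∣ → ∣ a ∣ ≡ p₀ ℕ.* d → a ≡ + d * (s * + p₀)
    factor {a} {s} {p₀} {d} e f = trans e (trans (cong (λ z → s * + z) f) (trans (cong (s *_) (pos-* p₀ d))
      (solve 3 (λ s p d → s :* (p :* d) := d :* (s :* p)) refl s (+ p₀) (+ d))))
      where open +-*-Solver

  bézout : ∀ a b → Bézout a b
  bézout a b with ℕ.Bézout.lemma ∣ a ∣ ∣ b ∣
  ... | ℕ.Bézout.result zero g _ = record
    { g = + 0 ; p = + 1 ; q = + 0 ; α = + 1 ; β = + 0 ; unit = refl
    ; a≡ = trans (∣i∣≡0⇒i≡0 (ℕ.0∣⇒≡0 (ℕ.GCD.gcd∣m g))) (sym (*-zeroˡ (+ 1)))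
    ; b≡ = trans (∣i∣≡0⇒i≡0 (ℕ.0∣⇒≡0 (ℕ.GCD.gcd∣n g))) (sym (*-zeroˡ (+ 0))) }
  ... | ℕ.Bézout.result d@(suc _) g identity
    with signed-abs a | signed-abs b | ℕ.GCD.gcd∣m g | ℕ.GCD.gcd∣n g
  ...   | s , ss , ea | r , rr , eb | ℕ.divides p₀ ep | ℕ.divides q₀ eq = record
    { g = + d ; p = s * + p₀ ; q = r * + q₀ ; α = s * proj₁ coeffs ; β = r * proj₁ (proj₂ coeffs)
    ; a≡ = factor {a} {s} ea ep ; b≡ = factor {b} {r} eb eq
    ; unit = signs s r (+ p₀) (+ q₀) _ _ ss rr (proj₂ (proj₂ coeffs)) }
    where
    combine : ℕ.Bézout.Identity d ∣ a ∣ ∣ b ∣ → ∃[ x ] ∃[ y ] (x * + p₀ + y * + q₀ ≡ + 1)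
    combine (ℕ.Bézout.+- x y e) = + x , - + y , pos-eq {x} {∣ a ∣} {p₀} {y} {q₀} d ep
            (trans (cong (λ z → d ℕ.+ y ℕ.* z) (sym eq)) e)
    combine (ℕ.Bézout.-+ x y e) = - + x , + y , trans (+-comm (- + x * + p₀) (+ y * + q₀))
            (pos-eq {y} {∣ b ∣} {q₀} {x} {p₀} d eq
              (trans (cong (λ z → d ℕ.+ x ℕ.* z) (sym ep)) e))
    coeffs : ∃[ x ] ∃[ y ] (x * + p₀ + y * + q₀ ≡ + 1)
    coeffs = combine identity

  -- Coordinate changes are built as functions, and their matrices are read off from `coefficients`
  -- afterwards. `value` also replaces function extensionality, by way of `linear-cong`. The map `π`
  -- admits domains such as pairs of vectors.
  record Linear {D : Set} {N} (π : D → Vector ℤ N) (f : D → ℤ) : Set where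
    constructor by
    field
      coefficients : Vector ℤ N
      value : ∀ z → f z ≡ dot coefficients (π z)
  open Linear

  module _ {D : Set} {N} {π : D → Vector ℤ N} where

    linear-coordinate : ∀ i → Linear π (λ z → π z i)
    linear-coordinate i = by (δ i) (λ z → sym (dot-δ i (π z)))

    linear-+ : ∀ {f g} → Linear π f → Linear π g → Linear π (λ z → f z + g z)
    linear-+ (by a p) (by b q) = by (λ i → a i + b i)
      (λ z → trans (cong₂ _+_ (p z) (q z)) (sym (dot-+ˡ a b (π z))))

    linear-* : ∀ k {f} → Linear π f → Linear π (λ z → k * f z)
    linear-* k (by a p) = by (λ i → k * a i) (λ z → trans (cong (k *_) (p z)) (sym (dot-*ˡ k a (π z))))

    linear-dot : ∀ {m} v {F : D → Vector ℤ m} → (∀ i → Linear π (λ z → F z i)) → Linear π (λ z → dot v (F z))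
    linear-dot v lin = by (λ j → dot v (λ i → coefficients (lin i) j))
      (λ z → trans (dot-congʳ v (λ i → value (lin i) z)) (dot-assoc v (λ i → coefficients (lin i)) (π z)))

    linear-∘ : ∀ {D′ : Set} {m} {π′ : D′ → Vector ℤ m} {f} → Linear π′ f → (F : D → D′) →
               (∀ i → Linear π (λ z → π′ (F z) i)) → Linear π (λ z → f (F z))
    linear-∘ (by a p) F lin = let by b q = linear-dot a lin in by b (λ z → trans (p (F z)) (q z))

    linear-cong : ∀ {f} → Linear π f → ∀ {z z′} → π z ≗ π z′ → f z ≡ f z′
    linear-cong (by a p) {z} {z′} e = trans (p z) (trans (dot-congʳ a e) (sym (p z′)))

  record LinearIso {n} (x : Vector ℤ (suc n)) : Set where
    field
      g  : ℤ
      to from : Vector ℤ (suc n) → Vector ℤ (suc n)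
      to-linear   : ∀ i → Linear id (λ z → to z i)
      from-linear : ∀ i → Linear id (λ z → from z i)
      to∘from : ∀ z → to (from z) ≗ z
      from∘to : ∀ z → from (to z) ≗ z
      form : ∀ z → dot x z ≡ g * to z zero

  -- Euclid's algorithm along the coordinates of x.
  straighten : ∀ {n} (x : Vector ℤ (suc n)) → LinearIso x
  straighten {zero} x = record
    { g = x zero ; to = id ; from = id ; to-linear = linear-coordinate ; from-linear = linear-coordinate
    ; to∘from = λ _ _ → refl ; from∘to = λ _ _ → refl ; form = λ z → +-identityʳ (x zero * z zero) }
  straighten {suc n} x = record
    { g = g ; to = to ; from = from ; to-linear = to-linear ; from-linear = from-linear
    ; to∘from = to∘from ; from∘to = from∘to ; form = form }
    where
    module R = LinearIso (straighten (tail x))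
    open Bézout (bézout (x zero) R.g)
    open +-*-Solver
    y : Vector ℤ (suc (suc n)) → Vector ℤ (suc n)
    y z = R.to (tail z)
    y-linear : ∀ i → Linear id (λ z → y z i)
    y-linear i = linear-∘ (R.to-linear i) tail (λ j → linear-coordinate (suc j))
    -- The matrix with rows `(p, q)` and `(- β, α)` has determinant `α * p + β * q = 1`, and its
    -- inverse has rows `(α, - q)` and `(β, p)`. The first row collects `x zero` and `R.g` into
    -- their common factor `g`.
    to from : Vector ℤ (suc (suc n)) → Vector ℤ (suc (suc n))
    to z zero          = p * z zero + q * y z zero
    to z (suc zero)    = - β * z zero + α * y z zero
    to z (suc (suc i)) = y z (suc i)
    inner : Vector ℤ (suc (suc n)) → Vector ℤ (suc n)
    inner w = (β * w zero + p * w (suc zero)) ∷ tail (tail w)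
    from w = (α * w zero + - q * w (suc zero)) ∷ R.from (inner w)
    to-linear : ∀ i → Linear id (λ z → to z i)
    to-linear zero = linear-+ (linear-* p (linear-coordinate zero)) (linear-* q (y-linear zero))
    to-linear (suc zero) = linear-+ (linear-* (- β) (linear-coordinate zero)) (linear-* α (y-linear zero))
    to-linear (suc (suc i)) = y-linear (suc i)
    inner-linear : ∀ i → Linear id (λ w → inner w i)
    inner-linear zero = linear-+ (linear-* β (linear-coordinate zero)) (linear-* p (linear-coordinate (suc zero)))
    inner-linear (suc i) = linear-coordinate (suc (suc i))
    from-linear : ∀ i → Linear id (λ w → from w i)
    from-linear zero = linear-+ (linear-* α (linear-coordinate zero)) (linear-* (- q) (linear-coordinate (suc zero)))
    from-linear (suc i) = linear-∘ (R.from-linear i) inner inner-linear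
    use-unit : ∀ {e w} → e ≡ (α * p + β * q) * w → e ≡ w
    use-unit {e} {w} h = trans h (trans (cong (_* w) unit) (*-identityˡ w))
    to∘from : ∀ z → to (from z) ≗ z
    to∘from w zero = trans (cong (λ u → p * from w zero + q * u) (R.to∘from (inner w) zero))
      (use-unit (solve 6 (λ p q α β a b → p :* (α :* a :+ (:- q) :* b) :+ q :* (β :* a :+ p :* b)
                     := (α :* p :+ β :* q) :* a) refl p q α β (w zero) (w (suc zero))))
    to∘from w (suc zero) = trans (cong (λ u → - β * from w zero + α * u) (R.to∘from (inner w) zero))
      (use-unit (solve 6 (λ p q α β a b → (:- β) :* (α :* a :+ (:- q) :* b) :+ α :* (β :* a :+ p :* b)
                     := (α :* p :+ β :* q) :* b) refl p q α β (w zero) (w (suc zero))))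
    to∘from w (suc (suc i)) = R.to∘from (inner w) (suc i)
    from∘to : ∀ z → from (to z) ≗ z
    from∘to z zero = use-unit (solve 6 (λ p q α β a b → α :* (p :* a :+ q :* b) :+ (:- q) :* ((:- β) :* a :+ α :* b)
                     := (α :* p :+ β :* q) :* a) refl p q α β (z zero) (y z zero))
    from∘to z (suc i) = trans (linear-cong (R.from-linear i) inner≗) (R.from∘to (tail z) i)
      where
      inner≗ : inner (to z) ≗ y z
      inner≗ zero = use-unit (solve 6 (λ p q α β a b → β :* (p :* a :+ q :* b) :+ p :* ((:- β) :* a :+ α :* b)
                     := (α :* p :+ β :* q) :* b) refl p q α β (z zero) (y z zero))
      inner≗ (suc i) = refl
    form : ∀ z → dot x z ≡ g * to z zero
    form z = begin
      x zero * z zero + dot (tail x) (tail z)  ≡⟨ cong₂ (λ u v → u * z zero + v) a≡ (R.form (tail z)) ⟩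
      g * p * z zero + R.g * y z zero          ≡⟨ cong (λ u → g * p * z zero + u * y z zero) b≡ ⟩
      g * p * z zero + g * q * y z zero        ≡⟨ solve 5 (λ g p q a b → g :* p :* a :+ g :* q :* b := g :* (p :* a :+ q :* b))
                                                    refl g p q (z zero) (y z zero) ⟩
      g * to z zero ∎
      where open ≡-Reasoning

  ++-cong : ∀ {m n} {u u′ : Vector ℤ m} {v v′ : Vector ℤ n} → u ≗ u′ → v ≗ v′ → (u ++ v) ≗ (u′ ++ v′)
  ++-cong {m} p q i with splitAt m i
  ... | inj₁ j = p j
  ... | inj₂ j = q j

  pair : ∀ {m n} → Vector ℤ m × Vector ℤ n → Vector ℤ (m ℕ.+ n)
  pair (u , v) = u ++ v

  linear-++ : ∀ {D : Set} {N m n} {π : D → Vector ℤ N} {u : D → Vector ℤ m} {v : D → Vector ℤ n} →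
    (∀ i → Linear π (λ z → u z i)) → (∀ j → Linear π (λ z → v z j)) → ∀ i → Linear π (λ z → (u z ++ v z) i)
  linear-++ {m = m} p q i with splitAt m i
  ... | inj₁ j = p j
  ... | inj₂ j = q j

  linear-left : ∀ {m n} (i : Fin m) → Linear (pair {m} {n}) (λ z → proj₁ z i)
  linear-left {m} {n} i = by (δ (i ↑ˡ n)) (λ (u , v) → sym (trans (dot-δ (i ↑ˡ n) (u ++ v))
    (cong [ u , v ] (Fin.splitAt-↑ˡ m i n))))

  linear-right : ∀ {m n} (i : Fin n) → Linear (pair {m} {n}) (λ z → proj₂ z i)
  linear-right {m} {n} i = by (δ (m ↑ʳ i)) (λ (u , v) → sym (trans (dot-δ (m ↑ʳ i) (u ++ v))
    (cong [ u , v ] (Fin.splitAt-↑ʳ m n i))))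

  -- `f` supplies the missing coordinates: `f` and `X` together are inverse to `g`, which expresses
  -- that `X` is part of a basis of the dual lattice.
  record Completion {t n} (X : Fin t → Vector ℤ n) : Set where
    field
      m    : ℕ
      m+t≡n : m ℕ.+ t ≡ n
      f    : Vector ℤ n → Vector ℤ m
      g    : Vector ℤ m → Vector ℤ t → Vector ℤ n
      f-linear : ∀ i → Linear id (λ z → f z i)
      g-linear : ∀ i → Linear pair (λ z → g (proj₁ z) (proj₂ z) i)
      g∘f : ∀ z → g (f z) (λ j → dot (X j) z) ≗ z
      f∘g : ∀ y ξ → f (g y ξ) ≗ y
      X∘g : ∀ y ξ j → dot (X j) (g y ξ) ≡ ξ j

    g-cong : ∀ {y y′ ξ ξ′} → y ≗ y′ → ξ ≗ ξ′ → g y ξ ≗ g y′ ξ′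
    g-cong p q i = linear-cong (g-linear i) (++-cong p q)

  -- After straightening, `X zero` is `g₀` times the first coordinate, and its value 1 at `W zero`
  -- makes `g₀` a unit. Since `X zero` vanishes at every `W (suc j)`, these vectors have first
  -- coordinate 0 and stay dual to the other forms after that coordinate is dropped.
  complete : ∀ {t n} (X W : Fin t → Vector ℤ n) → (∀ i j → dot (X i) (W j) ≡ δ i j) → Completion X
  complete {zero} {n} X W _ = record
    { m = n ; m+t≡n = ℕ.+-identityʳ n ; f = id ; g = λ y _ → y ; f-linear = linear-coordinate
    ; g-linear = linear-left ; g∘f = λ _ _ → refl ; f∘g = λ _ _ _ → refl ; X∘g = λ _ _ () }
  complete {suc t} {zero} X W dual = contradiction (dual zero zero) λ ()
  complete {suc t} {suc n} X W dual = record
    { m = R.m ; m+t≡n = trans (ℕ.+-suc R.m t) (cong suc R.m+t≡n) ; f = f ; g = g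
    ; f-linear = λ i → linear-∘ (R.f-linear i) (tail ∘ U) (λ j → to-linear (suc j))
    ; g-linear = λ i → linear-∘ (from-linear i) w-pair w-linear
    ; g∘f = λ z i → trans (linear-cong (from-linear i) (w-f z)) (from∘to z i)
    ; f∘g = λ y ξ i → trans (linear-cong (R.f-linear i) (λ j → to∘from (w y ξ) (suc j))) (R.f∘g y (ξ′ ξ) i)
    ; X∘g = X∘g }
    where
    open LinearIso (straighten (X zero)) renaming (g to g₀; to to U; from to V)
    ε : ℤ
    ε = U (W zero) zero
    g₀ε≡1 : g₀ * ε ≡ + 1
    g₀ε≡1 = trans (sym (form (W zero))) (dual zero zero)
    U₀ : ∀ z → U z zero ≡ ε * dot (X zero) z
    U₀ z = begin
      U z zero              ≡⟨ *-identityˡ (U z zero) ⟨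
      + 1 * U z zero        ≡⟨ cong (_* U z zero) g₀ε≡1 ⟨
      g₀ * ε * U z zero     ≡⟨ solve 3 (λ g e u → g :* e :* u := e :* (g :* u)) refl g₀ ε (U z zero) ⟩
      ε * (g₀ * U z zero)   ≡⟨ cong (ε *_) (form z) ⟨
      ε * dot (X zero) z ∎
      where
      open ≡-Reasoning
      open +-*-Solver
    XV : ∀ j → Linear id (λ w → dot (X (suc j)) (V w))
    XV j = linear-dot (X (suc j)) from-linear
    a : Fin t → Vector ℤ (suc n)
    a j = coefficients (XV j)
    a-U : ∀ j z → dot (a j) (U z) ≡ dot (X (suc j)) z
    a-U j z = trans (sym (value (XV j) (U z))) (dot-congʳ (X (suc j)) (from∘to z))
    a′ : Fin t → Vector ℤ n
    a′ j = tail (a j)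
    a′-U : ∀ j z → dot (a′ j) (tail (U z)) ≡ dot (X (suc j)) z - a j zero * (ε * dot (X zero) z)
    a′-U j z = trans (solve 2 (λ u v → v := u :+ v :- u) refl (a j zero * U z zero) (dot (a′ j) (tail (U z))))
      (cong₂ _-_ (a-U j z) (cong (a j zero *_) (U₀ z)))
      where open +-*-Solver
    dual′ : ∀ i j → dot (a′ i) (tail (U (W (suc j)))) ≡ δ i j
    dual′ i j = begin
      dot (a′ i) (tail (U (W (suc j))))                       ≡⟨ a′-U i (W (suc j)) ⟩
      dot (X (suc i)) (W (suc j)) - a i zero * (ε * dot (X zero) (W (suc j)))
        ≡⟨ cong₂ (λ u v → u - a i zero * (ε * v)) (dual (suc i) (suc j)) (dual zero (suc j)) ⟩
      δ i j - a i zero * (ε * + 0)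
        ≡⟨ solve 3 (λ d a e → d :- a :* (e :* con (+ 0)) := d) refl (δ i j) (a i zero) ε ⟩
      δ i j ∎
      where
      open ≡-Reasoning
      open +-*-Solver
    module R = Completion (complete a′ (λ j → tail (U (W (suc j)))) dual′)
    f : Vector ℤ (suc n) → Vector ℤ R.m
    f z = R.f (tail (U z))
    -- The share of `X (suc j)` on the first coordinate is already fixed by `ξ zero`; it is
    -- subtracted before the recursive inverse is applied.
    ξ′ : Vector ℤ (suc t) → Vector ℤ t
    ξ′ ξ j = ξ (suc j) + - a j zero * (ε * ξ zero)
    w : Vector ℤ R.m → Vector ℤ (suc t) → Vector ℤ (suc n)
    w y ξ = (ε * ξ zero) ∷ R.g y (ξ′ ξ)
    g : Vector ℤ R.m → Vector ℤ (suc t) → Vector ℤ (suc n)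
    g y ξ = V (w y ξ)
    w-pair : Vector ℤ R.m × Vector ℤ (suc t) → Vector ℤ (suc n)
    w-pair (y , ξ) = w y ξ
    w-linear : ∀ i → Linear pair (λ z → w-pair z i)
    w-linear zero = linear-* ε (linear-right {R.m} zero)
    w-linear (suc i) = linear-∘ (R.g-linear i) (λ z → proj₁ z , ξ′ (proj₂ z))
      (linear-++ linear-left (λ j → linear-+ (linear-right {R.m} (suc j))
        (linear-* (- a j zero) (linear-* ε (linear-right {R.m} zero)))))
    w-f : ∀ z → w (f z) (λ j → dot (X j) z) ≗ U z
    w-f z = λ { zero → sym (U₀ z)
              ; (suc i) → trans (R.g-cong {f z} (λ _ → refl) ξ′-f i) (R.g∘f (tail (U z)) i) }
      where
      open +-*-Solver
      ξ′-f : ∀ j → ξ′ (λ j → dot (X j) z) j ≡ dot (a′ j) (tail (U z))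
      ξ′-f j = trans (solve 3 (λ u a e → u :+ (:- a) :* e := u :- a :* e) refl
          (dot (X (suc j)) z) (a j zero) (ε * dot (X zero) z))
        (sym (a′-U j z))
    X∘g : ∀ y ξ j → dot (X j) (g y ξ) ≡ ξ j
    X∘g y ξ zero = begin
      dot (X zero) (g y ξ)      ≡⟨ form (g y ξ) ⟩
      g₀ * U (g y ξ) zero       ≡⟨ cong (g₀ *_) (to∘from (w y ξ) zero) ⟩
      g₀ * (ε * ξ zero)         ≡⟨ *-assoc g₀ ε (ξ zero) ⟨
      g₀ * ε * ξ zero           ≡⟨ cong (_* ξ zero) g₀ε≡1 ⟩
      + 1 * ξ zero              ≡⟨ *-identityˡ (ξ zero) ⟩
      ξ zero ∎
      where open ≡-Reasoning
    X∘g y ξ (suc j) = begin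
      dot (X (suc j)) (g y ξ)                                  ≡⟨ value (XV j) (w y ξ) ⟩
      a j zero * (ε * ξ zero) + dot (a′ j) (R.g y (ξ′ ξ))      ≡⟨ cong (λ z → a j zero * (ε * ξ zero) + z) (R.X∘g y (ξ′ ξ) j) ⟩
      a j zero * (ε * ξ zero) + ξ′ ξ j                         ≡⟨ solve 3 (λ a e x → a :* e :+ (x :+ (:- a) :* e) := x)
                                                                    refl (a j zero) (ε * ξ zero) (ξ (suc j)) ⟩
      ξ (suc j) ∎
      where
      open ≡-Reasoning
      open +-*-Solver

open import Defs

-- Ring structure and order of the Cauchy reals.

module RealField where
  open import Data.Rational.Solver using (module +-*-Solver)
  open RationalArithmetic using (0≤-*; 0<-*; 0<1; recip; *-monoˡ; *-cancelˡ-≤; <⇒0<-)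

  half : ∀ {ε} → 0ℚ ℚ.< ε → 0ℚ ℚ.< ε ℚ.* ½
  half h = 0<-* h (ℚ.positive⁻¹ ½)

  halves : ∀ ε → ε ℚ.* ½ ℚ.+ ε ℚ.* ½ ≡ ε
  halves ε = trans (sym (ℚ.*-distribˡ-+ ε ½ ½)) (ℚ.*-identityʳ ε)

  p≤∣p∣ : ∀ p → p ℚ.≤ ℚ.∣ p ∣
  p≤∣p∣ p with ℚ.≤-total 0ℚ p
  ... | inj₁ 0≤p = ℚ.≤-reflexive (sym (ℚ.0≤p⇒∣p∣≡p 0≤p))
  ... | inj₂ p≤0 = ℚ.≤-trans p≤0 (ℚ.0≤∣p∣ p)

  -p≤∣p∣ : ∀ p → ℚ.- p ℚ.≤ ℚ.∣ p ∣
  -p≤∣p∣ p = subst (ℚ.- p ℚ.≤_) (ℚ.∣-p∣≡∣p∣ p) (p≤∣p∣ (ℚ.- p))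

  ∣p∣≤ : ∀ {p ε} → p ℚ.≤ ε → ℚ.- p ℚ.≤ ε → ℚ.∣ p ∣ ℚ.≤ ε
  ∣p∣≤ {p} {ε} h h′ with ℚ.∣p∣≡p∨∣p∣≡-p p
  ... | inj₁ e = subst (ℚ._≤ ε) (sym e) h
  ... | inj₂ e = subst (ℚ._≤ ε) (sym e) h′

  -≤⇒≤+ : ∀ {p q ε} → p ℚ.- q ℚ.≤ ε → p ℚ.≤ q ℚ.+ ε
  -≤⇒≤+ {p} {q} h = subst (ℚ._≤ _) (solve 2 (λ p q → q :+ (p :- q) := p) refl p q) (ℚ.+-monoʳ-≤ q h)
    where open +-*-Solver

  ≤+⇒-≤ : ∀ {p q ε} → p ℚ.≤ q ℚ.+ ε → p ℚ.- q ℚ.≤ ε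
  ≤+⇒-≤ {p} {q} {ε} h = subst (_ ℚ.≤_) (solve 2 (λ q e → q :+ e :- q := e) refl q ε) (ℚ.+-monoˡ-≤ (ℚ.- q) h)
    where open +-*-Solver

  neg-sub : ∀ p q → ℚ.- (p ℚ.- q) ≡ q ℚ.- p
  neg-sub = solve 2 (λ p q → :- (p :- q) := q :- p) refl
    where open +-*-Solver

  Eventually : (ℕ → Set) → Set
  Eventually P = ∃[ N ] (∀ k → N ℕ.≤ k → P k)

  eventually-map : ∀ {P Q : ℕ → Set} → (∀ k → P k → Q k) → Eventually P → Eventually Q
  eventually-map f (N , h) = N , λ k le → f k (h k le)

  eventually-map₂ : ∀ {P Q R : ℕ → Set} → (∀ k → P k → Q k → R k) → Eventually P → Eventually Q → Eventually R
  eventually-map₂ f (M , h) (N , h′) = M ℕ.⊔ N , λ k le →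
    f k (h k (ℕ.≤-trans (ℕ.m≤m⊔n M N) le)) (h′ k (ℕ.≤-trans (ℕ.m≤n⊔m M N) le))

  eventually-const : ∀ {A : Set} → Eventually (λ _ → A) → A
  eventually-const (N , h) = h N ℕ.≤-refl

  ≤-pointwise : ∀ {x y} → (∀ k → seq x k ℚ.≤ seq y k) → x ≤ y
  ≤-pointwise {x} {y} h ε ε>0 = 0 , λ k _ → ℚ.≤-trans (h k)
    (subst (ℚ._≤ seq y k ℚ.+ ε) (ℚ.+-identityʳ (seq y k)) (ℚ.+-monoʳ-≤ (seq y k) (ℚ.<⇒≤ ε>0)))

  ≤-trans : ∀ {x y z} → x ≤ y → y ≤ z → x ≤ z
  ≤-trans {x} {y} {z} p q ε ε>0 = eventually-map₂
    (λ k a b → ℚ.≤-trans a (ℚ.≤-trans (ℚ.+-monoˡ-≤ (ε ℚ.* ½) b)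
      (ℚ.≤-reflexive (trans (ℚ.+-assoc (seq z k) _ _) (cong (λ w → seq z k ℚ.+ w) (halves ε))))))
    (p (ε ℚ.* ½) (half ε>0)) (q (ε ℚ.* ½) (half ε>0))

  ≈⇒≤ : ∀ {x y} → x ≈ y → x ≤ y
  ≈⇒≤ {x} {y} h ε ε>0 = eventually-map (λ k a → -≤⇒≤+ (ℚ.≤-trans (p≤∣p∣ (seq x k ℚ.- seq y k)) a)) (h ε ε>0)

  ≈⇒≥ : ∀ {x y} → x ≈ y → y ≤ x
  ≈⇒≥ {x} {y} h ε ε>0 = eventually-map (λ k a → -≤⇒≤+ (subst (ℚ._≤ ε) (neg-sub (seq x k) (seq y k))
    (ℚ.≤-trans (-p≤∣p∣ (seq x k ℚ.- seq y k)) a))) (h ε ε>0)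

  ≤-antisym : ∀ {x y} → x ≤ y → y ≤ x → x ≈ y
  ≤-antisym {x} {y} p q ε ε>0 = eventually-map₂ (λ k a b → ∣p∣≤ (≤+⇒-≤ a)
    (subst (ℚ._≤ ε) (sym (neg-sub (seq x k) (seq y k))) (≤+⇒-≤ b))) (p ε ε>0) (q ε ε>0)

  ≤-refl : ∀ {x} → x ≤ x
  ≤-refl {x} = ≤-pointwise {x} {x} (λ _ → ℚ.≤-refl)

  ≈-pointwise : ∀ {x y} → (∀ k → seq x k ≡ seq y k) → x ≈ y
  ≈-pointwise {x} {y} h = ≤-antisym {x} {y} (≤-pointwise {x} {y} (λ k → ℚ.≤-reflexive (h k)))
                                    (≤-pointwise {y} {x} (λ k → ℚ.≤-reflexive (sym (h k))))

  ≈-refl : ∀ {x} → x ≈ x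
  ≈-refl {x} = ≈-pointwise {x} {x} (λ _ → refl)

  ≈-sym : ∀ {x y} → x ≈ y → y ≈ x
  ≈-sym {x} {y} h = ≤-antisym {y} {x} (≈⇒≥ {x} {y} h) (≈⇒≤ {x} {y} h)

  ≈-trans : ∀ {x y z} → x ≈ y → y ≈ z → x ≈ z
  ≈-trans {x} {y} {z} p q = ≤-antisym {x} {z} (≤-trans {x} {y} {z} (≈⇒≤ {x} {y} p) (≈⇒≤ {y} {z} q))
                                      (≤-trans {z} {y} {x} (≈⇒≥ {y} {z} q) (≈⇒≥ {x} {y} p))

  +-mono-≤ : ∀ {x x′ y y′} → x ≤ x′ → y ≤ y′ → x + y ≤ x′ + y′
  +-mono-≤ {x} {x′} {y} {y′} p q ε ε>0 = eventually-map₂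
    (λ k a b → ℚ.≤-trans (ℚ.+-mono-≤ a b) (ℚ.≤-reflexive (trans
      (solve 3 (λ x y e → (x :+ e) :+ (y :+ e) := (x :+ y) :+ (e :+ e)) refl (seq x′ k) (seq y′ k) (ε ℚ.* ½))
      (cong (λ w → (seq x′ k ℚ.+ seq y′ k) ℚ.+ w) (halves ε)))))
    (p (ε ℚ.* ½) (half ε>0)) (q (ε ℚ.* ½) (half ε>0))
    where open +-*-Solver

  +-cong : ∀ {x x′ y y′} → x ≈ x′ → y ≈ y′ → x + y ≈ x′ + y′
  +-cong {x} {x′} {y} {y′} p q = ≤-antisym {x + y} {x′ + y′}
    (+-mono-≤ {x} {x′} {y} {y′} (≈⇒≤ {x} {x′} p) (≈⇒≤ {y} {y′} q))
    (+-mono-≤ {x′} {x} {y′} {y} (≈⇒≥ {x} {x′} p) (≈⇒≥ {y} {y′} q))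

  -‿cong : ∀ {x x′} → x ≈ x′ → - x ≈ - x′
  -‿cong {x} {x′} h ε ε>0 = eventually-map (λ k a → subst (ℚ._≤ ε)
    (trans (sym (ℚ.∣-p∣≡∣p∣ (seq x k ℚ.- seq x′ k)))
           (cong ℚ.∣_∣ (solve 2 (λ p q → :- (p :- q) := (:- p) :- (:- q)) refl (seq x k) (seq x′ k)))) a) (h ε ε>0)
    where open +-*-Solver

  bounded : ∀ x → ∃[ B ] (0ℚ ℚ.< B × Eventually (λ k → ℚ.∣ seq x k ∣ ℚ.≤ B))
  bounded x = let N , h = cauchy x 1ℚ 0<1 in
    ℚ.∣ seq x N ∣ ℚ.+ 1ℚ , ℚ.+-mono-≤-< (ℚ.0≤∣p∣ (seq x N)) 0<1 , N , λ k le →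
      ℚ.≤-trans (ℚ.≤-reflexive (cong ℚ.∣_∣ (solve 2 (λ a b → a := b :+ (a :- b)) refl (seq x k) (seq x N))))
        (ℚ.≤-trans (ℚ.∣p+q∣≤∣p∣+∣q∣ (seq x N) (seq x k ℚ.- seq x N))
          (ℚ.+-monoʳ-≤ ℚ.∣ seq x N ∣ (h k N le ℕ.≤-refl)))
    where open +-*-Solver

  *-congʳ : ∀ {x x′} y → x ≈ x′ → x * y ≈ x′ * y
  *-congʳ {x} {x′} y h ε ε>0 = eventually-map₂ bound (h (r ℚ.* ε) (0<-* (proj₁ (proj₂ (recip B>0))) ε>0)) (proj₂ (proj₂ (bounded y)))
    where
    open ℚ.≤-Reasoning
    open +-*-Solver
    B r : ℚ
    B = proj₁ (bounded y)
    B>0 : 0ℚ ℚ.< B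
    B>0 = proj₁ (proj₂ (bounded y))
    r = proj₁ (recip B>0)
    Br≡1 : B ℚ.* r ≡ 1ℚ
    Br≡1 = proj₂ (proj₂ (recip B>0))
    bound : ∀ k → ℚ.∣ seq x k ℚ.- seq x′ k ∣ ℚ.≤ r ℚ.* ε → ℚ.∣ seq y k ∣ ℚ.≤ B →
            ℚ.∣ seq x k ℚ.* seq y k ℚ.- seq x′ k ℚ.* seq y k ∣ ℚ.≤ ε
    bound k a b = begin
      ℚ.∣ seq x k ℚ.* seq y k ℚ.- seq x′ k ℚ.* seq y k ∣
        ≡⟨ cong ℚ.∣_∣ (solve 3 (λ x x′ y → x :* y :- x′ :* y := (x :- x′) :* y) refl (seq x k) (seq x′ k) (seq y k)) ⟩
      ℚ.∣ (seq x k ℚ.- seq x′ k) ℚ.* seq y k ∣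
        ≡⟨ ℚ.∣p*q∣≡∣p∣*∣q∣ (seq x k ℚ.- seq x′ k) (seq y k) ⟩
      ℚ.∣ seq x k ℚ.- seq x′ k ∣ ℚ.* ℚ.∣ seq y k ∣
        ≤⟨ *-monoˡ (ℚ.0≤∣p∣ (seq x k ℚ.- seq x′ k)) b ⟩
      ℚ.∣ seq x k ℚ.- seq x′ k ∣ ℚ.* B
        ≡⟨ ℚ.*-comm ℚ.∣ seq x k ℚ.- seq x′ k ∣ B ⟩
      B ℚ.* ℚ.∣ seq x k ℚ.- seq x′ k ∣
        ≤⟨ *-monoˡ (ℚ.<⇒≤ B>0) a ⟩
      B ℚ.* (r ℚ.* ε)
        ≡⟨ trans (sym (ℚ.*-assoc B r ε)) (trans (cong (ℚ._* ε) Br≡1) (ℚ.*-identityˡ ε)) ⟩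
      ε ∎

  *-comm : ∀ x y → x * y ≈ y * x
  *-comm x y = ≈-pointwise {x * y} {y * x} (λ k → ℚ.*-comm (seq x k) (seq y k))

  *-cong : ∀ {x x′ y y′} → x ≈ x′ → y ≈ y′ → x * y ≈ x′ * y′
  *-cong {x} {x′} {y} {y′} p q = ≈-trans {x * y} {x′ * y} {x′ * y′} (*-congʳ {x} {x′} y p)
    (≈-trans {x′ * y} {y * x′} {x′ * y′} (*-comm x′ y)
      (≈-trans {y * x′} {y′ * x′} {x′ * y′} (*-congʳ {y} {y′} x′ q) (*-comm y′ x′)))

  ℝ-commutativeRing : CommutativeRing 0ℓ 0ℓ
  ℝ-commutativeRing = record
    { Carrier = ℝ ; _≈_ = _≈_ ; _+_ = _+_ ; _*_ = _*_ ; -_ = -_ ; 0# = 0ℝ ; 1# = 1ℝ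
    ; isCommutativeRing = record
      { isRing = record
        { +-isAbelianGroup = record
          { isGroup = record
            { isMonoid = record
              { isSemigroup = record
                { isMagma = record
                  { isEquivalence = record
                    { refl = λ {x} → ≈-refl {x} ; sym = λ {x} {y} → ≈-sym {x} {y} ; trans = λ {x} {y} {z} → ≈-trans {x} {y} {z} }
                  ; ∙-cong = λ {x} {x′} {y} {y′} → +-cong {x} {x′} {y} {y′} }
                ; assoc = λ x y z → ≈-pointwise {(x + y) + z} {x + (y + z)} (λ k → ℚ.+-assoc (seq x k) (seq y k) (seq z k)) }
              ; identity = (λ x → ≈-pointwise {0ℝ + x} {x} (λ k → ℚ.+-identityˡ (seq x k)))
                         , (λ x → ≈-pointwise {x + 0ℝ} {x} (λ k → ℚ.+-identityʳ (seq x k))) }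
            ; inverse = (λ x → ≈-pointwise {(- x) + x} {0ℝ} (λ k → ℚ.+-inverseˡ (seq x k)))
                      , (λ x → ≈-pointwise {x + (- x)} {0ℝ} (λ k → ℚ.+-inverseʳ (seq x k)))
            ; ⁻¹-cong = λ {x} {x′} → -‿cong {x} {x′} }
          ; comm = λ x y → ≈-pointwise {x + y} {y + x} (λ k → ℚ.+-comm (seq x k) (seq y k)) }
        ; *-cong = λ {x} {x′} {y} {y′} → *-cong {x} {x′} {y} {y′}
        ; *-assoc = λ x y z → ≈-pointwise {(x * y) * z} {x * (y * z)} (λ k → ℚ.*-assoc (seq x k) (seq y k) (seq z k))
        ; *-identity = (λ x → ≈-pointwise {1ℝ * x} {x} (λ k → ℚ.*-identityˡ (seq x k)))
                     , (λ x → ≈-pointwise {x * 1ℝ} {x} (λ k → ℚ.*-identityʳ (seq x k)))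
        ; distrib = (λ x y z → ≈-pointwise {x * (y + z)} {x * y + x * z} (λ k → ℚ.*-distribˡ-+ (seq x k) (seq y k) (seq z k)))
                  , (λ x y z → ≈-pointwise {(y + z) * x} {y * x + z * x} (λ k → ℚ.*-distribʳ-+ (seq x k) (seq y k) (seq z k))) }
      ; *-comm = *-comm } }

  fromℚ-mono : ∀ {p q} → p ℚ.≤ q → fromℚ p ≤ fromℚ q
  fromℚ-mono {p} {q} h = ≤-pointwise {fromℚ p} {fromℚ q} (λ _ → h)

  fromℚ-cong : ∀ {p q} → p ≡ q → fromℚ p ≈ fromℚ q
  fromℚ-cong {p} refl = ≈-refl {fromℚ p}

  -- The sequences are constant, so one index decides; half of a positive gap `p - q` is the
  -- tolerance that refutes it.
  fromℚ-cancel-≤ : ∀ {p q} → fromℚ p ≤ fromℚ q → p ℚ.≤ q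
  fromℚ-cancel-≤ {p} {q} h with p ℚ.≤? q
  ... | yes le = le
  ... | no nle = contradiction (≤+⇒-≤ (eventually-const (h (ε ℚ.* ½) (half ε>0))))
                   (λ le → ℚ.<-irrefl refl (ℚ.<-≤-trans (half ε>0) (subst₂ ℚ._≤_
                     (solve 1 (λ e → e :* con ½ :+ e :* con ½ :- e :* con ½ := e :* con ½) refl ε)
                     (ℚ.+-inverseʳ (ε ℚ.* ½))
                     (ℚ.+-monoˡ-≤ (ℚ.- (ε ℚ.* ½)) (subst (ℚ._≤ ε ℚ.* ½) (sym (halves ε)) le)))))
    where
    open +-*-Solver
    ε = p ℚ.- q
    ε>0 : 0ℚ ℚ.< ε
    ε>0 = <⇒0<- (ℚ.≰⇒> nle)

  fromℚ-cancel-≈ : ∀ {p q} → fromℚ p ≈ fromℚ q → p ≡ q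
  fromℚ-cancel-≈ {p} {q} h = ℚ.≤-antisym (fromℚ-cancel-≤ (≈⇒≤ {fromℚ p} {fromℚ q} h))
                                         (fromℚ-cancel-≤ (≈⇒≥ {fromℚ p} {fromℚ q} h))

  -- Eventually `0 ≤ (x + e) * (y + e) = x * y + e * (x + y + e)`, so `e * K ≤
  -- ε` is wanted for a bound `K` of the bracket. The 1 in `K` stands for `e` itself, and `e = ε /
  -- (K + ε)` secures both `e ≤ 1` and `e * K ≤ ε`.
  0≤-*ℝ : ∀ {x y} → 0ℝ ≤ x → 0ℝ ≤ y → 0ℝ ≤ x * y
  0≤-*ℝ {x} {y} p q ε ε>0 = eventually-map₂ combine
      (eventually-map₂ (λ _ → _,_) (p e e>0) (q e e>0))
      (eventually-map₂ (λ _ → _,_) (proj₂ (proj₂ (bounded x))) (proj₂ (proj₂ (bounded y))))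
    where
    open +-*-Solver
    A B K r e : ℚ
    A = proj₁ (bounded x)
    B = proj₁ (bounded y)
    K = A ℚ.+ B ℚ.+ 1ℚ
    K>0 : 0ℚ ℚ.< K
    K>0 = ℚ.+-mono-< (ℚ.+-mono-< (proj₁ (proj₂ (bounded x))) (proj₁ (proj₂ (bounded y)))) 0<1
    K+ε>0 : 0ℚ ℚ.< K ℚ.+ ε
    K+ε>0 = ℚ.+-mono-< K>0 ε>0
    r = proj₁ (recip K+ε>0)
    Kr≡1 : (K ℚ.+ ε) ℚ.* r ≡ 1ℚ
    Kr≡1 = proj₂ (proj₂ (recip K+ε>0))
    e = r ℚ.* ε
    e>0 : 0ℚ ℚ.< e
    e>0 = 0<-* (proj₁ (proj₂ (recip K+ε>0))) ε>0
    Ke≡ε : (K ℚ.+ ε) ℚ.* e ≡ ε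
    Ke≡ε = trans (sym (ℚ.*-assoc (K ℚ.+ ε) r ε)) (trans (cong (ℚ._* ε) Kr≡1) (ℚ.*-identityˡ ε))
    weaken : ∀ {s t} → 0ℚ ℚ.≤ t → s ℚ.≤ s ℚ.+ t
    weaken {s} {t} h = subst (ℚ._≤ s ℚ.+ t) (ℚ.+-identityʳ s) (ℚ.+-monoʳ-≤ s h)
    e≤1 : e ℚ.≤ 1ℚ
    e≤1 = *-cancelˡ-≤ K+ε>0 (subst₂ ℚ._≤_ (sym Ke≡ε) (trans (ℚ.+-comm ε K) (sym (ℚ.*-identityʳ (K ℚ.+ ε))))
      (weaken (ℚ.<⇒≤ K>0)))
    eK≤ε : e ℚ.* K ℚ.≤ ε
    eK≤ε = subst (e ℚ.* K ℚ.≤_) (trans (solve 3 (λ e K ε → e :* K :+ e :* ε := (K :+ ε) :* e) refl e K ε) Ke≡ε)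
      (weaken (0≤-* (ℚ.<⇒≤ e>0) (ℚ.<⇒≤ ε>0)))
    combine : ∀ k → (0ℚ ℚ.≤ seq x k ℚ.+ e × 0ℚ ℚ.≤ seq y k ℚ.+ e) → (ℚ.∣ seq x k ∣ ℚ.≤ A × ℚ.∣ seq y k ∣ ℚ.≤ B) →
              0ℚ ℚ.≤ seq x k ℚ.* seq y k ℚ.+ ε
    combine k (hx , hy) (bx , by) = begin
      0ℚ                                                         ≤⟨ 0≤-* hx hy ⟩
      (seq x k ℚ.+ e) ℚ.* (seq y k ℚ.+ e)                        ≡⟨ solve 3 (λ x y e → (x :+ e) :* (y :+ e) := x :* y :+ e :* (x :+ y :+ e)) refl (seq x k) (seq y k) e ⟩
      seq x k ℚ.* seq y k ℚ.+ e ℚ.* (seq x k ℚ.+ seq y k ℚ.+ e)  ≤⟨ ℚ.+-monoʳ-≤ (seq x k ℚ.* seq y k) (*-monoˡ (ℚ.<⇒≤ e>0)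
          (ℚ.+-mono-≤ (ℚ.+-mono-≤ (ℚ.≤-trans (p≤∣p∣ (seq x k)) bx) (ℚ.≤-trans (p≤∣p∣ (seq y k)) by)) e≤1)) ⟩
      seq x k ℚ.* seq y k ℚ.+ e ℚ.* K                            ≤⟨ ℚ.+-monoʳ-≤ (seq x k ℚ.* seq y k) eK≤ε ⟩
      seq x k ℚ.* seq y k ℚ.+ ε ∎
      where open ℚ.≤-Reasoning

-- Convex hulls of lattice points and their images under affine maps.

module Polytopes where
  open RealField
  module ℝSums = RingSums ℝ-commutativeRing
  open ℝSums using (dot; dot-congʳ; dot-comm; dot-assoc; dot-+ʳ; dot-δ; δ; sum-cong)
  open CommutativeRing ℝ-commutativeRing using (setoid; *-identityʳ; *-identityˡ; -‿inverseʳ)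
  module ℚSums = RingSums ℚ.+-*-commutativeRing
  open import Relation.Binary.Reasoning.Setoid setoid

  ones : ∀ {n} → ℝ^ n
  ones _ = 1ℝ

  sum-ones : ∀ {n} (c : ℝ^ n) → sum c ≈ dot c ones
  sum-ones c = sum-cong {u = c} (λ i → ≈-sym {c i * 1ℝ} {c i} (*-identityʳ (c i)))

  sum-δ : ∀ {n} (i : Fin n) → sum (δ i) ≈ 1ℝ
  sum-δ i = ≈-trans {sum (δ i)} {dot (δ i) ones} {1ℝ} (sum-ones (δ i)) (dot-δ i ones)

  δ≥0 : ∀ {n} (i j : Fin n) → 0ℝ ≤ δ i j
  δ≥0 zero    zero    = fromℚ-mono (ℚ.nonNegative⁻¹ 1ℚ)
  δ≥0 zero    (suc j) = ≤-refl {0ℝ}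
  δ≥0 (suc i) zero    = ≤-refl {0ℝ}
  δ≥0 (suc i) (suc j) = δ≥0 i j

  0≤-sum : ∀ {n} {u : ℝ^ n} → (∀ i → 0ℝ ≤ u i) → 0ℝ ≤ sum u
  0≤-sum {zero}  h = ≤-refl {0ℝ}
  0≤-sum {suc n} {u} h = ≤-trans {0ℝ} {0ℝ + 0ℝ} {sum u} (≤-pointwise {0ℝ} {0ℝ + 0ℝ} (λ _ → ℚ.≤-refl))
    (+-mono-≤ {0ℝ} {u zero} {0ℝ} {sum (u ∘ suc)} (h zero) (0≤-sum {n} {u ∘ suc} (h ∘ suc)))

  0≤-dot : ∀ {n} {u v : ℝ^ n} → (∀ i → 0ℝ ≤ u i) → (∀ i → 0ℝ ≤ v i) → 0ℝ ≤ dot u v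
  0≤-dot {u = u} {v} p q = 0≤-sum {u = λ i → u i * v i} (λ i → 0≤-*ℝ {u i} {v i} (p i) (q i))

  0≤-sub : ∀ {x y} → x ≤ y → 0ℝ ≤ y - x
  0≤-sub {x} {y} h = ≤-trans {0ℝ} {x - x} {y - x} (≈⇒≥ {x - x} {0ℝ} (-‿inverseʳ x))
    (+-mono-≤ {x} {y} { - x } { - x } h (≤-refl { - x }))

  sub-0≤ : ∀ {x y} → 0ℝ ≤ y - x → x ≤ y
  sub-0≤ {x} {y} h = ≤-trans {x} {0ℝ + x} {y} (≤-pointwise {x} {0ℝ + x} (λ k → ℚ.≤-reflexive (sym (ℚ.+-identityˡ (seq x k)))))
    (≤-trans {0ℝ + x} {(y - x) + x} {y} (+-mono-≤ {0ℝ} {y - x} {x} {x} h (≤-refl {x}))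
      (≈⇒≤ {(y - x) + x} {y} (≈-pointwise {(y - x) + x} {y} (λ k →
        trans (ℚ.+-assoc (seq y k) (ℚ.- seq x k) (seq x k))
          (trans (cong (λ z → seq y k ℚ.+ z) (ℚ.+-inverseˡ (seq x k))) (ℚ.+-identityʳ (seq y k)))))))

  dot-monoʳ-≤ : ∀ {n} {u v w : ℝ^ n} → (∀ i → 0ℝ ≤ u i) → (∀ i → v i ≤ w i) → dot u v ≤ dot u w
  dot-monoʳ-≤ {u = u} {v} {w} p q = sub-0≤ {dot u v} {dot u w} (≤-trans {0ℝ} {dot u (λ i → w i - v i)} {dot u w - dot u v}
    (0≤-dot {u = u} {λ i → w i - v i} p (λ i → 0≤-sub {v i} {w i} (q i)))
    (≈⇒≤ {dot u (λ i → w i - v i)} {dot u w - dot u v} (begin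
      dot u (λ i → w i - v i)          ≈⟨ dot-+ʳ u w (λ i → - v i) ⟩
      dot u w + dot u (λ i → - v i)    ≈⟨ +-cong {dot u w} {dot u w} {dot u (λ i → - v i)} { - dot u v } (≈-refl {dot u w}) (begin
        dot u (λ i → - v i)   ≈⟨ dot-comm u (λ i → - v i) ⟩
        dot (λ i → - v i) u   ≈⟨ ℝSums.dot-negˡ v u ⟩
        - dot v u             ≈⟨ -‿cong {dot v u} {dot u v} (dot-comm v u) ⟩
        - dot u v ∎) ⟩
      dot u w - dot u v ∎)))

  seq-sum : ∀ {n} (u : ℝ^ n) k → seq (sum u) k ≡ ℚSums.sum (λ i → seq (u i) k)
  seq-sum {zero}  u k = refl
  seq-sum {suc n} u k = cong (λ z → seq (u zero) k ℚ.+ z) (seq-sum (u ∘ suc) k)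

  seq-⟨⟩ : ∀ {n} (a : ℤ^ n) (x : ℝ^ n) k → seq ⟨ a , x ⟩ k ≡ ℚSums.dot (λ i → a i ℚ./ 1) (λ i → seq (x i) k)
  seq-⟨⟩ a x k = seq-sum (λ i → fromℤ (a i) * x i) k

  ⟨⟩-ι : ∀ {n} (a z : ℤ^ n) → ⟨ a , ι z ⟩ ≈ fromℤ (ℤSums.dot a z)
  ⟨⟩-ι a z = ≈-pointwise {⟨ a , ι z ⟩} {fromℤ (ℤSums.dot a z)} (λ k →
    trans (seq-⟨⟩ a (ι z) k) (sym (Counting.dot-/1 a z)))

  ⟨⟩-cong : ∀ {n} (a : ℤ^ n) {x y : ℝ^ n} → x ≋ y → ⟨ a , x ⟩ ≈ ⟨ a , y ⟩
  ⟨⟩-cong a h = dot-congʳ (λ i → fromℤ (a i)) h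

  ⟨⟩-combination : ∀ {r n} (a : ℤ^ n) (c : ℝ^ r) (p : Vector (ℝ^ n) r) →
    ⟨ a , combination c p ⟩ ≈ dot c (λ j → ⟨ a , p j ⟩)
  ⟨⟩-combination a c p = begin
    dot (λ i → fromℤ (a i)) (combination c p)      ≈⟨ dot-comm (λ i → fromℤ (a i)) (combination c p) ⟩
    dot (combination c p) (λ i → fromℤ (a i))      ≈⟨ dot-assoc c p (λ i → fromℤ (a i)) ⟨
    dot c (λ j → dot (p j) (λ i → fromℤ (a i)))    ≈⟨ dot-congʳ c (λ j → dot-comm (p j) (λ i → fromℤ (a i))) ⟩
    dot c (λ j → ⟨ a , p j ⟩) ∎

  combination-congʳ : ∀ {r n} (c : ℝ^ r) {p q : Vector (ℝ^ n) r} → (∀ j → p j ≋ q j) →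
    combination c p ≋ combination c q
  combination-congʳ c h i = dot-congʳ c (λ j → h j i)

  combination-assoc : ∀ {r s n} (c : ℝ^ r) (w : Fin r → ℝ^ s) (v : Vector (ℝ^ n) s) →
    combination c (λ j → combination (w j) v) ≋ combination (λ l → dot c (λ j → w j l)) v
  combination-assoc c w v i = dot-assoc c w (λ l → v l i)

  dot-const : ∀ {r} (c : ℝ^ r) → sum c ≈ 1ℝ → ∀ β → dot c (λ _ → β) ≈ β
  dot-const c h β = begin
    dot c (λ _ → β)    ≈⟨ ℝSums.*-distribʳ-sum β c ⟨
    sum c * β          ≈⟨ *-cong {sum c} {1ℝ} {β} {β} h (≈-refl {β}) ⟩
    1ℝ * β             ≈⟨ *-identityˡ β ⟩
    β ∎

  ≋-trans : ∀ {n} {x y z : ℝ^ n} → x ≋ y → y ≋ z → x ≋ z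
  ≋-trans {x = x} {y} {z} p q i = ≈-trans {x i} {y i} {z i} (p i) (q i)

  ≋-sym : ∀ {n} {x y : ℝ^ n} → x ≋ y → y ≋ x
  ≋-sym {x = x} {y} p i = ≈-sym {x i} {y i} (p i)

  ≋-refl : ∀ {n} {x : ℝ^ n} → x ≋ x
  ≋-refl {x = x} i = ≈-refl {x i}

  module _ {n} (P : LatticePolytope n) where
    open LatticePolytope P

    vertex : Fin (suc size) → ℝ^ n
    vertex l = ι (generator l)

    -- `conv` allows any number of points with repetitions. One weight per generator is a normal
    -- form, under which mixing several points is a product of weight matrices.
    record Weights (x : ℝ^ n) : Set where
      field
        weight : ℝ^ (suc size)
        nonneg : ∀ l → 0ℝ ≤ weight l
        total  : sum weight ≈ 1ℝ
        point  : x ≋ combination weight vertex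

    from-weights : ∀ {x} → Weights x → x ∈ ⟦ P ⟧
    from-weights w = suc size , weight , vertex , (λ l → l , λ i → ≈-refl {vertex l i}) , nonneg , total , point
      where open Weights w

    mix : ∀ {r} (c : ℝ^ r) (p : Vector (ℝ^ n) r) → (∀ j → 0ℝ ≤ c j) → sum c ≈ 1ℝ →
          (∀ j → Weights (p j)) → Weights (combination c p)
    mix c p c≥0 Σc≈1 w = record
      { weight = λ l → dot c (λ j → weight (w j) l)
      ; nonneg = λ l → 0≤-dot {u = c} {λ j → weight (w j) l} c≥0 (λ j → nonneg (w j) l)
      ; total = begin
          sum (λ l → dot c (λ j → weight (w j) l))       ≈⟨ sum-ones (λ l → dot c (λ j → weight (w j) l)) ⟩
          dot (λ l → dot c (λ j → weight (w j) l)) ones  ≈⟨ dot-assoc c (λ j → weight (w j)) ones ⟨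
          dot c (λ j → dot (weight (w j)) ones)          ≈⟨ dot-congʳ c (λ j → sum-ones (weight (w j))) ⟨
          dot c (λ j → sum (weight (w j)))               ≈⟨ dot-congʳ c (λ j → total (w j)) ⟩
          dot c ones                                     ≈⟨ sum-ones c ⟨
          sum c                                          ≈⟨ Σc≈1 ⟩
          1ℝ ∎
      ; point = ≋-trans {x = combination c p} {combination c (λ j → combination (weight (w j)) vertex)} {combination (λ l → dot c (λ j → weight (w j) l)) vertex}
          (combination-congʳ c (λ j → point (w j)))
          (combination-assoc c (λ j → weight (w j)) vertex)
      }
      where open Weights

    weights-cong : ∀ {x y} → x ≋ y → Weights y → Weights x
    weights-cong {x} {y} e w = record { weight = weight ; nonneg = nonneg ; total = total ; point = ≋-trans {x = x} {y} {combination weight vertex} e point }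
      where open Weights w

    vertex-weights : ∀ l → Weights (vertex l)
    vertex-weights l = record { weight = δ l ; nonneg = δ≥0 l ; total = sum-δ l
      ; point = λ i → ≈-sym {combination (δ l) vertex i} {vertex l i} (dot-δ l (λ l′ → vertex l′ i)) }

    to-weights : ∀ {x} → x ∈ ⟦ P ⟧ → Weights x
    to-weights {x} (r , c , p , p∈ , c≥0 , Σc≈1 , x≋) = weights-cong {x} x≋
      (mix c p c≥0 Σc≈1 (λ j → weights-cong {p j} (proj₂ (p∈ j)) (vertex-weights (proj₁ (p∈ j)))))

    vertex∈ : ∀ l → vertex l ∈ ⟦ P ⟧
    vertex∈ l = from-weights (vertex-weights l)

    convex : ∀ {r} (c : ℝ^ r) (p : Vector (ℝ^ n) r) → (∀ j → 0ℝ ≤ c j) → sum c ≈ 1ℝ →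
             (∀ j → p j ∈ ⟦ P ⟧) → combination c p ∈ ⟦ P ⟧
    convex c p c≥0 Σc≈1 p∈ = from-weights (mix c p c≥0 Σc≈1 (λ j → to-weights (p∈ j)))

    valid : ∀ (a : ℤ^ n) (β : ℚ) → (∀ l → β ℚ.≤ ℤSums.dot a (generator l) ℚ./ 1) →
            ∀ {x} → x ∈ ⟦ P ⟧ → fromℚ β ≤ ⟨ a , x ⟩
    valid a β h {x} x∈ = ≤-trans {fromℚ β} {dot weight (λ _ → fromℚ β)} {⟨ a , x ⟩}
      (≈⇒≥ {dot weight (λ _ → fromℚ β)} {fromℚ β} (dot-const weight total (fromℚ β)))
      (≤-trans {dot weight (λ _ → fromℚ β)} {dot weight (λ l → ⟨ a , vertex l ⟩)} {⟨ a , x ⟩}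
        (dot-monoʳ-≤ {u = weight} {λ _ → fromℚ β} {λ l → ⟨ a , vertex l ⟩} nonneg (λ l →
          ≤-trans {fromℚ β} {fromℤ (ℤSums.dot a (generator l))} {⟨ a , vertex l ⟩} (fromℚ-mono (h l))
            (≈⇒≥ {⟨ a , vertex l ⟩} {fromℤ (ℤSums.dot a (generator l))} (⟨⟩-ι a (generator l)))))
        (≈⇒≥ {⟨ a , x ⟩} {dot weight (λ l → ⟨ a , vertex l ⟩)} (begin
          ⟨ a , x ⟩                             ≈⟨ ⟨⟩-cong a point ⟩
          ⟨ a , combination weight vertex ⟩     ≈⟨ ⟨⟩-combination a weight vertex ⟩
          dot weight (λ l → ⟨ a , vertex l ⟩) ∎)))
      where open Weights (to-weights {x} x∈)

  module _ {m n} (φ : AffineMap m n) where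
    open AffineMap φ

    applyℝ-cong : ∀ {x y} → x ≋ y → applyℝ x ≋ applyℝ y
    applyℝ-cong {x} {y} e i = +-cong {⟨ matrix i , x ⟩} {⟨ matrix i , y ⟩} {fromℤ (offset i)} {fromℤ (offset i)}
      (⟨⟩-cong (matrix i) e) (≈-refl {fromℤ (offset i)})

    applyℝ-ι : ∀ z → applyℝ (ι z) ≋ ι (applyℤ z)
    applyℝ-ι z i = begin
      ⟨ matrix i , ι z ⟩ + fromℤ (offset i)
        ≈⟨ +-cong {⟨ matrix i , ι z ⟩} {fromℤ (ℤSums.dot (matrix i) z)} {fromℤ (offset i)} {fromℤ (offset i)}
             (⟨⟩-ι (matrix i) z) (≈-refl {fromℤ (offset i)}) ⟩
      fromℤ (ℤSums.dot (matrix i) z) + fromℤ (offset i)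
        ≈⟨ ≈-pointwise {fromℤ (applyℤ z i)} {fromℤ (ℤSums.dot (matrix i) z) + fromℤ (offset i)}
             (λ _ → RationalArithmetic./1-+ (ℤSums.dot (matrix i) z) (offset i)) ⟨
      fromℤ (applyℤ z i) ∎

    applyℝ-combination : ∀ {r} (c : ℝ^ r) (p : Vector (ℝ^ m) r) → sum c ≈ 1ℝ →
      applyℝ (combination c p) ≋ combination c (λ j → applyℝ (p j))
    applyℝ-combination c p Σc≈1 i = begin
      ⟨ matrix i , combination c p ⟩ + o
        ≈⟨ +-cong {⟨ matrix i , combination c p ⟩} {dot c (λ j → ⟨ matrix i , p j ⟩)} {o} {dot c (λ _ → o)}
             (⟨⟩-combination (matrix i) c p) (≈-sym {dot c (λ _ → o)} {o} (dot-const c Σc≈1 o)) ⟩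
      dot c (λ j → ⟨ matrix i , p j ⟩) + dot c (λ _ → o)
        ≈⟨ dot-+ʳ c (λ j → ⟨ matrix i , p j ⟩) (λ _ → o) ⟨
      dot c (λ j → applyℝ (p j) i) ∎
      where
      o : ℝ
      o = fromℤ (offset i)

    -- An affine map commutes with combinations of total weight 1, so it suffices to look at the
    -- generators on one side and at the points of `T` on the other.
    mapsOnto-conv : ∀ (P : LatticePolytope m) {T : Subset n} → (∀ l → applyℝ (vertex P l) ∈ T) →
      (∀ y → y ∈ T → ∃[ x ] (x ∈ ⟦ P ⟧ × applyℝ x ≋ y)) → MapsOnto φ ⟦ P ⟧ (conv T)
    mapsOnto-conv P {T} into onto = forward , backward
      where
      forward : ∀ x → x ∈ ⟦ P ⟧ → applyℝ x ∈ conv T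
      forward x x∈ = suc (LatticePolytope.size P) , weight , (λ l → applyℝ (vertex P l)) , into , nonneg , total ,
        ≋-trans {x = applyℝ x} {applyℝ (combination weight (vertex P))} {combination weight (λ l → applyℝ (vertex P l))} (applyℝ-cong {x} {combination weight (vertex P)} point) (applyℝ-combination weight (vertex P) total)
        where open Weights (to-weights P {x} x∈)
      backward : ∀ y → y ∈ conv T → ∃[ x ] (x ∈ ⟦ P ⟧ × applyℝ x ≋ y)
      backward y (r , c , q , q∈ , c≥0 , Σc≈1 , y≋) =
        combination c p , convex P c p c≥0 Σc≈1 (λ j → proj₁ (proj₂ (onto (q j) (q∈ j)))) ,
        ≋-trans {x = applyℝ (combination c p)} {combination c (λ j → applyℝ (p j))} {y} (applyℝ-combination c p Σc≈1)
          (≋-trans {x = combination c (λ j → applyℝ (p j))} {combination c q} {y} (combination-congʳ c (λ j → proj₂ (proj₂ (onto (q j) (q∈ j)))))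
            (≋-sym {x = y} {combination c q} y≋))
        where
        p : Vector (ℝ^ m) r
        p j = proj₁ (onto (q j) (q∈ j))

-- From facet distances with values 0 and 1 to a Cayley sum.

module CayleyStructure where
  open import Data.Integer.Solver using (module +-*-Solver)
  open ℤSums using (dot; dot-+ʳ; dot-congʳ; dot-negˡ; dot-comm; dot-*ʳ; δ; δ-sym)
  open UnimodularCompletion
  open RealField using (≈-refl)
  open Polytopes hiding (δ≥0)

  corner-δ : ∀ {t} (i j : Fin t) → corner (suc i) j ≡ δ i j
  corner-δ i j with i Fin.≟ j
  ... | yes refl = sym (diagonal i)
    where
    diagonal : ∀ {t} (i : Fin t) → δ i i ≡ ℤ.+ 1
    diagonal zero    = refl
    diagonal (suc i) = diagonal i
  ... | no ne = sym (off i j ne)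
    where
    off : ∀ {t} (i j : Fin t) → i ≢ j → δ i j ≡ ℤ.+ 0
    off zero    zero    ne = contradiction refl ne
    off zero    (suc j) ne = refl
    off (suc i) zero    ne = refl
    off (suc i) (suc j) ne = off i j (ne ∘ cong suc)

  δ>0⇒≡ : ∀ {t} (i j : Fin t) → ℤ.0ℤ ℤ.< δ i j → i ≡ j
  δ>0⇒≡ zero    zero    _ = refl
  δ>0⇒≡ zero    (suc j) h = contradiction h (ℤ.<-irrefl refl)
  δ>0⇒≡ (suc i) zero    h = contradiction h (ℤ.<-irrefl refl)
  δ>0⇒≡ (suc i) (suc j) h = cong suc (δ>0⇒≡ i j h)

  corner>0 : ∀ {t} (i : Fin (suc t)) (j : Fin t) → ℤ.0ℤ ℤ.< corner i j → i ≡ suc j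
  corner>0 zero    j h = contradiction h (ℤ.<-irrefl refl)
  corner>0 (suc i) j h = cong suc (δ>0⇒≡ i j (subst (ℤ.0ℤ ℤ.<_) (corner-δ i j) h))

  0≤sumℤ : ∀ {t} {y : ℤ^ t} → (∀ j → ℤ.0ℤ ℤ.≤ y j) → ℤ.0ℤ ℤ.≤ sumℤ y
  0≤sumℤ {zero}  h = ℤ.≤-refl
  0≤sumℤ {suc t} h = ℤ.+-mono-≤ (h zero) (0≤sumℤ (h ∘ suc))

  term≤sumℤ : ∀ {t} {y : ℤ^ t} → (∀ j → ℤ.0ℤ ℤ.≤ y j) → ∀ j → y j ℤ.≤ sumℤ y
  term≤sumℤ {suc t} {y} h zero    = subst (ℤ._≤ sumℤ y) (ℤ.+-identityʳ (y zero)) (ℤ.+-monoʳ-≤ (y zero) (0≤sumℤ (h ∘ suc)))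
  term≤sumℤ {suc t} {y} h (suc j) = ℤ.≤-trans (term≤sumℤ (h ∘ suc) j)
    (subst (ℤ._≤ sumℤ y) (ℤ.+-identityˡ (sumℤ (y ∘ suc))) (ℤ.+-monoˡ-≤ (sumℤ (y ∘ suc)) (h zero)))

  -- The unimodular simplex contains no lattice points besides its vertices.
  find-corner : ∀ {t} (y : ℤ^ t) → (∀ j → ℤ.0ℤ ℤ.≤ y j) → sumℤ y ℤ.≤ ℤ.1ℤ → ∃[ i ] y ≗ corner i
  find-corner {zero} y _ _ = zero , λ ()
  find-corner {suc t} y y≥0 Σ≤1 with Counting.0≤z≤1 (y≥0 zero) (ℤ.≤-trans (term≤sumℤ y≥0 zero) Σ≤1)
  ... | inj₂ y₀≡1 = suc zero , λ { zero → y₀≡1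
        ; (suc j) → trans (ℤ.≤-antisym (ℤ.≤-trans (term≤sumℤ (y≥0 ∘ suc) j) rest≤0) (y≥0 (suc j))) (sym (corner-δ zero (suc j))) }
    where
    rest≤0 : sumℤ (y ∘ suc) ℤ.≤ ℤ.0ℤ
    rest≤0 = subst₂ ℤ._≤_ (trans (cong (λ z → ℤ.- ℤ.1ℤ ℤ.+ (z ℤ.+ sumℤ (y ∘ suc))) y₀≡1)
      (solve 1 (λ s → con (ℤ.- ℤ.1ℤ) :+ (con ℤ.1ℤ :+ s) := s) refl (sumℤ (y ∘ suc)))) refl
      (ℤ.+-monoʳ-≤ (ℤ.- ℤ.1ℤ) Σ≤1)
      where open +-*-Solver
  ... | inj₁ y₀≡0 with find-corner (y ∘ suc) (y≥0 ∘ suc)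
        (subst (ℤ._≤ ℤ.1ℤ) (trans (cong (ℤ._+ sumℤ (y ∘ suc)) y₀≡0) (ℤ.+-identityˡ (sumℤ (y ∘ suc)))) Σ≤1)
  ...   | zero , h = zero , λ { zero → y₀≡0 ; (suc j) → h j }
  ...   | suc i , h = suc (suc i) , λ { zero → trans y₀≡0 (sym (corner-δ (suc i) zero))
          ; (suc j) → trans (h j) (trans (corner-δ i j) (sym (corner-δ (suc i) (suc j)))) }

  ++-lookup : ∀ {A : Set} {m t} (w : Vector A (m ℕ.+ t)) → ((λ i → w (i ↑ˡ t)) ++ (λ j → w (m ↑ʳ j))) ≗ w
  ++-lookup {m = m} {t} w i with splitAt m i | Fin.join-splitAt m t i
  ... | inj₁ j | refl = refl
  ... | inj₂ j | refl = refl

  affineIso : ∀ {m n} (R : Vector (ℤ^ m) n) (S : Vector (ℤ^ n) m) →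
    (∀ w → (λ i → dot (R i) (λ k → dot (S k) w)) ≗ w) → (∀ z → (λ k → dot (S k) (λ i → dot (R i) z)) ≗ z) →
    ℤ^ n → AffineLatticeIso m n
  affineIso {m} {n} R S RS SR o = record
    { to = record { matrix = R ; offset = o }
    ; from = record { matrix = S ; offset = λ k → ℤ.- dot (S k) o }
    ; from∘to = λ z k → trans (cong (ℤ._- dot (S k) o) (dot-+ʳ (S k) (λ i → dot (R i) z) o))
        (trans (cancel (dot (S k) (λ i → dot (R i) z)) (dot (S k) o)) (SR z k))
    ; to∘from = λ w i → trans
        (cong (ℤ._+ o i) (trans (dot-+ʳ (R i) (λ k → dot (S k) w) (λ k → ℤ.- dot (S k) o))
          (cong₂ ℤ._+_ (RS w i) (trans (trans (dot-comm (R i) _) (dot-negˡ (λ k → dot (S k) o) (R i)))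
            (cong ℤ.-_ (trans (dot-comm (λ k → dot (S k) o) (R i)) (RS o i)))))))
        (uncancel (w i) (o i)) }
    where
    open +-*-Solver
    cancel : ∀ u v → u ℤ.+ v ℤ.- v ≡ u
    cancel = solve 2 (λ u v → u :+ v :- v := u) refl
    uncancel : ∀ u v → u ℤ.- v ℤ.+ v ≡ u
    uncancel = solve 2 (λ u v → u :- v :+ v := u) refl

  -- The translation is zero on the completing coordinates and `o` on the last `t`, where it turns
  -- linear forms into affine ones such as facet distances.
  completionIso : ∀ {t n} {X : Fin t → ℤ^ n} (C : Completion X) (o : ℤ^ t) →
    Σ[ φ ∈ AffineLatticeIso n (Completion.m C ℕ.+ t) ]
      (∀ z → AffineMap.applyℤ (AffineLatticeIso.to φ) z ≗ (Completion.f C z ++ (λ j → dot (X j) z ℤ.+ o j)))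
  completionIso {t} {n} {X} C o = affineIso R S RS SR ((λ _ → ℤ.0ℤ) ++ o) , to≗
    where
    open Completion C
    R : Vector (ℤ^ n) (m ℕ.+ t)
    R = (λ i → Linear.coefficients (f-linear i)) ++ X
    S : Vector (ℤ^ (m ℕ.+ t)) n
    S k = Linear.coefficients (g-linear k)
    R≗ : ∀ z → (λ i → dot (R i) z) ≗ (f z ++ (λ j → dot (X j) z))
    R≗ z i with splitAt m i
    ... | inj₁ j = sym (Linear.value (f-linear j) z)
    ... | inj₂ j = refl
    RS : ∀ w → (λ i → dot (R i) (λ k → dot (S k) w)) ≗ w
    RS w i = begin
      dot (R i) (λ k → dot (S k) w)
        ≡⟨ dot-congʳ (R i) (λ k → trans (dot-congʳ (S k) (λ j → sym (++-lookup {m = m} w j)))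
             (sym (Linear.value (g-linear k) (y , ξ)))) ⟩
      dot (R i) (g y ξ)
        ≡⟨ R≗ (g y ξ) i ⟩
      (f (g y ξ) ++ (λ j → dot (X j) (g y ξ))) i
        ≡⟨ ++-cong (f∘g y ξ) (X∘g y ξ) i ⟩
      (y ++ ξ) i
        ≡⟨ ++-lookup {m = m} w i ⟩
      w i ∎
      where
      open ≡-Reasoning
      y : ℤ^ m
      y i = w (i ↑ˡ t)
      ξ : ℤ^ t
      ξ j = w (m ↑ʳ j)
    SR : ∀ z → (λ k → dot (S k) (λ i → dot (R i) z)) ≗ z
    SR z k = trans (dot-congʳ (S k) (R≗ z))
      (trans (sym (Linear.value (g-linear k) (f z , (λ j → dot (X j) z)))) (g∘f z k))
    to≗ : ∀ z → (λ i → dot (R i) z ℤ.+ ((λ _ → ℤ.0ℤ) ++ o) i) ≗ (f z ++ (λ j → dot (X j) z ℤ.+ o j))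
    to≗ z i with splitAt m i
    ... | inj₁ j = trans (ℤ.+-identityʳ _) (sym (Linear.value (f-linear j) z))
    ... | inj₂ j = refl

  ι-++ : ∀ {m t} (u : ℤ^ m) (v : ℤ^ t) → ι (u ++ v) ≋ ι u ++ ι v
  ι-++ {m} u v i with splitAt m i
  ... | inj₁ j = ≈-refl {fromℤ (u j)}
  ... | inj₂ j = ≈-refl {fromℤ (v j)}

  ++-congℝ : ∀ {m t} {u u′ : ℝ^ m} {v v′ : ℝ^ t} → u ≋ u′ → v ≋ v′ → (u ++ v) ≋ (u′ ++ v′)
  ++-congℝ {m} p q i with splitAt m i
  ... | inj₁ j = p j
  ... | inj₂ j = q j

  combination-++ : ∀ {r m t} (c : ℝ^ r) (p : Vector (ℝ^ m) r) (v : ℝ^ t) → sum c ≈ 1ℝ →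
    combination c (λ l → p l ++ v) ≋ combination c p ++ v
  combination-++ {m = m} c p v Σc≈1 i with splitAt m i
  ... | inj₁ j = ≈-refl {combination c p j}
  ... | inj₂ j = dot-const c Σc≈1 (v j)

  -- `index` sorts the generators of `P` into fibres over the corners. `at` shows that no fibre is
  -- empty, as a summand needs at least one generator.
  record CornerMap {n} (P : LatticePolytope n) (m t : ℕ) : Set where
    open LatticePolytope P
    field
      φ        : AffineLatticeIso n (m ℕ.+ t)
      f        : ℤ^ n → ℤ^ m
      index    : Fin (suc size) → Fin (suc t)
      at       : Fin (suc t) → Fin (suc size)
      index-at : ∀ i → index (at i) ≡ i
      φ≗       : ∀ l → AffineMap.applyℤ (AffineLatticeIso.to φ) (generator l) ≗ (f (generator l) ++ corner (index l))

  module _ {m t n} {P : LatticePolytope n} (C : CornerMap P m t) where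
    open LatticePolytope P
    open CornerMap C
    open AffineLatticeIso φ using (to)
    open AffineMap to using (applyℝ; applyℤ)

    choose : Fin (suc t) → Fin (suc size) → Fin (suc size)
    choose i l with index l Fin.≟ i
    ... | yes _ = l
    ... | no _  = at i

    index-choose : ∀ i l → index (choose i l) ≡ i
    index-choose i l with index l Fin.≟ i
    ... | yes e = e
    ... | no _  = index-at i

    choose-index : ∀ l → choose (index l) l ≡ l
    choose-index l with index l Fin.≟ index l
    ... | yes _ = refl
    ... | no ne = contradiction refl ne

    -- The generators of P outside the i-th fibre are replaced by one inside it.
    summand : Vector (LatticePolytope m) (suc t)
    summand i = record { size = size ; generator = λ l → f (generator (choose i l)) }

    φ-vertex : ∀ l → applyℝ (vertex P l) ≋ ι (f (generator l)) ++ ι (corner (index l))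
    φ-vertex l = ≋-trans {x = applyℝ (vertex P l)} {ι (applyℤ (generator l))} {ι (f (generator l)) ++ ι (corner (index l))}
      (applyℝ-ι to (generator l))
      (≋-trans {x = ι (applyℤ (generator l))} {ι (f (generator l) ++ corner (index l))} {ι (f (generator l)) ++ ι (corner (index l))}
        (λ i → RealField.fromℚ-cong (cong (ℚ._/ 1) (φ≗ l i))) (ι-++ (f (generator l)) (corner (index l))))

    ≅-Cayley : ⟦ P ⟧ ≅ Cayley summand
    ≅-Cayley = φ , mapsOnto-conv to P into onto
      where
      into : ∀ l → ∃[ i ] ∃[ x ] (x ∈ ⟦ summand i ⟧ × applyℝ (vertex P l) ≋ x ++ ι (corner i))
      into l = index l , vertex (summand (index l)) l , vertex∈ (summand (index l)) l ,
        subst (λ l′ → applyℝ (vertex P l) ≋ ι (f (generator l′)) ++ ι (corner (index l))) (sym (choose-index l)) (φ-vertex l)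
      onto : ∀ y → ∃[ i ] ∃[ x ] (x ∈ ⟦ summand i ⟧ × y ≋ x ++ ι (corner i)) → ∃[ x ] (x ∈ ⟦ P ⟧ × applyℝ x ≋ y)
      onto y (i , x , x∈ , y≋) = combination weight p , convex P weight p nonneg total (λ l → vertex∈ P (choose i l)) ,
        ≋-trans {x = applyℝ (combination weight p)} {combination weight (λ l → applyℝ (p l))} {y} (applyℝ-combination to weight p total)
        (≋-trans {x = combination weight (λ l → applyℝ (p l))} {combination weight (λ l → vertex (summand i) l ++ ι (corner i))} {y}
          (combination-congʳ weight {λ l → applyℝ (p l)} {λ l → vertex (summand i) l ++ ι (corner i)} φ-p)
          (≋-trans {x = combination weight (λ l → vertex (summand i) l ++ ι (corner i))}
              {combination weight (vertex (summand i)) ++ ι (corner i)} {y}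
            (combination-++ weight (vertex (summand i)) (ι (corner i)) total)
            (≋-trans {x = combination weight (vertex (summand i)) ++ ι (corner i)} {x ++ ι (corner i)} {y}
              (++-congℝ {u = combination weight (vertex (summand i))} {x} (≋-sym {x = x} {combination weight (vertex (summand i))} point) (≋-refl {x = ι (corner i)}))
              (≋-sym {x = y} {x ++ ι (corner i)} y≋))))
        where
        open Weights (to-weights (summand i) {x} x∈)
        p : Fin (suc size) → ℝ^ n
        p l = vertex P (choose i l)
        φ-p : ∀ l → applyℝ (p l) ≋ vertex (summand i) l ++ ι (corner i)
        φ-p l = subst (λ i′ → applyℝ (p l) ≋ vertex (summand i) l ++ ι (corner i′)) (index-choose i l) (φ-vertex (choose i l))

  -- With no coordinates beside the last `t`, the image of a generator is a corner, and `at` reaches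
  -- every corner.
  ≅-Δ : ∀ {m t n} {P : LatticePolytope n} → CornerMap P m t → m ≡ 0 → m ℕ.+ t ≡ n → ⟦ P ⟧ ≅ ⟦ Δ n ⟧
  ≅-Δ {t = t} {P = P} C refl refl = φ , mapsOnto-conv to P into onto
    where
    open CornerMap C
    open AffineLatticeIso φ using (to)
    open AffineMap to using (applyℝ)
    into : ∀ l → ∃[ j ] applyℝ (vertex P l) ≋ ι (corner j)
    into l = index l , φ-vertex C l
    onto : ∀ y → ∃[ j ] y ≋ ι (corner j) → ∃[ x ] (x ∈ ⟦ P ⟧ × applyℝ x ≋ y)
    onto y (j , y≋) = vertex P (at j) , vertex∈ P (at j) ,
      ≋-trans {x = applyℝ (vertex P (at j))} {ι (corner j)} {y}
        (subst (λ j′ → applyℝ (vertex P (at j)) ≋ ι (corner j′)) (index-at j) (proj₂ (into (at j))))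
        (≋-sym {x = y} {ι (corner j)} y≋)

  -- The `t + 1` forms of the decomposition are the `χ` and `1 - Σ χ`; the last two hypotheses say
  -- that none of them vanishes on all generators. The clause for `m ≡ 0` serves the one case in
  -- which the bound on `m` can fail.
  cayley-decomposition : ∀ {n t} (P : LatticePolytope n) (X : Fin t → ℤ^ n) (o : ℤ^ t) →
    let χ = λ l j → dot (X j) (LatticePolytope.generator P l) ℤ.+ o j in
    (∀ l j → ℤ.0ℤ ℤ.≤ χ l j) → (∀ l → sumℤ (χ l) ℤ.≤ ℤ.1ℤ) →
    (∀ j → ∃[ l ] ℤ.0ℤ ℤ.< χ l j) → (∃[ l ] sumℤ (χ l) ℤ.≤ ℤ.0ℤ) →
    ∃[ m ] (m ℕ.+ t ≡ n × (∃[ Q ] (⟦ P ⟧ ≅ Cayley {m} {t} Q)) × (m ≡ 0 → ⟦ P ⟧ ≅ ⟦ Δ n ⟧))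
  cayley-decomposition {n} {t} P X o χ≥0 Σχ≤1 attained origin =
    m , m+t≡n , (summand corners , ≅-Cayley corners) , (λ m≡0 → ≅-Δ corners m≡0 m+t≡n)
    where
    open LatticePolytope P
    χ : Fin (suc size) → ℤ^ t
    χ l j = dot (X j) (generator l) ℤ.+ o j
    index : Fin (suc size) → Fin (suc t)
    index l = proj₁ (find-corner (χ l) (χ≥0 l) (Σχ≤1 l))
    χ≗ : ∀ l → χ l ≗ corner (index l)
    χ≗ l = proj₂ (find-corner (χ l) (χ≥0 l) (Σχ≤1 l))
    at : Fin (suc t) → Fin (suc size)
    at zero    = proj₁ origin
    at (suc j) = proj₁ (attained j)
    at-origin : ∀ i → (∀ j → corner i j ℤ.≤ ℤ.0ℤ) → i ≡ zero
    at-origin zero    _ = refl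
    at-origin (suc j) h = contradiction (subst (ℤ._≤ ℤ.0ℤ) (corner-diagonal j) (h j)) λ { (ℤ.+≤+ ()) }
      where
      corner-diagonal : ∀ j → corner (suc j) j ≡ ℤ.1ℤ
      corner-diagonal j with j Fin.≟ j
      ... | yes _ = refl
      ... | no ne = contradiction refl ne
    index-at : ∀ i → index (at i) ≡ i
    index-at zero = at-origin (index (at zero)) (λ j → subst (ℤ._≤ ℤ.0ℤ) (χ≗ (at zero) j)
      (ℤ.≤-trans (term≤sumℤ (χ≥0 (at zero)) j) (proj₂ origin)))
    index-at (suc j) = corner>0 (index (at (suc j))) j (subst (ℤ.0ℤ ℤ.<_) (χ≗ (at (suc j)) j) (proj₂ (attained j)))
    W : Fin t → ℤ^ n
    W j k = generator (at (suc j)) k ℤ.+ ℤ.- ℤ.1ℤ ℤ.* generator (at zero) k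
    χ-at : ∀ i j → χ (at i) j ≡ corner i j
    χ-at i j = trans (χ≗ (at i) j) (cong (λ i′ → corner i′ j) (index-at i))
    dual : ∀ i j → dot (X i) (W j) ≡ δ i j
    dual i j = begin
      dot (X i) (W j)
        ≡⟨ dot-+ʳ (X i) (generator (at (suc j))) (λ k → ℤ.- ℤ.1ℤ ℤ.* generator (at zero) k) ⟩
      dot (X i) (generator (at (suc j))) ℤ.+ dot (X i) (λ k → ℤ.- ℤ.1ℤ ℤ.* generator (at zero) k)
        ≡⟨ cong (λ z → dot (X i) (generator (at (suc j))) ℤ.+ z) (dot-*ʳ (ℤ.- ℤ.1ℤ) (X i) (generator (at zero))) ⟩
      dot (X i) (generator (at (suc j))) ℤ.+ ℤ.- ℤ.1ℤ ℤ.* dot (X i) (generator (at zero))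
        ≡⟨ solve 3 (λ u v o → u :+ con (ℤ.- ℤ.1ℤ) :* v := (u :+ o) :+ (:- (v :+ o))) refl
             (dot (X i) (generator (at (suc j)))) (dot (X i) (generator (at zero))) (o i) ⟩
      χ (at (suc j)) i ℤ.- χ (at zero) i
        ≡⟨ cong₂ ℤ._-_ (χ-at (suc j) i) (χ-at zero i) ⟩
      corner (suc j) i ℤ.+ ℤ.0ℤ
        ≡⟨ ℤ.+-identityʳ (corner (suc j) i) ⟩
      corner (suc j) i
        ≡⟨ trans (corner-δ j i) (δ-sym j i) ⟩
      δ i j ∎
      where
      open ≡-Reasoning
      open +-*-Solver
    completion : Completion X
    completion = complete X W dual
    open Completion completion using (m; m+t≡n; f)
    iso : Σ[ φ ∈ AffineLatticeIso n (m ℕ.+ t) ]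
      (∀ z → AffineMap.applyℤ (AffineLatticeIso.to φ) z ≗ (f z ++ (λ j → dot (X j) z ℤ.+ o j)))
    iso = completionIso completion o
    corners : CornerMap P m t
    corners = record
      { φ = proj₁ iso ; f = f ; index = index ; at = at ; index-at = index-at
      ; φ≗ = λ l i → trans (proj₂ iso (generator l) i) (++-cong {u = f (generator l)} (λ _ → refl) (χ≗ l) i) }

-- Facet inequalities and the linear program of the ℚ-codegree.

module Facets where
  open import Data.Rational.Solver using (module +-*-Solver)
  open RationalArithmetic using (argmin; /1-*; /1-mono-≤; /1-mono-<; /1-injective; *-monoˡ; *-monoˡ-<; *-cancelˡ-≤; sum-mono-≤)
  module Q = RationalArithmetic
  open RealField
  open Polytopes using (⟨⟩-cong; ⟨⟩-combination; ⟨⟩-ι; seq-⟨⟩; dot-const; valid; 0≤-sub; sub-0≤)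
  module R = Polytopes.ℝSums

  /1-neg : ∀ z → (ℤ.- z) ℚ./ 1 ≡ ℚ.- (z ℚ./ 1)
  /1-neg z = trans (cong (ℚ._/ 1) (sym (ℤ.-1*i≡-i z))) (trans (/1-* (ℤ.- ℤ.1ℤ) z)
    (solve 1 (λ x → con (ℚ.- 1ℚ) :* x := :- x) refl (z ℚ./ 1)))
    where open +-*-Solver

  -- If all coordinates vanished, 2 would be a common divisor.
  nonzero-coordinate : ∀ {n} {a : ℤ^ n} → Primitive a → ∃[ k ] a k ≢ ℤ.0ℤ
  nonzero-coordinate {n} {a} prim = Fin.¬∀⟶∃¬ n (λ k → a k ≡ ℤ.0ℤ) (λ k → a k ℤ.≟ ℤ.0ℤ) λ a≡0 →
    contradiction (prim 2 (λ i → subst (λ z → 2 ℕ.∣ ℤ.∣ z ∣) (sym (a≡0 i)) (2 ℕ.∣0))) λ ()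

  rational : ∀ {n} → Vector ℚ n → ℝ^ n
  rational x j = fromℚ (x j)

  ⟨⟩-rational : ∀ {n} (a : ℤ^ n) x → ⟨ a , rational x ⟩ ≈ fromℚ (Q.dot (λ k → a k ℚ./ 1) x)
  ⟨⟩-rational a x = ≈-pointwise {⟨ a , rational x ⟩} {fromℚ (Q.dot (λ k → a k ℚ./ 1) x)} (seq-⟨⟩ a (rational x))

  ⟨⟩-constant : ∀ {r n} (a : ℤ^ n) β (c : ℝ^ r) (p : Vector (ℝ^ n) r) {x : ℝ^ n} → x ≋ combination c p → sum c ≈ 1ℝ →
    (∀ j → ⟨ a , p j ⟩ ≈ β) → ⟨ a , x ⟩ ≈ β
  ⟨⟩-constant a β c p {x} x≋ Σc≈1 h = begin
    ⟨ a , x ⟩                    ≈⟨ ⟨⟩-cong a x≋ ⟩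
    ⟨ a , combination c p ⟩      ≈⟨ ⟨⟩-combination a c p ⟩
    R.dot c (λ j → ⟨ a , p j ⟩)  ≈⟨ R.dot-congʳ c h ⟩
    R.dot c (λ _ → β)            ≈⟨ dot-const c Σc≈1 β ⟩
    β ∎
    where open import Relation.Binary.Reasoning.Setoid (CommutativeRing.setoid ℝ-commutativeRing)

  coordinate-point : ∀ {n} (a : ℤ^ n) k → a k ≢ ℤ.0ℤ → ∀ β → ∃[ x ] Q.dot (λ j → a j ℚ./ 1) x ≡ β
  coordinate-point a k ak≢0 β = (λ j → q ℚ.* Q.δ k j) ,
    trans (Q.dot-*ʳ q A (Q.δ k)) (trans (cong (q ℚ.*_) (trans (Q.dot-comm A (Q.δ k)) (Q.dot-δ k A)))
      (trans (ℚ.*-assoc β (ℚ.1/ A k) (A k)) (trans (cong (β ℚ.*_) (ℚ.*-inverseˡ (A k))) (ℚ.*-identityʳ β))))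
    where
    A : Vector ℚ _
    A j = a j ℚ./ 1
    instance
      A≢0 : ℚ.NonZero (A k)
      A≢0 = ℚ.≢-nonZero (λ e → ak≢0 (/1-injective {a k} {ℤ.0ℤ} e))
    q : ℚ
    q = β ℚ.* ℚ.1/ A k

  0≉1 : ¬ (0ℝ ≈ 1ℝ)
  0≉1 h = contradiction (fromℚ-cancel-≈ {0ℚ} {1ℚ} h) λ ()

  module _ {n} (P : LatticePolytope n) where
    open LatticePolytope P

    -- If no generator lay on the hyperplane, the least value over the generators would exceed `β`
    -- and the hyperplane would miss `P`. The affine hull of the empty set is empty, as an empty sum
    -- is not 1, whereas a hyperplane with nonzero normal has a rational point. It follows that the
    -- right-hand side of a facet is an integer.
    tight-generator : ∀ (a : ℤ^ n) β → ∃[ k ] a k ≢ ℤ.0ℤ →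
      (∀ x → x ∈ hyperplane a β → x ∈ aff (λ x → x ∈ ⟦ P ⟧ × x ∈ hyperplane a β)) →
      (∀ l → β ℚ.≤ ℤSums.dot a (generator l) ℚ./ 1) →
      ∃[ l ] ℤSums.dot a (generator l) ℚ./ 1 ≡ β
    tight-generator a β (k , ak≢0) spans β≤ =
      [ (λ none → contradiction (spans (rational (proj₁ point)) on-hyperplane) (empty none {rational (proj₁ point)}))
      , (λ (l , e , _) → l , e) ]′ (argmin (λ l → value l ℚ.≟ β) (λ _ → 0ℚ))
      where
      value : Fin (suc size) → ℚ
      value l = ℤSums.dot a (generator l) ℚ./ 1
      point : ∃[ x ] Q.dot (λ j → a j ℚ./ 1) x ≡ β
      point = coordinate-point a k ak≢0 β
      on-hyperplane : rational (proj₁ point) ∈ hyperplane a β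
      on-hyperplane = ≈-trans {⟨ a , rational (proj₁ point) ⟩} {fromℚ (Q.dot (λ j → a j ℚ./ 1) (proj₁ point))} {fromℚ β}
        (⟨⟩-rational a (proj₁ point)) (fromℚ-cong (proj₂ point))
      lowest : ∃[ l ] (∀ l′ → value l ℚ.≤ value l′)
      lowest = [ (λ none → contradiction tt (none zero)) , (λ (l , _ , min) → l , λ l′ → min l′ tt) ]′
        (argmin (λ _ → yes tt) value)
      strict : (∀ l → value l ≢ β) → ∀ x → ¬ (x ∈ ⟦ P ⟧ × x ∈ hyperplane a β)
      strict none x (x∈ , on) = none (proj₁ lowest) (ℚ.≤-antisym
        (fromℚ-cancel-≤ (≤-trans {fromℚ (value (proj₁ lowest))} {⟨ a , x ⟩} {fromℚ β}
          (valid P a (value (proj₁ lowest)) (proj₂ lowest) x∈) (≈⇒≤ {⟨ a , x ⟩} {fromℚ β} on)))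
        (β≤ (proj₁ lowest)))
      empty : (∀ l → value l ≢ β) → ∀ {x} → ¬ (x ∈ aff (λ x → x ∈ ⟦ P ⟧ × x ∈ hyperplane a β))
      empty none (zero , c , p , p∈ , Σc≈1 , _) = 0≉1 Σc≈1
      empty none (suc r , c , p , p∈ , Σc≈1 , _) = strict none (p zero) (p∈ zero)

    -- Constancy spreads from the generators to `P` and to its affine hull, the whole space;
    -- comparing the origin with a unit vector gives `a k = 0`.
    not-constant : FullDimensional ⟦ P ⟧ → ∀ (a : ℤ^ n) → ∃[ k ] a k ≢ ℤ.0ℤ → ∀ (β : ℤ) →
      ¬ (∀ l → ℤSums.dot a (generator l) ≡ β)
    not-constant full a (k , ak≢0) β const = ak≢0 (trans (sym a·δ≡) (trans (everywhere (ℤSums.δ k)) (trans (sym (everywhere (λ _ → ℤ.0ℤ)))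
        (ℤSums.dot-zeroʳ a (λ _ → refl)))))
      where
      a·δ≡ : ℤSums.dot a (ℤSums.δ k) ≡ a k
      a·δ≡ = trans (ℤSums.dot-comm a (ℤSums.δ k)) (ℤSums.dot-δ k a)
      on-vertex : ∀ l {x : ℝ^ n} → x ≋ ι (generator l) → ⟨ a , x ⟩ ≈ fromℤ β
      on-vertex l {x} e = ≈-trans {⟨ a , x ⟩} {⟨ a , ι (generator l) ⟩} {fromℤ β} (⟨⟩-cong a e)
        (≈-trans {⟨ a , ι (generator l) ⟩} {fromℤ (ℤSums.dot a (generator l))} {fromℤ β}
          (⟨⟩-ι a (generator l)) (fromℚ-cong (cong (ℚ._/ 1) (const l))))
      on-P : ∀ {x} → x ∈ ⟦ P ⟧ → ⟨ a , x ⟩ ≈ fromℤ β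
      on-P {x} (r , c , p , p∈ , _ , Σc≈1 , x≋) = ⟨⟩-constant a (fromℤ β) c p {x} x≋ Σc≈1
        (λ j → on-vertex (proj₁ (p∈ j)) {p j} (proj₂ (p∈ j)))
      everywhere : ∀ z → ℤSums.dot a z ≡ β
      everywhere z = let r , c , p , p∈ , Σc≈1 , x≋ = full (ι z) in
        /1-injective (fromℚ-cancel-≈ (≈-trans {fromℤ (ℤSums.dot a z)} {⟨ a , ι z ⟩} {fromℤ β}
          (≈-sym {⟨ a , ι z ⟩} {fromℤ (ℤSums.dot a z)} (⟨⟩-ι a z))
          (⟨⟩-constant a (fromℤ β) c p {ι z} x≋ Σc≈1 (λ j → on-P {p j} (p∈ j)))))

  eventually-all : ∀ {M} {P : Fin M → ℕ → Set} → (∀ i → Eventually (P i)) → Eventually (λ k → ∀ i → P i k)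
  eventually-all {zero}  h = 0 , λ _ _ ()
  eventually-all {suc M} {P} h = eventually-map₂ (λ k p ps → λ { zero → p ; (suc i) → ps i })
    (h zero) (eventually-all {M} {λ i → P (suc i)} (h ∘ suc))

  ≤-bound : ∀ x → ∃[ B ] (x ≤ fromℚ B × fromℚ (ℚ.- B) ≤ x)
  ≤-bound x = let B , _ , h = bounded x in B
    , (λ ε ε>0 → eventually-map (λ k le → weaken (ℚ.<⇒≤ ε>0) (ℚ.≤-trans (p≤∣p∣ (seq x k)) le)) h)
    , (λ ε ε>0 → eventually-map (λ k le → weaken (ℚ.<⇒≤ ε>0)
         (subst (ℚ.- B ℚ.≤_) (neg-neg (seq x k)) (ℚ.neg-antimono-≤ (ℚ.≤-trans (-p≤∣p∣ (seq x k)) le)))) h)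
    where
    neg-neg : ∀ p → ℚ.- (ℚ.- p) ≡ p
    neg-neg = solve 1 (λ p → :- (:- p) := p) refl
      where open +-*-Solver
    weaken : ∀ {s t ε} → 0ℚ ℚ.≤ ε → s ℚ.≤ t → s ℚ.≤ t ℚ.+ ε
    weaken {s} {t} {ε} h le = ℚ.≤-trans le (subst (ℚ._≤ t ℚ.+ ε) (ℚ.+-identityʳ t) (ℚ.+-monoʳ-≤ t h))

  p+1≰p : ∀ {p} → ¬ (p ℚ.+ 1ℚ ℚ.≤ p)
  p+1≰p {p} h = ℚ.<-irrefl refl (ℚ.<-≤-trans (subst (ℚ._< p ℚ.+ 1ℚ) (ℚ.+-identityʳ p) (ℚ.+-monoʳ-< p Q.0<1)) h)

  module Codegree {M n} (a : Fin M → ℤ^ n) (b : Vector ℚ M) where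

    A : Fin M → Vector ℚ n
    A i k = a i k ℚ./ 1

    Feasible : ℝ → Set
    Feasible s = 0ℝ < s × Satisfiable {A = ℝ^ n} (λ x → ∀ i → s ≤ ⟨ a i , x ⟩ - fromℚ (b i))

    rational-feasible : ∀ {s} → 0ℚ ℚ.< s → ∃[ x ] (∀ i → s ℚ.≤ Q.dot (A i) x ℚ.- b i) → Feasible (fromℚ s)
    rational-feasible {s} s>0 (x , h) = (s , s>0 , 0 , λ _ _ → ℚ.≤-reflexive (ℚ.+-identityˡ s)) , rational x ,
      λ i → ≤-pointwise {fromℚ s} {⟨ a i , rational x ⟩ - fromℚ (b i)}
        (λ k → subst (s ℚ.≤_) (cong (ℚ._- b i) (sym (seq-⟨⟩ (a i) (rational x) k))) (h i))

    -- The real point is frozen at a late index: there `s` is at least some rational ε > 0, and each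
    -- of the finitely many constraints is violated by at most ε/2, which leaves ε/2.
    feasible-rational : ∀ {s} → Feasible s → ∃[ ε ] (0ℚ ℚ.< ε × (∃[ x ] (∀ i → ε ℚ.≤ Q.dot (A i) x ℚ.- b i)))
    feasible-rational {s} ((ε , ε>0 , large) , y , h) = ε ℚ.* ½ , half ε>0 , eventually-const {A = Point} (eventually-map₂ {R = λ _ → Point} close
      large (eventually-all (λ i → h i (ε ℚ.* ½) (half ε>0))))
      where
      Point : Set
      Point = ∃[ x ] (∀ i → ε ℚ.* ½ ℚ.≤ Q.dot (A i) x ℚ.- b i)
      close : ∀ k → seq 0ℝ k ℚ.+ ε ℚ.≤ seq s k →
        (∀ i → seq s k ℚ.≤ (seq ⟨ a i , y ⟩ k ℚ.- b i) ℚ.+ ε ℚ.* ½) → Point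
      close k le hk = (λ j → seq (y j) k) , λ i → subst₂ ℚ._≤_
        (trans (cong (ℚ._- ε ℚ.* ½) (sym (halves ε))) (cancel (ε ℚ.* ½) (ε ℚ.* ½)))
        (trans (cancel (seq ⟨ a i , y ⟩ k ℚ.- b i) (ε ℚ.* ½)) (cong (ℚ._- b i) (seq-⟨⟩ (a i) y k)))
        (ℚ.+-monoˡ-≤ (ℚ.- (ε ℚ.* ½)) (ℚ.≤-trans (subst (ℚ._≤ seq s k) (ℚ.+-identityˡ ε) le) (hk i)))
        where
        cancel : ∀ u v → u ℚ.+ v ℚ.- v ≡ u
        cancel = solve 2 (λ u v → u :+ v :- v := u) refl
          where open +-*-Solver

    record Certificate (s : ℚ) : Set where
      field
        point  : ∃[ x ] (∀ i → s ℚ.≤ Q.dot (A i) x ℚ.- b i)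
        c      : Vector ℚ M
        c≥0    : ∀ i → 0ℚ ℚ.≤ c i
        Σc≡1   : Q.sum c ≡ 1ℚ
        cA≡0   : ∀ k → Q.dot c (λ i → A i k) ≡ 0ℚ
        cb≡-s  : Q.dot c b ≡ ℚ.- s

      evaluate : ∀ x → Q.dot c (λ i → Q.dot (A i) x ℚ.- b i) ≡ s
      evaluate x = begin
        Q.dot c (λ i → Q.dot (A i) x ℚ.- b i)
          ≡⟨ Q.dot-+ʳ c (λ i → Q.dot (A i) x) (λ i → ℚ.- b i) ⟩
        Q.dot c (λ i → Q.dot (A i) x) ℚ.+ Q.dot c (λ i → ℚ.- b i)
          ≡⟨ cong₂ ℚ._+_ (trans (Q.dot-assoc c A x) (Q.dot-zeroˡ x cA≡0))
               (trans (Q.dot-comm c (λ i → ℚ.- b i)) (trans (Q.dot-negˡ b c) (cong ℚ.-_ (trans (Q.dot-comm b c) cb≡-s)))) ⟩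
        0ℚ ℚ.+ ℚ.- (ℚ.- s)
          ≡⟨ solve 1 (λ s → con 0ℚ :+ :- (:- s) := s) refl s ⟩
        s ∎
        where
        open ≡-Reasoning
        open +-*-Solver

      weak-duality : ∀ {t} x → (∀ i → t ℚ.≤ Q.dot (A i) x ℚ.- b i) → t ℚ.≤ s
      weak-duality {t} x h = subst₂ ℚ._≤_
        (trans (sym (Q.*-distribʳ-sum t c)) (trans (cong (ℚ._* t) Σc≡1) (ℚ.*-identityˡ t))) (evaluate x)
        (sum-mono-≤ (λ i → *-monoˡ (c≥0 i) (h i)))

    -- An unbounded program would have feasible values beyond every rational bound of `σ`. Of the
    -- comparison with `σ` only `s ≤ σ` is kept: it makes 1/s, the later sum of the weights, at
    -- least μ(P).
    certificate : ∀ {σ} → IsSupremum Feasible σ → ∃[ s ] (0ℚ ℚ.< s × Certificate s × fromℚ s ≤ σ)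
    certificate {σ} (upper , least) = [ unbounded , attained ]′ (FourierMotzkin.max-min-duality A b)
      where
      B : ℚ
      B = proj₁ (≤-bound σ)
      unbounded : (∀ s → ∃[ x ] (∀ i → s ℚ.≤ Q.dot (A i) x ℚ.- b i)) → ∃[ s ] (0ℚ ℚ.< s × Certificate s × fromℚ s ≤ σ)
      unbounded h = contradiction (fromℚ-cancel-≤ {t} {B} (≤-trans {fromℚ t} {σ} {fromℚ B}
          (upper (fromℚ t) (rational-feasible t>0 (h t))) (proj₁ (proj₂ (≤-bound σ)))))
          (λ le → p+1≰p (ℚ.≤-trans (ℚ.+-monoˡ-≤ 1ℚ (p≤∣p∣ B)) le))
        where
        t : ℚ
        t = ℚ.∣ B ∣ ℚ.+ 1ℚ
        t>0 : 0ℚ ℚ.< t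
        t>0 = ℚ.+-mono-≤-< (ℚ.0≤∣p∣ B) Q.0<1
      attained : ∃[ s ] ((∃[ x ] (∀ i → s ℚ.≤ Q.dot (A i) x ℚ.- b i)) ×
        ∃[ c ] ((∀ i → 0ℚ ℚ.≤ c i) × Q.sum c ≡ 1ℚ × (∀ k → Q.dot c (λ i → A i k) ≡ 0ℚ) × Q.dot c b ≡ ℚ.- s)) →
        ∃[ s ] (0ℚ ℚ.< s × Certificate s × fromℚ s ≤ σ)
      attained (s , x , c , c≥0 , Σc≡1 , cA≡0 , cb≡-s) = s , s>0 , cert , upper (fromℚ s) (rational-feasible s>0 x)
        where
        cert : Certificate s
        cert = record { point = x ; c = c ; c≥0 = c≥0 ; Σc≡1 = Σc≡1 ; cA≡0 = cA≡0 ; cb≡-s = cb≡-s }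
        infeasible : s ℚ.≤ 0ℚ → ∀ t → ¬ Feasible t
        infeasible s≤0 t t∈ = let ε , ε>0 , x , h = feasible-rational {t} t∈ in
          ℚ.<-irrefl refl (ℚ.<-≤-trans ε>0 (ℚ.≤-trans (Certificate.weak-duality cert x h) s≤0))
        -- If `s ≤ 0`, nothing is feasible, every real is an upper bound, and leastness pushes `σ`
        -- below its own lower bound `- B`.
        s≰0 : ¬ (s ℚ.≤ 0ℚ)
        s≰0 s≤0 = p+1≰p (ℚ.≤-trans (ℚ.≤-reflexive (cancel (ℚ.- B))) (fromℚ-cancel-≤ {ℚ.- B} {ℚ.- B ℚ.- 1ℚ} (≤-trans {fromℚ (ℚ.- B)} {σ} {fromℚ (ℚ.- B ℚ.- 1ℚ)}
          (proj₂ (proj₂ (≤-bound σ))) (least (fromℚ (ℚ.- B ℚ.- 1ℚ)) (λ t t∈ → contradiction t∈ (infeasible s≤0 t))))))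
          where
          cancel : ∀ u → u ℚ.- 1ℚ ℚ.+ 1ℚ ≡ u
          cancel = solve 1 (λ u → u :- con 1ℚ :+ con 1ℚ := u) refl
            where open +-*-Solver
        s>0 : 0ℚ ℚ.< s
        s>0 = ℚ.≰⇒> s≰0

  *-monoˡ-≤ℝ : ∀ {x y z} → 0ℝ ≤ x → y ≤ z → x * y ≤ x * z
  *-monoˡ-≤ℝ {x} {y} {z} x≥0 h = sub-0≤ {x * y} {x * z} (≤-trans {0ℝ} {x * (z - y)} {x * z - x * y}
    (0≤-*ℝ {x} {z - y} x≥0 (0≤-sub {y} {z} h))
    (≈⇒≤ {x * (z - y)} {x * z - x * y} (≈-pointwise {x * (z - y)} {x * z - x * y} (λ k →
      solve 3 (λ x y z → x :* (z :- y) := x :* z :- x :* y) refl (seq x k) (seq y k) (seq z k)))))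
    where open +-*-Solver

  2ℚ : ℚ
  2ℚ = Counting.2ℚ

  -- For integral μ = k the left side is 2k - 1, and k ≤ 1/s suffices. Otherwise it is 2⌊μ⌋, and
  -- strictness comes from μ differing from its floor.
  codegree-bound : ∀ {n μ d σ s r} → IsD n μ d → d ℤ.< ℤ.+ n → μ * σ ≈ 1ℝ → 0ℚ ℚ.< s → fromℚ s ≤ σ → s ℚ.* r ≡ 1ℚ →
    (ℤ.+ (n ℕ.+ n) ℤ.- d) ℚ./ 1 ℚ.< 2ℚ ℚ.* r
  codegree-bound {n} {μ} {_} {σ} {s} {r} (integral {k} μ≈k) _ μσ≈1 s>0 s≤σ sr≡1 = ℚ.<-≤-trans
    (/1-mono-< {ℤ.+ (n ℕ.+ n) ℤ.- (ℤ.+ 2 ℤ.* (ℤ.+ n ℤ.- ℤ.+ k) ℤ.+ ℤ.+ 1)} {ℤ.+ 2 ℤ.* ℤ.+ k} (subst (ℤ._< ℤ.+ 2 ℤ.* ℤ.+ k)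
      (solve 2 (λ n k → :- con (ℤ.+ 1) :+ con (ℤ.+ 2) :* k := (n :+ n) :- (con (ℤ.+ 2) :* (n :- k) :+ con (ℤ.+ 1))) refl (ℤ.+ n) (ℤ.+ k))
      (subst (ℤ.- ℤ.+ 1 ℤ.+ ℤ.+ 2 ℤ.* ℤ.+ k ℤ.<_) (ℤ.+-identityˡ (ℤ.+ 2 ℤ.* ℤ.+ k)) (ℤ.+-monoˡ-< (ℤ.+ 2 ℤ.* ℤ.+ k) ℤ.-<+))))
    (subst (ℚ._≤ 2ℚ ℚ.* r) (sym (/1-* (ℤ.+ 2) (ℤ.+ k))) (*-monoˡ {2ℚ} (ℚ.nonNegative⁻¹ 2ℚ) k≤r))
    where
    open ℤSolver.+-*-Solver
    K : ℚ
    K = ℤ.+ k ℚ./ 1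
    Ks≤1 : K ℚ.* s ℚ.≤ 1ℚ
    Ks≤1 = fromℚ-cancel-≤ {K ℚ.* s} {1ℚ} (≤-trans {fromℚ (K ℚ.* s)} {fromℚ K * σ} {1ℝ}
      (*-monoˡ-≤ℝ {fromℚ K} {fromℚ s} {σ} (fromℚ-mono (/1-mono-≤ {ℤ.0ℤ} {ℤ.+ k} (ℤ.+≤+ ℕ.z≤n))) s≤σ)
      (≈⇒≤ {fromℚ K * σ} {1ℝ} (≈-trans {fromℚ K * σ} {μ * σ} {1ℝ} (*-congʳ {fromℚ K} {μ} σ (≈-sym {μ} {fromℚ K} μ≈k)) μσ≈1)))
    k≤r : K ℚ.≤ r
    k≤r = *-cancelˡ-≤ s>0 (subst₂ ℚ._≤_ (ℚ.*-comm K s) (sym sr≡1) Ks≤1)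
  codegree-bound {n} {μ} {_} {σ} {s} {r} (non-integral non {f} (f≤μ , _)) d<n μσ≈1 s>0 s≤σ sr≡1 = subst (λ z → z ℚ./ 1 ℚ.< 2ℚ ℚ.* r)
      (solve 2 (λ n f → con (ℤ.+ 2) :* f := (n :+ n) :- con (ℤ.+ 2) :* (n :- f)) refl (ℤ.+ n) f)
      (subst (ℚ._< 2ℚ ℚ.* r) (sym (/1-* (ℤ.+ 2) f)) (*-monoˡ-< {2ℚ} (ℚ.positive⁻¹ 2ℚ) (ℚ.≰⇒> r≰f)))
    where
    open ℤSolver.+-*-Solver
    K : ℚ
    K = f ℚ./ 1
    -- A negative floor would give `d = 2 (n - f) > n`. The sign matters because `non` excludes only
    -- natural values of μ.
    f≥0 : ℤ.0ℤ ℤ.≤ f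
    f≥0 = nonneg f d<n
      where
      nonneg : ∀ f → ℤ.+ 2 ℤ.* (ℤ.+ n ℤ.- f) ℤ.< ℤ.+ n → ℤ.0ℤ ℤ.≤ f
      nonneg (ℤ.+ f) _ = ℤ.+≤+ ℕ.z≤n
      nonneg ℤ.-[1+ f ] h = contradiction (ℤ.drop‿+<+ (subst (ℤ._< ℤ.+ n) (sym (ℤ.pos-* 2 (n ℕ.+ suc f))) h)) (ℕ.≤⇒≯ (ℕ.≤-trans (ℕ.m≤m+n n (suc f)) (ℕ.m≤m+n (n ℕ.+ suc f) _)))
    natural : ∀ f → ℤ.0ℤ ℤ.≤ f → ∃[ k ] f ≡ ℤ.+ k
    natural (ℤ.+ k) _ = k , refl
    μ≥0 : 0ℝ ≤ μ
    μ≥0 = ≤-trans {0ℝ} {fromℚ K} {μ} (fromℚ-mono (/1-mono-≤ {ℤ.0ℤ} {f} f≥0)) f≤μ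
    rotate : ∀ x y z → x ℚ.* (y ℚ.* z) ≡ x ℚ.* z ℚ.* y
    rotate x y z = trans (cong (x ℚ.*_) (ℚ.*-comm y z)) (sym (ℚ.*-assoc x z y))
    -- From `r ≤ K` follows `1 = s * r ≤ K * s ≤ K * σ`; multiplied by μ this reads `μ ≤ K`, so μ
    -- would equal its floor.
    r≰f : ¬ (r ℚ.≤ K)
    r≰f r≤f = non (proj₁ (natural f f≥0)) (subst (λ z → μ ≈ fromℤ z) (proj₂ (natural f f≥0)) (≤-antisym {μ} {fromℚ K} μ≤f f≤μ))
      where
      1≤fs : 1ℚ ℚ.≤ K ℚ.* s
      1≤fs = subst₂ ℚ._≤_ sr≡1 (ℚ.*-comm s K) (*-monoˡ (ℚ.<⇒≤ s>0) r≤f)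
      1≤fσ : 1ℝ ≤ fromℚ K * σ
      1≤fσ = ≤-trans {1ℝ} {fromℚ (K ℚ.* s)} {fromℚ K * σ} (fromℚ-mono 1≤fs)
        (*-monoˡ-≤ℝ {fromℚ K} {fromℚ s} {σ} (fromℚ-mono (/1-mono-≤ {ℤ.0ℤ} {f} f≥0)) s≤σ)
      μ≤f : μ ≤ fromℚ K
      μ≤f = ≤-trans {μ} {μ * 1ℝ} {fromℚ K} (≤-pointwise {μ} {μ * 1ℝ} (λ k → ℚ.≤-reflexive (sym (ℚ.*-identityʳ (seq μ k)))))
        (≤-trans {μ * 1ℝ} {μ * (fromℚ K * σ)} {fromℚ K} (*-monoˡ-≤ℝ {μ} {1ℝ} {fromℚ K * σ} μ≥0 1≤fσ)
          (≈⇒≤ {μ * (fromℚ K * σ)} {fromℚ K} (begin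
            μ * (fromℚ K * σ)   ≈⟨ ≈-pointwise {μ * (fromℚ K * σ)} {μ * σ * fromℚ K} (λ k → rotate (seq μ k) K (seq σ k)) ⟩
            μ * σ * fromℚ K     ≈⟨ *-congʳ {μ * σ} {1ℝ} (fromℚ K) μσ≈1 ⟩
            1ℝ * fromℚ K        ≈⟨ CommutativeRing.*-identityˡ ℝ-commutativeRing (fromℚ K) ⟩
            fromℚ K ∎)))
        where open import Relation.Binary.Reasoning.Setoid (CommutativeRing.setoid ℝ-commutativeRing)

-- Lattice distances to the facets and the final dimension count.

open import Data.Integer using (+_)

module _ {n} (P : LatticePolytope n) (full : FullDimensional ⟦ P ⟧) (F : FacetDescription ⟦ P ⟧) where
  open LatticePolytope P
  open FacetDescription F
  open Facets
  open Codegree a b using (A)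

  value : Fin count → Fin (suc size) → ℤ
  value i l = ℤSums.dot (a i) (generator l)

  b≤value : ∀ i l → b i ℚ.≤ value i l ℚ./ 1
  b≤value i l = RealField.fromℚ-cancel-≤ {b i} {value i l ℚ./ 1}
    (RealField.≤-trans {fromℚ (b i)} {⟨ a i , Polytopes.vertex P l ⟩} {fromℤ (value i l)}
      (proj₁ describes {Polytopes.vertex P l} (Polytopes.vertex∈ P l) i)
      (RealField.≈⇒≤ {⟨ a i , Polytopes.vertex P l ⟩} {fromℤ (value i l)} (Polytopes.⟨⟩-ι (a i) (generator l))))

  tight : ∀ i → ∃[ l ] value i l ℚ./ 1 ≡ b i
  tight i = tight-generator P (a i) (b i) (nonzero-coordinate (isPrimitive i)) (λ x → proj₂ (facet i) {x}) (b≤value i)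

  -- The integer form of `b i`, taken from a generator on the facet; it makes `distance` integral by
  -- construction.
  height : Fin count → ℤ
  height i = value i (proj₁ (tight i))

  distance : Fin count → Fin (suc size) → ℤ
  distance i l = value i l ℤ.+ ℤ.- height i

  distance≥0 : ∀ i l → ℤ.0ℤ ℤ.≤ distance i l
  distance≥0 i l = ℤ.i≤j⇒0≤j-i (Q./1-cancel-≤ {height i} {value i l} (subst (ℚ._≤ value i l ℚ./ 1) (sym (proj₂ (tight i))) (b≤value i l)))

  distance≢0 : ∀ i → ∃[ l ] ℤ.0ℤ ℤ.< distance i l
  distance≢0 i = proj₁ apart , ℤ.≤∧≢⇒< (distance≥0 i (proj₁ apart))
      (λ e → proj₂ apart (ℤ.i-j≡0⇒i≡j (value i (proj₁ apart)) (height i) (sym e)))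
    where
    apart : ∃[ l ] value i l ≢ height i
    apart = Fin.¬∀⟶∃¬ (suc size) (λ l → value i l ≡ height i) (λ l → value i l ℤ.≟ height i)
      (not-constant P full (a i) (nonzero-coordinate (isPrimitive i)) (height i))

  generatorℚ : Fin (suc size) → Vector ℚ n
  generatorℚ l k = generator l k ℚ./ 1

  distance-/1 : ∀ i l → distance i l ℚ./ 1 ≡ Q.dot (A i) (generatorℚ l) ℚ.- b i
  distance-/1 i l = trans (Q./1-+ (value i l) (ℤ.- height i)) (cong₂ ℚ._+_ (Counting.dot-/1 (a i) (generator l))
    (trans (/1-neg (height i)) (cong ℚ.-_ (proj₂ (tight i)))))

  -- The affine form of a facet as a vector of n + 1 coefficients; hence the bound n + 1 on the
  -- support.
  form : Fin count → Vector ℚ (suc n)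
  form i zero    = b i
  form i (suc k) = A i k

  relation : ∀ (d : Vector ℚ count) → (∀ k → Q.dot d (λ i → form i k) ≡ 0ℚ) →
             ∀ l → Q.dot d (λ i → distance i l ℚ./ 1) ≡ 0ℚ
  relation d h l = begin
    Q.dot d (λ i → distance i l ℚ./ 1)
      ≡⟨ Q.dot-congʳ d (λ i → distance-/1 i l) ⟩
    Q.dot d (λ i → Q.dot (A i) (generatorℚ l) ℚ.+ ℚ.- b i)
      ≡⟨ Q.dot-+ʳ d (λ i → Q.dot (A i) (generatorℚ l)) (λ i → ℚ.- b i) ⟩
    Q.dot d (λ i → Q.dot (A i) (generatorℚ l)) ℚ.+ Q.dot d (λ i → ℚ.- b i)
      ≡⟨ cong₂ ℚ._+_ (trans (Q.dot-assoc d A (generatorℚ l)) (Q.dot-zeroˡ (generatorℚ l) (λ k → h (suc k))))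
           (trans (Q.dot-comm d (λ i → ℚ.- b i)) (trans (Q.dot-negˡ b d) (cong ℚ.-_ (trans (Q.dot-comm b d) (h zero))))) ⟩
    0ℚ ∎
    where open ≡-Reasoning

  module _ {σ : ℝ} (sup : IsSupremum (λ s → 0ℝ < s × Satisfiable (adjoint F s)) σ) where

    optimum : ∃[ s ] (0ℚ ℚ.< s × Codegree.Certificate a b s × fromℚ s ≤ σ)
    optimum = Codegree.certificate a b {σ} sup

    s r : ℚ
    s = proj₁ optimum
    s>0 : 0ℚ ℚ.< s
    s>0 = proj₁ (proj₂ optimum)
    s≤σ : fromℚ s ≤ σ
    s≤σ = proj₂ (proj₂ (proj₂ optimum))
    open Codegree.Certificate (proj₁ (proj₂ (proj₂ optimum)))
    r = proj₁ (Q.recip s>0)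
    sr≡1 : s ℚ.* r ≡ 1ℚ
    sr≡1 = proj₂ (proj₂ (Q.recip s>0))

    -- The dual solution `c` has total 1 and combines the distances to the constant `s`; division by
    -- `s` exchanges the two normalisations.
    weights : Vector ℚ count
    weights i = r ℚ.* c i

    weights≥0 : ∀ i → 0ℚ ℚ.≤ weights i
    weights≥0 i = Q.0≤-* (ℚ.<⇒≤ (proj₁ (proj₂ (Q.recip s>0)))) (c≥0 i)

    Σweights : Q.sum weights ≡ r
    Σweights = trans (sym (Q.*-distribˡ-sum r c)) (trans (cong (r ℚ.*_) Σc≡1) (ℚ.*-identityʳ r))

    weights-unit : ∀ l → Q.dot weights (λ i → distance i l ℚ./ 1) ≡ 1ℚ
    weights-unit l = begin
      Q.dot weights (λ i → distance i l ℚ./ 1)                     ≡⟨ Q.dot-*ˡ r c (λ i → distance i l ℚ./ 1) ⟩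
      r ℚ.* Q.dot c (λ i → distance i l ℚ./ 1)                     ≡⟨ cong (r ℚ.*_) (Q.dot-congʳ c (λ i → distance-/1 i l)) ⟩
      r ℚ.* Q.dot c (λ i → Q.dot (A i) (generatorℚ l) ℚ.- b i)     ≡⟨ cong (r ℚ.*_) (evaluate (generatorℚ l)) ⟩
      r ℚ.* s                                                      ≡⟨ ℚ.*-comm r s ⟩
      s ℚ.* r                                                      ≡⟨ sr≡1 ⟩
      1ℚ ∎
      where open ≡-Reasoning

    unit-facets : ∀ {d μ} → IsD n μ d → d ℤ.< + n → μ * σ ≈ 1ℝ →
      ∃[ k ] Σ[ e ∈ (Fin k → Fin count) ] Counting.Subfamily distance distance≥0 distance≢0 k e (suc n) (+ (n ℕ.+ n) ℤ.- d)
    unit-facets {d} {μ} isD d<n μσ≈1 = Counting.unit-subfamily distance distance≥0 distance≢0 form relation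
      weights weights≥0 weights-unit (+ (n ℕ.+ n) ℤ.- d)
      (subst (λ z → (+ (n ℕ.+ n) ℤ.- d) ℚ./ 1 ℚ.< 2ℚ ℚ.* z) (sym Σweights)
        (codegree-bound {n} {μ} {d} {σ} {s} {r} isD d<n μσ≈1 s>0 s≤σ sr≡1))

  private
    <⇒0≤ : ∀ {i j} → i ℤ.< j → ℤ.0ℤ ℤ.≤ j ℤ.- (+ 1 ℤ.+ i)
    <⇒0≤ h = ℤ.i≤j⇒0≤j-i (ℤ.i<j⇒suc[i]≤j h)

    -- Between integers, `2n - d < k + n + 1` means `2n - d ≤ k + n`, and `n - k` is `m`.
    bound-proper : ∀ {m k d} → m ℕ.+ k ≡ n → + (n ℕ.+ n) ℤ.- d ℤ.< + (k ℕ.+ suc n) → + m ℤ.≤ d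
    bound-proper {m} {k} {d} refl h = ℤ.0≤i-j⇒j≤i (subst (ℤ.0ℤ ℤ.≤_)
      (solve 3 (λ m k d → (k :+ (con (+ 1) :+ (m :+ k))) :- (con (+ 1) :+ (((m :+ k) :+ (m :+ k)) :- d)) := d :- m)
        refl (+ m) (+ k) d) (<⇒0≤ h))
      where open ℤSolver.+-*-Solver

    -- The estimate gives `d ≥ 2m + 1`, and adding `m ≥ 0` weakens this to `m + 1`. With 0 in place
    -- of `suc m` it would give only `d ≥ -1`, the value of d at the unimodular simplex.
    bound-exact : ∀ {m t d} → suc m ℕ.+ t ≡ n → + (n ℕ.+ n) ℤ.- d ℤ.< + (suc t ℕ.+ suc t) → + suc m ℤ.≤ d
    bound-exact {m} {t} {d} refl h = ℤ.0≤i-j⇒j≤i (subst (ℤ.0ℤ ℤ.≤_)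
      (solve 3 (λ m t d → let n = con (+ 1) :+ (m :+ t); t′ = con (+ 1) :+ t in
          ((t′ :+ t′) :- (con (+ 1) :+ ((n :+ n) :- d))) :+ m := d :- (con (+ 1) :+ m))
        refl (+ m) (+ t) d) (ℤ.+-mono-≤ (<⇒0≤ h) (ℤ.+≤+ (ℕ.z≤n {m}))))
      where open ℤSolver.+-*-Solver

  Conclusion : ℤ → Set
  Conclusion d = ∃[ m ] ∃[ t ] ∃[ Q ] (+ m ℤ.≤ d × ⟦ P ⟧ ≅ Cayley {m} {t} Q)

  conclude : ¬ (⟦ P ⟧ ≅ ⟦ Δ n ⟧) → ∀ {d} k (e : Fin k → Fin count) →
    Counting.Subfamily distance distance≥0 distance≢0 k e (suc n) (+ (n ℕ.+ n) ℤ.- d) → Conclusion d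
  conclude _ k e (S≤1 , inj₁ ((l , S≡0) , small)) =
    let m , m+k≡n , (Q , iso) , _ = CayleyStructure.cayley-decomposition P (a ∘ e) (λ j → ℤ.- height (e j))
          (λ l j → distance≥0 (e j) l) S≤1 (λ j → distance≢0 (e j)) (l , ℤ.≤-reflexive S≡0)
    in m , k , Q , bound-proper m+k≡n small , iso
  -- An empty family sums to 0, not to 1.
  conclude _ zero e (_ , inj₂ (S≡1 , _)) = contradiction (S≡1 zero) λ ()
  -- The distances of the family add up to 1, so that of `e zero` is 1 minus the sum of the others.
  -- A generator off this facet maps to the origin: its distance there is at least 1 and leaves 0
  -- for the rest.
  conclude notΔ {d} (suc t) e (S≤1 , inj₂ (S≡1 , small)) =
    let m , m+t≡n , (Q , iso) , Δ-case = CayleyStructure.cayley-decomposition P (a ∘ e ∘ suc) (λ j → ℤ.- height (e (suc j)))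
          (λ l j → distance≥0 (e (suc j)) l) (λ l → ℤ.≤-trans (drop-first l) (S≤1 l)) (λ j → distance≢0 (e (suc j)))
          (proj₁ (distance≢0 (e zero)) , origin)
    in m , t , Q , bound m m+t≡n Δ-case , iso
    where
    rest : Fin (suc size) → ℤ
    rest l = sumℤ (λ j → distance (e (suc j)) l)
    drop-first : ∀ l → rest l ℤ.≤ distance (e zero) l ℤ.+ rest l
    drop-first l = subst (ℤ._≤ distance (e zero) l ℤ.+ rest l) (ℤ.+-identityˡ (rest l)) (ℤ.+-monoˡ-≤ (rest l) (distance≥0 (e zero) l))
    origin : rest (proj₁ (distance≢0 (e zero))) ℤ.≤ ℤ.0ℤ
    origin = ℤ.≮⇒≥ λ 0<rest → contradiction
      (subst (ℤ.1ℤ ℤ.+ ℤ.1ℤ ℤ.≤_) (S≡1 l₀) (ℤ.+-mono-≤ (ℤ.i<j⇒suc[i]≤j (proj₂ (distance≢0 (e zero)))) (ℤ.i<j⇒suc[i]≤j 0<rest)))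
      λ { (ℤ.+≤+ (ℕ.s≤s ())) }
      where
      l₀ : Fin (suc size)
      l₀ = proj₁ (distance≢0 (e zero))
    bound : ∀ m → m ℕ.+ t ≡ n → (m ≡ 0 → ⟦ P ⟧ ≅ ⟦ Δ n ⟧) → + m ℤ.≤ d
    -- All of ℤⁿ is used up by the `t` forms, and `P` would be the excluded simplex.
    bound zero    _     Δ-case = contradiction (Δ-case refl) notΔ
    bound (suc m) m+t≡n _      = bound-exact m+t≡n small

theorem3p4 : ∀ (n : ℕ) (P : LatticePolytope n) →
    FullDimensional ⟦ P ⟧ →
    ¬ (⟦ P ⟧ ≅ ⟦ Δ n ⟧) →
    ∀ (F : FacetDescription ⟦ P ⟧) (μ : ℝ) → IsℚCodegree F μ →
    ∀ (d : ℤ) → IsD n μ d →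
    d ℤ.< + n →
    ∃[ m ] ∃[ t ] ∃[ Q ]
    (+ m ℤ.≤ d × ⟦ P ⟧ ≅ Cayley {m} {t} Q)
theorem3p4 n P full notΔ F μ (σ , sup , μσ≈1) d isD d<n =
  let k , e , family = unit-facets P full F {σ} sup {d} {μ} isD d<n μσ≈1
  in conclude P full F notΔ k e family
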